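{- Let $G$ be a weakly connected oriented graph on $n\ge 2$ vertices $1,\dots,n$ with $m\ge 1$ edges $e_1,\dots,e_m$, with non-zero edge weights in $\mathbb{C}\setminus\mathbb{R}^-$ and complex signless Laplacian matrix $Q$. Then $$\det(Q)=\sum_{H\in\mathcal{U}(G)}\ \prod_{i=1}^{c(H)}2|W_{U_i\setminus C_i}|\cdot\alpha(C_i),\qquad \alpha(C_i)=\begin{cases}|wt(C_i)|-\operatorname{Re}(wt(C_i)) & \text{if } C_i \text{ is an even cycle},\\ |wt(C_i)|+\operatorname{Re}(wt(C_i)) & \text{if } C_i \text{ is an odd cycle},\end{cases}$$ where $\mathcal{U}(G)$ is the set of all spanning subgraphs $H$ of $G$ on $n$ vertices and $n$ edges whose connected components $U_1,\dots,U_{c(H)}$ are all unicyclic, with $C_i$ the cycle of $U_i$, such that $wt(C_i)\in\mathbb{C}\setminus\mathbb{R}^-$ whenever $C_i$ is odd and $wt(C_i)\in\mathbb{C}\setminus\mathbb{R}^+$ whenever $C_i$ is even. (An empty sum is $0$.)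
   Context: An oriented graph $G$ is obtained from a finite simple undirected graph $G_u$ (its underlying graph) by giving each edge exactly one direction; it is weakly connected if $G_u$ is connected. Each directed edge $(u,v)$ (from $u$ to $v$) has a non-zero complex weight $w_{uv}$. $\mathbb{R}^+$ and $\mathbb{R}^-$ denote the positive and the negative real numbers. The complex adjacency matrix is $A=(a_{ij})$ with $a_{ij}=w_{ij}$ if $(i,j)\in E(G)$, $a_{ij}=\overline{w_{ji}}$ if $(j,i)\in E(G)$, and $a_{ij}=0$ otherwise. The complex signless Laplacian matrix is $Q=D+A$, where $D$ is diagonal with $D_{ii}=\sum_{j\ne i}|a_{ij}|$. The weight of a walk $\gamma=(i_1,\dots,i_k)$ in $G_u$ is $wt(\gamma)=\prod_{s=1}^{k-1}a_{i_si_{s+1}}$. A cycle of $G$ means a cycle of $G_u$; $wt(C)$ is the weight of the closed walk going once around $C$ in either direction (the two directions give complex conjugate values, so conditions such as $wt(C)\in\mathbb{R}^\pm$ and the value $\operatorname{Re}(wt(C))$ do not depend on the choice). A unicyclic graph is a (weakly) connected graph with exactly one cycle; a spanning subgraph of $G$ has vertex set $V(G)$. $U_i\setminus C_i$ is obtained from $U_i$ by removing the edges of $C_i$, and $W_F$ is the product of all edge weights of an oriented graph $F$ (equal to $1$ if $F$ has no edges). -}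

module Defs where

open import Level using (Level) renaming (suc to lsuc)
open import Algebra.Bundles using (CommutativeRing; RawRing)
import Algebra.Definitions.RawSemiring as RawSemiringDefs
import Algebra.Properties.Ring as RingProperties
import Algebra.Solver.Ring.NaturalCoefficients.Default as SemiringSolver
open import Data.Bool.Base using (if_then_else_)
open import Data.Fin.Base as Fin using (Fin; zero; suc; toℕ; punchIn)
import Data.Fin.Properties as Fin
open import Data.Fin.Subset using (Subset; inside; outside; _∈_; ∣_∣; ⊤; _─_)
open import Data.Fin.Subset.Properties using (_∈?_; ∈⊤)
open import Data.List.Base as List using (List; []; _∷_; _++_; _∷ʳ_; length; zip; drop)
import Data.List.Membership.Propositional as List using () renaming (_∈_ to _∈ˡ_)
open import Data.List.Membership.Propositional.Properties using (∈-allFin; ∈-lookup)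
open import Data.List.Relation.Unary.All as All using (All; []; _∷_)
open import Data.List.Relation.Unary.AllPairs using ([]; _∷_)
open import Data.List.Relation.Unary.Any as Any using (Any; here; there)
open import Data.List.Relation.Unary.Unique.Propositional using (Unique)
import Data.List.Relation.Unary.Unique.DecPropositional as UniqueDec
open import Data.Nat.Base as ℕ using (ℕ; zero; suc)
import Data.Nat.Properties as ℕ
open import Data.Nat.Divisibility using (_∣_; _∣?_)
open import Data.Product.Base using (∃; _×_; _,_; proj₁; proj₂; uncurry)
open import Data.Sum.Base using (_⊎_; inj₁; inj₂; [_,_]′)
import Data.Vec.Base as Vec
import Data.Vec.Properties as Vec
import Data.Bool.Properties as Bool
open import Function.Base using (_∘_; id)
open import Relation.Binary.Bundles using (DecTotalOrder)
open import Relation.Binary.Core using (Rel)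
open import Relation.Binary.Definitions using (Decidable)
open import Relation.Binary.Structures using (IsDecTotalOrder)
open import Relation.Binary.Construct.Closure.ReflexiveTransitive using (Star; ε; _◅_; _◅◅_)
import Relation.Binary.Reasoning.PartialOrder as PartialOrderReasoning
open import Relation.Binary.PropositionalEquality as ≡ using (_≡_; _≢_)
open import Relation.Nullary using (¬_; Dec; yes; no; does; contradiction)
open import Relation.Nullary.Decidable
  using (map′; ¬?; _×-dec_; _⊎-dec_; _→-dec_; decidable-stable; dec-true)
open import Relation.Unary as Unary using (Pred; Satisfiable)

private
  variable
    a p ℓ : Level
    n m : ℕ

------------------------------------------------------------------------
-- Real numbers

-- ℝ is characterised, uniquely up to isomorphism, as the complete
-- ordered field.  The order is decidable, as it is classically.
record Reals ℓ : Set (lsuc ℓ) where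
  field
    commutativeRing : CommutativeRing ℓ ℓ

  open CommutativeRing commutativeRing public

  infix 4 _≤_ _<_

  field
    _≤_             : Rel Carrier ℓ
    isDecTotalOrder : IsDecTotalOrder _≈_ _≤_
    0≉1             : ¬ 0# ≈ 1#
    inverse         : ∀ x → ¬ x ≈ 0# → ∃ λ y → x * y ≈ 1#
    +-monoʳ-≤       : ∀ x {y z} → y ≤ z → x + y ≤ x + z
    *-nonNeg        : ∀ {x y} → 0# ≤ x → 0# ≤ y → 0# ≤ x * y

  UpperBound : Pred Carrier ℓ → Pred Carrier ℓ
  UpperBound P b = ∀ {x} → P x → x ≤ b

  field
    supremum : (P : Pred Carrier ℓ) → Satisfiable P → Satisfiable (UpperBound P) →
               ∃ λ s → UpperBound P s × (∀ {b} → UpperBound P b → s ≤ b)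

  _<_ : Rel Carrier ℓ
  x < y = x ≤ y × ¬ x ≈ y

module RealProperties {ℓ} (ℝ : Reals ℓ) where

  open Reals ℝ
  open RingProperties ring using (-‿distribʳ-*; -‿involutive)

  decTotalOrder : DecTotalOrder ℓ ℓ ℓ
  decTotalOrder = record { isDecTotalOrder = isDecTotalOrder }

  open DecTotalOrder decTotalOrder public
    using (total; _≤?_; _≟_; poset; antisym; ≤-respˡ-≈; ≤-respʳ-≈)
    renaming (refl to ≤-refl; trans to ≤-trans; reflexive to ≤-reflexive)

  open PartialOrderReasoning poset
  open SemiringSolver commutativeSemiring using (solve; _:=_; _:+_; _:*_)

  +-monoˡ-≤ : ∀ x {y z} → y ≤ z → y + x ≤ z + x
  +-monoˡ-≤ x {y} {z} y≤z = begin
    y + x ≈⟨ +-comm y x ⟩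
    x + y ≤⟨ +-monoʳ-≤ x y≤z ⟩
    x + z ≈⟨ +-comm x z ⟩
    z + x ∎

  +-mono-≤ : ∀ {x y u v} → x ≤ y → u ≤ v → x + u ≤ y + v
  +-mono-≤ x≤y u≤v = ≤-trans (+-monoˡ-≤ _ x≤y) (+-monoʳ-≤ _ u≤v)

  +-nonNeg : ∀ {x y} → 0# ≤ x → 0# ≤ y → 0# ≤ x + y
  +-nonNeg 0≤x 0≤y = ≤-respˡ-≈ (+-identityˡ 0#) (+-mono-≤ 0≤x 0≤y)

  x+[y-x]≈y : ∀ x y → x + (y - x) ≈ y
  x+[y-x]≈y x y = begin-equality
    x + (y - x)   ≈⟨ +-congˡ (+-comm y (- x)) ⟩
    x + (- x + y) ≈⟨ +-assoc x (- x) y ⟨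
    (x - x) + y   ≈⟨ +-congʳ (-‿inverseʳ x) ⟩
    0# + y        ≈⟨ +-identityˡ y ⟩
    y             ∎

  +-cancelˡ-≤ : ∀ x {y z} → x + y ≤ x + z → y ≤ z
  +-cancelˡ-≤ x {y} {z} le = begin
    y              ≈⟨ lem y ⟨
    - x + (x + y)  ≤⟨ +-monoʳ-≤ (- x) le ⟩
    - x + (x + z)  ≈⟨ lem z ⟩
    z              ∎
    where
    lem : ∀ u → - x + (x + u) ≈ u
    lem u = trans (sym (+-assoc (- x) x u)) (trans (+-congʳ (-‿inverseˡ x)) (+-identityˡ u))

  ≤⇒0≤- : ∀ {x y} → x ≤ y → 0# ≤ y - x
  ≤⇒0≤- {x} {y} x≤y = +-cancelˡ-≤ x (begin
    x + 0#      ≈⟨ +-identityʳ x ⟩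
    x           ≤⟨ x≤y ⟩
    y           ≈⟨ x+[y-x]≈y x y ⟨
    x + (y - x) ∎)

  -≈0⇒≈ : ∀ {x y} → y - x ≈ 0# → x ≈ y
  -≈0⇒≈ {x} {y} eq = begin-equality
    x           ≈⟨ +-identityʳ x ⟨
    x + 0#      ≈⟨ +-congˡ eq ⟨
    x + (y - x) ≈⟨ x+[y-x]≈y x y ⟩
    y           ∎

  *-monoˡ-≤ : ∀ {z x y} → 0# ≤ z → x ≤ y → x * z ≤ y * z
  *-monoˡ-≤ {z} {x} {y} 0≤z x≤y = begin
    x * z                 ≈⟨ +-identityʳ _ ⟨
    x * z + 0#            ≤⟨ +-monoʳ-≤ _ (*-nonNeg (≤⇒0≤- x≤y) 0≤z) ⟩
    x * z + (y - x) * z   ≈⟨ distribʳ z x (y - x) ⟨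
    (x + (y - x)) * z     ≈⟨ *-congʳ (x+[y-x]≈y x y) ⟩
    y * z                 ∎

  *-mono-≤ : ∀ {x y u v} → 0# ≤ u → 0# ≤ y → x ≤ y → u ≤ v → x * u ≤ y * v
  *-mono-≤ {x} {y} {u} {v} 0≤u 0≤y x≤y u≤v = begin
    x * u ≤⟨ *-monoˡ-≤ 0≤u x≤y ⟩
    y * u ≈⟨ *-comm y u ⟩
    u * y ≤⟨ *-monoˡ-≤ 0≤y u≤v ⟩
    v * y ≈⟨ *-comm v y ⟩
    y * v ∎

  ≤0⇒0≤- : ∀ {x} → x ≤ 0# → 0# ≤ - x
  ≤0⇒0≤- x≤0 = ≤-respʳ-≈ (+-identityˡ _) (≤⇒0≤- x≤0)

  x*x-nonNeg : ∀ x → 0# ≤ x * x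
  x*x-nonNeg x with total 0# x
  ... | inj₁ 0≤x = *-nonNeg 0≤x 0≤x
  ... | inj₂ x≤0 = begin
    0#          ≤⟨ *-nonNeg (≤0⇒0≤- x≤0) (≤0⇒0≤- x≤0) ⟩
    - x * - x   ≈⟨ -‿distribʳ-* (- x) x ⟨
    - (- x * x) ≈⟨ -‿cong (*-comm (- x) x) ⟩
    - (x * - x) ≈⟨ -‿cong (-‿distribʳ-* x x) ⟨
    - - (x * x) ≈⟨ -‿involutive (x * x) ⟩
    x * x       ∎

  0≤1 : 0# ≤ 1#
  0≤1 = ≤-respʳ-≈ (*-identityˡ 1#) (x*x-nonNeg 1#)

  *-≉0 : ∀ {x y} → ¬ x ≈ 0# → ¬ y ≈ 0# → ¬ x * y ≈ 0#
  *-≉0 {x} {y} x≉0 y≉0 xy≈0 with i , xi≈1 ← inverse x x≉0 = y≉0 (begin-equality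
    y           ≈⟨ *-identityˡ y ⟨
    1# * y      ≈⟨ *-congʳ xi≈1 ⟨
    x * i * y   ≈⟨ solve 3 (λ x i y → x :* i :* y := x :* y :* i) refl x i y ⟩
    x * y * i   ≈⟨ *-congʳ xy≈0 ⟩
    0# * i      ≈⟨ zeroˡ i ⟩
    0#          ∎)

  inverse-nonNeg : ∀ {x y} → 0# ≤ x → x * y ≈ 1# → 0# ≤ y
  inverse-nonNeg {x} {y} 0≤x xy≈1 = begin
    0#           ≤⟨ *-nonNeg 0≤x (x*x-nonNeg y) ⟩
    x * (y * y)  ≈⟨ *-assoc x y y ⟨
    x * y * y    ≈⟨ *-congʳ xy≈1 ⟩
    1# * y       ≈⟨ *-identityˡ y ⟩
    y            ∎

  private

    record Increment (s δ : Carrier) : Set ℓ where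
      constructor mkIncrement
      field
        d    : Carrier
        0≤d  : 0# ≤ d
        d≉0  : ¬ d ≈ 0#
        grow : ∀ {x} → x ≤ s → ¬ x * x + δ ≤ (x + d) * (x + d)

    increment : ∀ {s δ} → 0# ≤ s → 0# ≤ δ → ¬ δ ≈ 0# → Increment s δ
    increment {s} {δ} 0≤s 0≤δ δ≉0 = mkIncrement d 0≤d d≉0 bound
      where
      b c : Carrier
      b = s + s + 1#
      c = b + δ

      0≤b : 0# ≤ b
      0≤b = +-nonNeg (+-nonNeg 0≤s 0≤s) 0≤1

      0≤c : 0# ≤ c
      0≤c = +-nonNeg 0≤b 0≤δ

      δ≤c : δ ≤ c
      δ≤c = ≤-respˡ-≈ (+-identityˡ δ) (+-monoˡ-≤ δ 0≤b)

      c≉0 : ¬ c ≈ 0#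
      c≉0 c≈0 = δ≉0 (antisym (≤-respʳ-≈ c≈0 δ≤c) 0≤δ)

      e : Carrier
      e = proj₁ (inverse c c≉0)

      ce≈1 : c * e ≈ 1#
      ce≈1 = proj₂ (inverse c c≉0)

      0≤e : 0# ≤ e
      0≤e = inverse-nonNeg 0≤c ce≈1

      d : Carrier
      d = δ * e

      0≤d : 0# ≤ d
      0≤d = *-nonNeg 0≤δ 0≤e

      cd≈δ : b * d + δ * d ≈ δ
      cd≈δ = begin-equality
        b * d + δ * d  ≈⟨ solve 3 (λ b δ e → b :* (δ :* e) :+ δ :* (δ :* e) := δ :* ((b :+ δ) :* e)) refl b δ e ⟩
        δ * (c * e)    ≈⟨ *-congˡ ce≈1 ⟩
        δ * 1#         ≈⟨ *-identityʳ δ ⟩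
        δ              ∎

      d≉0 : ¬ d ≈ 0#
      d≉0 d≈0 = δ≉0 (begin-equality
        δ               ≈⟨ cd≈δ ⟨
        b * d + δ * d   ≈⟨ +-cong (*-congˡ d≈0) (*-congˡ d≈0) ⟩
        b * 0# + δ * 0# ≈⟨ +-cong (zeroʳ b) (zeroʳ δ) ⟩
        0# + 0#         ≈⟨ +-identityˡ 0# ⟩
        0#              ∎)

      d≤1 : d ≤ 1#
      d≤1 = ≤-respʳ-≈ ce≈1 (*-monoˡ-≤ 0≤e δ≤c)

      bound : ∀ {x} → x ≤ s → ¬ x * x + δ ≤ (x + d) * (x + d)
      bound {x} x≤s le = *-≉0 δ≉0 d≉0 (antisym δd≤0 (*-nonNeg 0≤δ 0≤d))
        where
        δd≤0 : δ * d ≤ 0#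
        δd≤0 = +-cancelˡ-≤ (x * x + b * d) (begin
          x * x + b * d + δ * d     ≈⟨ +-assoc _ _ _ ⟩
          x * x + (b * d + δ * d)   ≈⟨ +-congˡ cd≈δ ⟩
          x * x + δ                 ≤⟨ le ⟩
          (x + d) * (x + d)         ≈⟨ solve 2 (λ x d → (x :+ d) :* (x :+ d) := x :* x :+ (x :+ x :+ d) :* d) refl x d ⟩
          x * x + (x + x + d) * d   ≤⟨ +-monoʳ-≤ _ (*-monoˡ-≤ 0≤d (+-mono-≤ (+-mono-≤ x≤s x≤s) d≤1)) ⟩
          x * x + b * d             ≈⟨ +-identityʳ _ ⟨
          x * x + b * d + 0#        ∎)

    SquareAtMost : Carrier → Pred Carrier ℓ
    SquareAtMost a r = r * r ≤ a

    squareAtMost-bound : ∀ {a} → 0# ≤ a → UpperBound (SquareAtMost a) (1# + a)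
    squareAtMost-bound {a} 0≤a {r} r²≤a =
      [ id , (λ 1+a≤r → contradiction (antisym 0≤1 (1≤0 1+a≤r)) 0≉1) ]′ (total r (1# + a))
      where
      0≤1+a : 0# ≤ 1# + a
      0≤1+a = +-nonNeg 0≤1 0≤a

      1≤0 : 1# + a ≤ r → 1# ≤ 0#
      1≤0 1+a≤r = +-cancelˡ-≤ a (begin
        a + 1#                ≈⟨ +-identityʳ _ ⟨
        a + 1# + 0#           ≤⟨ +-monoʳ-≤ _ (+-nonNeg 0≤a (x*x-nonNeg a)) ⟩
        a + 1# + (a + a * a)  ≈⟨ +-assoc _ _ _ ⟩
        a + (1# + (a + a * a)) ≈⟨ +-congˡ (+-congˡ (+-congʳ (*-identityʳ a))) ⟨
        a + (1# + (a * 1# + a * a)) ≈⟨ +-congˡ (+-congˡ (distribˡ a 1# a)) ⟨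
        a + (1# + a * (1# + a)) ≈⟨ +-assoc _ _ _ ⟨
        a + 1# + a * (1# + a)   ≈⟨ +-congʳ (trans (+-comm a 1#) (sym (*-identityˡ _))) ⟩
        1# * (1# + a) + a * (1# + a) ≈⟨ distribʳ (1# + a) 1# a ⟨
        (1# + a) * (1# + a)   ≤⟨ *-mono-≤ 0≤1+a (≤-trans 0≤1+a 1+a≤r) 1+a≤r 1+a≤r ⟩
        r * r                 ≤⟨ r²≤a ⟩
        a                     ≈⟨ +-identityʳ a ⟨
        a + 0#                ∎)

    sup²≮ : ∀ {a s} → UpperBound (SquareAtMost a) s → s * s ≤ a → ¬ Increment s (a - s * s)
    sup²≮ {a} {s} upper s²≤a (mkIncrement d 0≤d d≉0 grow) = d≉0 (antisym d≤0 0≤d)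
      where
      s+d-small : SquareAtMost a (s + d)
      s+d-small = [ id , (λ ge → contradiction (≤-respˡ-≈ (sym (x+[y-x]≈y (s * s) a)) ge) (grow ≤-refl)) ]′
        (total ((s + d) * (s + d)) a)

      d≤0 : d ≤ 0#
      d≤0 = +-cancelˡ-≤ s (≤-respʳ-≈ (sym (+-identityʳ s)) (upper s+d-small))

    sup²≯ : ∀ {a s} → 0# ≤ s → UpperBound (SquareAtMost a) s →
            (∀ {b} → UpperBound (SquareAtMost a) b → s ≤ b) →
            ¬ Increment s (s * s - a)
    sup²≯ {a} {s} 0≤s upper least (mkIncrement d 0≤d d≉0 grow) = d≉0 (antisym d≤0 0≤d)
      where
      s≤r+d : ∀ {r} → s - d ≤ r → s ≤ r + d
      s≤r+d {r} s-d≤r = begin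
        s           ≈⟨ x+[y-x]≈y d s ⟨
        d + (s - d) ≤⟨ +-monoʳ-≤ d s-d≤r ⟩
        d + r       ≈⟨ +-comm d r ⟩
        r + d       ∎

      r²+δ≤[r+d]² : ∀ {r} → SquareAtMost a r → s ≤ r + d → r * r + (s * s - a) ≤ (r + d) * (r + d)
      r²+δ≤[r+d]² {r} r²≤a le = begin
        r * r + (s * s - a)  ≤⟨ +-monoˡ-≤ _ r²≤a ⟩
        a + (s * s - a)      ≈⟨ x+[y-x]≈y a (s * s) ⟩
        s * s                ≤⟨ *-mono-≤ 0≤s (≤-trans 0≤s le) le le ⟩
        (r + d) * (r + d)    ∎

      s-d-bound : UpperBound (SquareAtMost a) (s - d)
      s-d-bound {r} r²≤a =
        [ id , (λ le → contradiction (r²+δ≤[r+d]² r²≤a (s≤r+d le)) (grow (upper r²≤a))) ]′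
        (total r (s - d))

      d≤0 : d ≤ 0#
      d≤0 = +-cancelˡ-≤ (s - d) (begin
        (s - d) + d   ≈⟨ +-comm _ d ⟩
        d + (s - d)   ≈⟨ x+[y-x]≈y d s ⟩
        s             ≤⟨ least s-d-bound ⟩
        s - d         ≈⟨ +-identityʳ _ ⟨
        (s - d) + 0#  ∎)

    sup²≈ : ∀ {a s} → 0# ≤ s → UpperBound (SquareAtMost a) s →
            (∀ {b} → UpperBound (SquareAtMost a) b → s ≤ b) → s * s ≈ a
    sup²≈ {a} {s} 0≤s upper least = decidable-stable (s * s ≟ a) λ s²≉a →
      [ (λ le → sup²≮ upper le (increment 0≤s (≤⇒0≤- le) (s²≉a ∘ -≈0⇒≈)))
      , (λ ge → sup²≯ 0≤s upper least (increment 0≤s (≤⇒0≤- ge) (s²≉a ∘ sym ∘ -≈0⇒≈)))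
      ]′ (total (s * s) a)

  abstract
    squareRoot : ∀ x → 0# ≤ x → ∃ λ s → 0# ≤ s × s * s ≈ x
    squareRoot x 0≤x =
      let s , upper , least = supremum (SquareAtMost x) (0# , 0²≤x) (1# + x , squareAtMost-bound 0≤x)
      in  s , upper 0²≤x , sup²≈ (upper 0²≤x) upper least
      where
      0²≤x : SquareAtMost x 0#
      0²≤x = ≤-respˡ-≈ (sym (zeroˡ 0#)) 0≤x

------------------------------------------------------------------------
-- Complex numbers

module Complex {ℓ} (ℝ : Reals ℓ) where

  private module ℝ where
    open Reals ℝ public
    open RealProperties ℝ public

  infix 5 _+i_

  record ℂ : Set ℓ where
    constructor _+i_
    field
      re im : ℝ.Carrier

  open ℂ public

  ℂ-rawRing : RawRing ℓ ℓ
  ℂ-rawRing = record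
    { Carrier = ℂ
    ; _≈_     = λ z u → re z ℝ.≈ re u × im z ℝ.≈ im u
    ; _+_     = λ z u → re z ℝ.+ re u +i im z ℝ.+ im u
    ; _*_     = λ z u → re z ℝ.* re u ℝ.- im z ℝ.* im u +i re z ℝ.* im u ℝ.+ im z ℝ.* re u
    ; -_      = λ z → ℝ.- re z +i ℝ.- im z
    ; 0#      = ℝ.0# +i ℝ.0#
    ; 1#      = ℝ.1# +i ℝ.0#
    }

  fromℝ : ℝ.Carrier → ℂ
  fromℝ x = x +i ℝ.0#

  conj : ℂ → ℂ
  conj z = re z +i ℝ.- im z

  modulus : ℂ → ℝ.Carrier
  modulus z = proj₁ (ℝ.squareRoot (re z ℝ.* re z ℝ.+ im z ℝ.* im z)
    (ℝ.+-nonNeg (ℝ.x*x-nonNeg (re z)) (ℝ.x*x-nonNeg (im z))))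

  ℝ⁺ ℝ⁻ : Pred ℂ ℓ
  ℝ⁺ z = ℝ.0# ℝ.< re z × im z ℝ.≈ ℝ.0#
  ℝ⁻ z = re z ℝ.< ℝ.0# × im z ℝ.≈ ℝ.0#

  _<?_ : Decidable ℝ._<_
  x <? y = (x ℝ.≤? y) ×-dec ¬? (x ℝ.≟ y)

  ℝ⁺? : Unary.Decidable ℝ⁺
  ℝ⁺? z = (ℝ.0# <? re z) ×-dec (im z ℝ.≟ ℝ.0#)

  ℝ⁻? : Unary.Decidable ℝ⁻
  ℝ⁻? z = (re z <? ℝ.0#) ×-dec (im z ℝ.≟ ℝ.0#)

------------------------------------------------------------------------
-- Determinants, by Laplace expansion along the first row

module Determinant {c ℓ} (R : RawRing c ℓ) where

  open RawRing R
  open RawSemiringDefs rawSemiring using (sum; _^_)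

  det : (Fin n → Fin n → Carrier) → Carrier
  det {zero}  M = 1#
  det {suc n} M = sum λ j →
    (- 1#) ^ toℕ j * (M zero j * det (λ r s → M (suc r) (punchIn j s)))

------------------------------------------------------------------------
-- Decidability over finite types

allSubsets : ∀ m → List (Subset m)
allSubsets zero    = Vec.[] ∷ []
allSubsets (suc m) = List.map (outside Vec.∷_) (allSubsets m) ++ List.map (inside Vec.∷_) (allSubsets m)

-- Warshall's algorithm: `Via ks` allows only intermediate points from ks.
module Reachability {T : Rel (Fin n) Level.zero} (T? : Decidable T) where

  private

    Via : List (Fin n) → Rel (Fin n) Level.zero
    Via []       i j = i ≡ j ⊎ T i j
    Via (k ∷ ks) i j = Via ks i j ⊎ (Via ks i k × Via ks k j)

    via? : ∀ ks → Decidable (Via ks)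
    via? []       i j = (i Fin.≟ j) ⊎-dec T? i j
    via? (k ∷ ks) i j = via? ks i j ⊎-dec (via? ks i k ×-dec via? ks k j)

    sound : ∀ ks {i j} → Via ks i j → Star T i j
    sound []       (inj₁ ≡.refl)  = ε
    sound []       (inj₂ t)       = t ◅ ε
    sound (k ∷ ks) (inj₁ p)       = sound ks p
    sound (k ∷ ks) (inj₂ (p , q)) = sound ks p ◅◅ sound ks q

    base : ∀ ks {i j} → Via [] i j → Via ks i j
    base []       p = p
    base (k ∷ ks) p = inj₁ (base ks p)

    compose : ∀ ks {i j k} → k List.∈ˡ ks → Via ks i k → Via ks k j → Via ks i j
    compose (l ∷ ks) (here ≡.refl) p q = inj₂ ([ id , proj₁ ]′ p , [ id , proj₂ ]′ q)
    compose (l ∷ ks) (there k∈) (inj₁ p)       (inj₁ q)       = inj₁ (compose ks k∈ p q)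
    compose (l ∷ ks) (there k∈) (inj₁ p)       (inj₂ (q , r)) = inj₂ (compose ks k∈ p q , r)
    compose (l ∷ ks) (there k∈) (inj₂ (p , q)) (inj₁ r)       = inj₂ (p , compose ks k∈ q r)
    compose (l ∷ ks) (there k∈) (inj₂ (p , q)) (inj₂ (r , s)) = inj₂ (p , s)

    complete : ∀ {i j} → Star T i j → Via (List.allFin n) i j
    complete ε        = base (List.allFin n) (inj₁ ≡.refl)
    complete (t ◅ ts) = compose (List.allFin n) (∈-allFin _) (base (List.allFin n) (inj₂ t)) (complete ts)

  star? : Decidable (Star T)
  star? i j = map′ (sound (List.allFin n)) complete (via? (List.allFin n) i j)

private

  length≤n : {xs : List (Fin n)} → Unique xs → length xs ℕ.≤ n
  length≤n u = Fin.injective⇒≤ (lookup-inj u)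
    where
    lookup-inj : {xs : List (Fin n)} → Unique xs → ∀ {i j} →
                 List.lookup xs i ≡ List.lookup xs j → i ≡ j
    lookup-inj (x∉ ∷ u) {zero}  {zero}  eq = ≡.refl
    lookup-inj (x∉ ∷ u) {zero}  {suc j} eq = contradiction eq (All.lookup x∉ (∈-lookup j))
    lookup-inj (x∉ ∷ u) {suc i} {zero}  eq = contradiction (≡.sym eq) (All.lookup x∉ (∈-lookup i))
    lookup-inj (x∉ ∷ u) {suc i} {suc j} eq = ≡.cong suc (lookup-inj u eq)

  anyOfLength? : {P : Pred (List (Fin n)) p} → Unary.Decidable P →
                 ∀ k → Dec (∃ λ xs → length xs ≡ k × P xs)
  anyOfLength? P? zero =
    map′ (λ Pxs → [] , ≡.refl , Pxs) (λ where ([] , _ , Pxs) → Pxs) (P? [])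
  anyOfLength? P? (suc k) =
    map′ (λ (x , xs , eq , Pxs) → x ∷ xs , ≡.cong suc eq , Pxs)
         (λ where (x ∷ xs , eq , Pxs) → x , xs , ℕ.suc-injective eq , Pxs)
         (Fin.any? λ x → anyOfLength? (P? ∘ (x ∷_)) k)

anyUnique? : {P : Pred (List (Fin n)) p} → Unary.Decidable P →
             (∀ {xs} → P xs → Unique xs) → Dec (∃ P)
anyUnique? {n = n} P? P⇒Unique =
  map′ (λ (_ , _ , xs , _ , Pxs) → xs , Pxs)
       (λ (xs , Pxs) → length xs , ℕ.s≤s (length≤n (P⇒Unique Pxs)) , xs , ≡.refl , Pxs)
       (ℕ.anyUpTo? (anyOfLength? P?) (suc n))

------------------------------------------------------------------------
-- Oriented graphs

record OrientedGraph (n m : ℕ) : Set where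
  field
    src tgt : Fin m → Fin n

  -- In the underlying graph, e is an edge between i and j.
  Joins : Fin m → Fin n → Fin n → Set
  Joins e i j = (src e ≡ i × tgt e ≡ j) ⊎ (src e ≡ j × tgt e ≡ i)

  field
    loopless : ∀ e → src e ≢ tgt e
    simple   : ∀ {e f} → Joins e (src f) (tgt f) → e ≡ f

-- A walk is the list of the vertices it visits.
steps : {A : Set a} → List A → List (A × A)
steps γ = zip γ (drop 1 γ)

closeUp : {A : Set a} → List A → List A
closeUp []       = []
closeUp (v ∷ vs) = v ∷ vs ∷ʳ v

module Graph (G : OrientedGraph n m) where

  open OrientedGraph G

  joins? : ∀ e → Decidable (Joins e)
  joins? e i j = ((src e Fin.≟ i) ×-dec (tgt e Fin.≟ j)) ⊎-dec ((src e Fin.≟ j) ×-dec (tgt e Fin.≟ i))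

  record Subgraph : Set where
    field
      vertices : Subset n
      edges    : Subset m
      incident : ∀ {e} → e ∈ edges → src e ∈ vertices × tgt e ∈ vertices

  open Subgraph public

  spanning : Subset m → Subgraph
  spanning S = record { vertices = ⊤ ; edges = S ; incident = λ _ → ∈⊤ , ∈⊤ }

  Adjacent : Subgraph → Rel (Fin n) _
  Adjacent U i j = ∃ λ e → e ∈ edges U × Joins e i j

  Connected : Subgraph → Set
  Connected U = ∀ i j → i ∈ vertices U → j ∈ vertices U → Star (Adjacent U) i j

  WeaklyConnected : Set
  WeaklyConnected = Connected (spanning ⊤)

  adjacent? : ∀ U → Decidable (Adjacent U)
  adjacent? U i j = Fin.any? λ e → (e ∈? edges U) ×-dec joins? e i j

  reachable? : ∀ U → Decidable (Star (Adjacent U))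
  reachable? U = Reachability.star? (adjacent? U)

  connected? : Unary.Decidable Connected
  connected? U = Fin.all? λ i → Fin.all? λ j →
    (i ∈? vertices U) →-dec ((j ∈? vertices U) →-dec reachable? U i j)

  -- A cycle v₁, …, vₖ (not repeating v₁ at the end) of the underlying
  -- graph; it is listed from any starting vertex, in either direction.
  record IsCycle (U : Subgraph) (γ : List (Fin n)) : Set where
    field
      length≥3 : 3 ℕ.≤ length γ
      distinct : Unique γ
      adjacent : All (uncurry (Adjacent U)) (steps (closeUp γ))

  isCycle? : ∀ U → Unary.Decidable (IsCycle U)
  isCycle? U γ = map′
    (λ (l , d , a) → record { length≥3 = l ; distinct = d ; adjacent = a })
    (λ c → let open IsCycle c in length≥3 , distinct , adjacent)
    ((3 ℕ.≤? length γ) ×-dec (UniqueDec.unique? Fin._≟_ γ ×-dec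
      All.all? (uncurry (adjacent? U)) (steps (closeUp γ))))

  cycleEdges : List (Fin n) → Subset m
  cycleEdges γ = Vec.tabulate λ e → does (Any.any? (uncurry (joins? e)) (steps (closeUp γ)))

  -- Two lists describe the same cycle when they have the same edges.
  record Unicyclic (U : Subgraph) : Set where
    field
      connected : Connected U
      cycle     : List (Fin n)
      isCycle   : IsCycle U cycle
      unique    : ∀ γ → IsCycle U γ → cycleEdges γ ≡ cycleEdges cycle

  allCycles? : ∀ U {P : Pred (List (Fin n)) p} → Unary.Decidable P →
               Dec (∀ γ → IsCycle U γ → P γ)
  allCycles? U P? = map′
    (λ ¬∃ γ c → decidable-stable (P? γ) λ ¬Pγ → ¬∃ (γ , c , ¬Pγ))
    (λ all (γ , c , ¬Pγ) → ¬Pγ (all γ c))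
    (¬? (anyUnique? (λ γ → isCycle? U γ ×-dec ¬? (P? γ)) (IsCycle.distinct ∘ proj₁)))

  unicyclic? : Unary.Decidable Unicyclic
  unicyclic? U = map′
    (λ (con , γ , c , u) → record { connected = con ; cycle = γ ; isCycle = c ; unique = u })
    (λ u → let open Unicyclic u in connected , cycle , isCycle , unique)
    (connected? U ×-dec anyUnique?
      (λ γ → isCycle? U γ ×-dec
        allCycles? U λ γ′ → Vec.≡-dec Bool._≟_ (cycleEdges γ′) (cycleEdges γ))
      (IsCycle.distinct ∘ proj₁))

  private

    ∈-tabulate⁺ : ∀ {k} {P : Pred (Fin k) p} (P? : Unary.Decidable P) {i} →
                  P i → i ∈ Vec.tabulate (does ∘ P?)
    ∈-tabulate⁺ P? {i} Pi = Vec.lookup⇒[]= i _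
      (≡.trans (Vec.lookup∘tabulate (does ∘ P?) i) (dec-true (P? i) Pi))

    ∈-tabulate⁻ : ∀ {k} {P : Pred (Fin k) p} (P? : Unary.Decidable P) {i} →
                  i ∈ Vec.tabulate (does ∘ P?) → P i
    ∈-tabulate⁻ P? {i} i∈ with P? i | ≡.trans (≡.sym (Vec.lookup∘tabulate (does ∘ P?) i)) (Vec.[]=⇒lookup i∈)
    ... | yes Pi | _ = Pi

  component : Subgraph → Fin n → Subgraph
  component H v = record
    { vertices = Vec.tabulate (does ∘ reachable? H v)
    ; edges    = Vec.tabulate (does ∘ inComponent?)
    ; incident = λ {e} e∈ → let (e∈H , v⇝src) = ∈-tabulate⁻ inComponent? e∈ in
        ∈-tabulate⁺ (reachable? H v) v⇝src ,
        ∈-tabulate⁺ (reachable? H v) (v⇝src ◅◅ (e , e∈H , inj₁ (≡.refl , ≡.refl)) ◅ ε)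
    }
    where
    inComponent? : Unary.Decidable λ e → e ∈ edges H × Star (Adjacent H) v (src e)
    inComponent? e = (e ∈? edges H) ×-dec reachable? H v (src e)

  -- The components of a spanning subgraph, each listed once, as the
  -- component of its least vertex.
  components : Subgraph → List Subgraph
  components H = List.map (component H) (List.filter least? (List.allFin n))
    where
    least? : Unary.Decidable λ v → ∀ u → Star (Adjacent H) v u → v Fin.≤ u
    least? v = Fin.all? λ u → reachable? H v u →-dec (v Fin.≤? u)

------------------------------------------------------------------------
-- Weighted oriented graphs

module Weighted {ℓ} (ℝ : Reals ℓ) (G : OrientedGraph n m)
                (w : Fin m → Complex.ℂ ℝ) where

  private module ℝ where
    open Reals ℝ public
    open RawRing (CommutativeRing.rawRing commutativeRing) public using (rawSemiring)
    open RawSemiringDefs rawSemiring public using (sum)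

  open Complex ℝ
  open RawRing ℂ-rawRing
  open RawSemiringDefs rawSemiring using (product)
  open OrientedGraph G
  open Graph G

  A : Fin n → Fin n → ℂ
  A i j with Fin.any? (λ e → (src e Fin.≟ i) ×-dec (tgt e Fin.≟ j))
           | Fin.any? (λ e → (src e Fin.≟ j) ×-dec (tgt e Fin.≟ i))
  ... | yes (e , _) | _           = w e
  ... | no _        | yes (e , _) = conj (w e)
  ... | no _        | no _        = 0#

  D : Fin n → Fin n → ℂ
  D i j = if does (i Fin.≟ j)
    then fromℝ (ℝ.sum λ k → if does (k Fin.≟ i) then ℝ.0# else modulus (A i k))
    else 0#

  Q : Fin n → Fin n → ℂ
  Q i j = D i j + A i j

  wt : List (Fin n) → ℂ
  wt γ = List.foldr _*_ 1# (List.map (uncurry A) (steps γ))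

  wtCycle : List (Fin n) → ℂ
  wtCycle γ = wt (closeUp γ)

  W : Subset m → ℂ
  W F = product λ e → if does (e ∈? F) then w e else 1#

  IsEven : List (Fin n) → Set
  IsEven γ = 2 ∣ length γ

  isEven? : Unary.Decidable IsEven
  isEven? γ = 2 ∣? length γ

  α : List (Fin n) → ℝ.Carrier
  α γ = if does (isEven? γ)
    then modulus (wtCycle γ) ℝ.- re (wtCycle γ)
    else modulus (wtCycle γ) ℝ.+ re (wtCycle γ)

  Admissible : List (Fin n) → Set ℓ
  Admissible γ = (¬ IsEven γ → ¬ ℝ⁻ (wtCycle γ)) × (IsEven γ → ¬ ℝ⁺ (wtCycle γ))

  admissible? : Unary.Decidable Admissible
  admissible? γ = (¬? (isEven? γ) →-dec ¬? (ℝ⁻? (wtCycle γ))) ×-dec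
                  (isEven? γ →-dec ¬? (ℝ⁺? (wtCycle γ)))

  -- Membership of a spanning subgraph in 𝒰(G).
  record In𝒰 (H : Subgraph) : Set ℓ where
    field
      size       : ∣ edges H ∣ ≡ n
      unicyclic  : All Unicyclic (components H)
      admissible : All (λ U → ∀ γ → IsCycle U γ → Admissible γ) (components H)

  in𝒰? : Unary.Decidable In𝒰
  in𝒰? H = map′
    (λ (s , u , a) → record { size = s ; unicyclic = u ; admissible = a })
    (λ p → let open In𝒰 p in size , unicyclic , admissible)
    ((∣ edges H ∣ ℕ.≟ n) ×-dec (All.all? unicyclic? (components H) ×-dec
      All.all? (λ U → allCycles? U admissible?) (components H)))

  factor : ∀ {U} → Unicyclic U → ℝ.Carrier
  factor {U} u = (ℝ.1# ℝ.+ ℝ.1#) ℝ.* modulus (W (edges U ─ cycleEdges cycle)) ℝ.* α cycle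
    where open Unicyclic u

  term : ∀ {H} → In𝒰 H → ℝ.Carrier
  term p = List.foldr ℝ._*_ ℝ.1# (All.reduce factor (In𝒰.unicyclic p))

  sumOver𝒰 : (∀ {H} → In𝒰 H → ℝ.Carrier) → ℝ.Carrier
  sumOver𝒰 f = List.foldr ℝ._+_ ℝ.0# (List.map (summand ∘ spanning) (allSubsets m))
    where
    summand : Subgraph → ℝ.Carrier
    summand H with in𝒰? H
    ... | yes p = f p
    ... | no  _ = ℝ.0#

{-# OPTIONS --safe #-}

-- Q is the sum over the edges of rank-one matrices C_eᵀ B_e, where C_e and B_e
-- are supported on the two endpoints of e.  Expanding det Q along its rows gives
-- a sum over maps f from vertices to edges, in which only injective f with
-- f v incident to v survive; collecting them by their image S, a set of n edges,
-- leaves Σ_S X_S, where X_S is the determinant of the Q-matrix of (V, S).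
--
-- If S carries such an f, let g v be the other endpoint of f v.  Since f is a
-- bijection onto S, every component of (V, S) contains exactly one cycle, an
-- orbit of g.  Conversely, cycles chosen in all components yield f and g by
-- moving round the cycles and towards them.  Then X_S = det (Σ_v C_vᵀ B_v) is
-- multilinear and alternating in either family of rows, and B_v is the multiple
-- by |a_v| of δ_v − t_v δ_(g v), where a_v = A v (g v) and t_v = − a_v / |a_v|;
-- C_v is its conjugate analogue.  Row operations along the g-orbits evaluate
-- both families: each cycle contributes |1 − τ|², τ being the product of t
-- round the cycle, and |wt| |1 − τ|² = 2 (|wt| ∓ Re wt).
--
-- If X_S ≠ 0 and S ∉ 𝒰(G), then some cycle is inadmissible, and choosing it in
-- its component makes the product vanish.
module Submission where

-- The diagonal of Q is what makes the contribution of an edge degenerate: weight a between u and v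
-- gives the block with |a| on the diagonal and a, conj a off it, whose determinant |a|² - a conj a
-- is zero.
--
-- X_S is defined without reference to f or to cycles, so every orientation that computes it gives
-- the same value. This freedom is used twice: with the cycles stored in a proof of membership in
-- 𝒰(G), which makes the product agree with `term`, and with an inadmissible cycle placed in its
-- component.
--
-- The modulus |a_v| is put on B alone. Its product over a cycle is |wt|, and over the remaining
-- edges of a component it is the modulus of `W`. Since |τ| = 1, |1 - τ|² = 2 - 2 Re τ, which is
-- where the 2 comes from; the sign in each t_v gives |wt| τ = (-1)^k wt for a cycle of length k,
-- which is where the parity rule of `α` comes from.
--
-- An f for S is not constructed from X_S ≠ 0. Equality in ℂ is decidable, so X_S = 0 may be proved
-- by contradiction, and there it suffices to treat each f as it turns up in the expansion.

open import Defs
import Level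
open import Algebra.Bundles using (CommutativeMonoid; CommutativeRing; RawRing)
import Algebra.Definitions.RawSemiring as RawSemiringDefs
import Algebra.Properties.CommutativeMonoid.Sum as CommutativeMonoidSum
import Algebra.Properties.Ring as RingProperties
import Algebra.Properties.Semiring.Mult as SemiringMult
import Algebra.Properties.Semiring.Sum as SemiringSum
import Algebra.Solver.Ring as RingSolver
open import Algebra.Solver.Ring.AlmostCommutativeRing
  using (fromCommutativeRing; _-Raw-AlmostCommutative⟶_; Induced-equivalence)
import Algebra.Solver.Ring.NaturalCoefficients.Default as SemiringSolver
open import Data.Bool.Base using (if_then_else_; true; false)
open import Data.Empty using (⊥)
open import Data.Fin.Base as Fin using (Fin; zero; suc; toℕ; punchIn; punchOut)
open import Data.Fin.Properties as Fin using (_≟_; any?; all?; ¬∀⟶∃¬; suc-injective; injective⇒≤; punchOut-injective)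
import Data.Fin.Subset as Subset
open import Data.Fin.Subset using (Subset; ∣_∣; inside; outside)
open import Data.Fin.Subset.Properties using (_∈?_; p⊂q⇒∣p∣<∣q∣; ⊆-antisym; x∈p∧x∉q⇒x∈p─q; p─q⊆p)
open import Data.List.Base as List using (List; []; _∷_; _∷ʳ_; _++_; foldr; map; allFin; tabulate; length)
open import Data.List.Membership.Propositional using (_∈_; _∉_; find; lose)
open import Data.List.Membership.Propositional.Properties using (∈-allFin; ∈-filter⁺; ∈-filter⁻; ∈-lookup; ∈-map⁺; ∈-map⁻)
import Data.List.Membership.DecPropositional as DecMembership
import Data.List.Properties as List
open import Data.List.Relation.Binary.Subset.Propositional using (_⊆_)
open import Data.List.Relation.Unary.All as All using (All; []; _∷_)
import Data.List.Relation.Unary.All.Properties as All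
open import Data.List.Relation.Unary.AllPairs as AllPairs using (AllPairs; []; _∷_)
import Data.List.Relation.Unary.AllPairs.Properties as AllPairs
open import Data.List.Relation.Unary.Any as Any using (Any; here; there)
open import Data.List.Relation.Unary.Linked using (Linked; []; [-]; _∷_)
open import Data.List.Relation.Unary.Unique.Propositional using (Unique)
import Data.List.Relation.Unary.Unique.Propositional.Properties as Unique
open import Data.Maybe.Base using (just; nothing)
open import Data.Nat.Base as ℕ using (ℕ; zero; suc; z≤n; s≤s; _≤_)
open import Data.Nat.Divisibility using (_∣_; _∣?_; ∣m∣n⇒∣m+n; ∣m+n∣m⇒∣n; ∣-refl; ∣1⇒≡1; divides)
open import Data.Nat.Induction using (<-wellFounded; Acc; acc)
import Data.Nat.Properties as ℕ
open import Data.Product.Base using (∃; _×_; _,_; proj₁; proj₂; uncurry)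
open import Data.Product.Properties using (≡-dec)
open import Data.Sum.Base using (_⊎_; inj₁; inj₂; [_,_]′; map₁)
import Data.Vec.Base as Vec
open import Data.Vec.Functional using (updateAt) renaming (_∷_ to _∷ᶠ_)
open import Data.Vec.Functional.Properties using (updateAt-updates; updateAt-minimal; updateAt-commutes; map-updateAt)
import Data.Vec.Properties as Vec
open import Function.Base using (_∘_; const; id)
open import Function.Bundles using (mk⇔)
open import Function.Definitions using (Injective)
open import Relation.Binary.Construct.Closure.ReflexiveTransitive as Star using (Star; ε; _◅_; _◅◅_)
open import Relation.Binary.Definitions using (WeaklyDecidable)
open import Relation.Binary.PropositionalEquality as ≡ using (_≡_; _≢_)
import Relation.Binary.Reasoning.Setoid as SetoidReasoning
open import Relation.Nullary using (¬_; Dec; yes; no; does; contradiction)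
open import Relation.Nullary.Decidable
  using (dec-true; dec-false; decidable-stable; does-⇔; _×-dec_; _→-dec_; ¬?)
open import Relation.Unary as Unary using (Pred)

-- A ring solver that can cancel terms in an abstract commutative ring: the
-- coefficient (a , b) stands for the integer a − b, so that equality of
-- coefficients computes.
module DifferenceSolver {c ℓ} (R : CommutativeRing c ℓ) where

  open CommutativeRing R hiding (zero)
  open RingProperties ring using (-‿distribˡ-*; -‿distribʳ-*; -‿involutive; -‿+-comm; -0#≈0#)
  open SemiringMult semiring using (×-homo-+; ×1-homo-*) renaming (_×_ to _·_)

  private

    module N = SemiringSolver commutativeSemiring

    differences : RawRing _ _
    differences = record
      { Carrier = ℕ × ℕ
      ; _≈_ = _≡_
      ; _+_ = λ (a , b) (c , d) → a ℕ.+ c , b ℕ.+ d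
      ; _*_ = λ (a , b) (c , d) → a ℕ.* c ℕ.+ b ℕ.* d , a ℕ.* d ℕ.+ b ℕ.* c
      ; -_  = λ (a , b) → b , a
      ; 0#  = 0 , 0
      ; 1#  = 1 , 0
      }

    difference : ℕ × ℕ → Carrier
    difference (a , b) = a · 1# - b · 1#

    -- Zero and one are special-cased so that constants in goals are recognised.
    ⟦_⟧ : ℕ × ℕ → Carrier
    ⟦ 0 , 0 ⟧ = 0#
    ⟦ 1 , 0 ⟧ = 1#
    ⟦ a , b ⟧ = difference (a , b)

    ⟦⟧-difference : ∀ x → ⟦ x ⟧ ≈ difference x
    ⟦⟧-difference (0 , 0)                 = sym (-‿inverseʳ 0#)
    ⟦⟧-difference (1 , 0)                 = sym (trans (+-cong (+-identityʳ 1#) -0#≈0#) (+-identityʳ 1#))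
    ⟦⟧-difference (suc (suc _) , 0)       = refl
    ⟦⟧-difference (0 , suc _)             = refl
    ⟦⟧-difference (1 , suc _)             = refl
    ⟦⟧-difference (suc (suc _) , suc _)   = refl

    open SetoidReasoning setoid

    *-expand : ∀ x y z w → (x - y) * (z - w) ≈ (x * z + y * w) - (x * w + y * z)
    *-expand x y z w = begin
      (x - y) * (z - w)
        ≈⟨ N.solve 4 (λ x y z w → (x N.:+ y) N.:* (z N.:+ w) N.:= (x N.:* z N.:+ y N.:* w) N.:+ (x N.:* w N.:+ y N.:* z)) refl x (- y) z (- w) ⟩
      (x * z + (- y) * (- w)) + (x * - w + - y * z)
        ≈⟨ +-cong (+-congˡ (trans (sym (-‿distribˡ-* y _)) (trans (-‿cong (sym (-‿distribʳ-* y w))) (-‿involutive _))))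
             (trans (+-cong (sym (-‿distribʳ-* x w)) (sym (-‿distribˡ-* y z))) (-‿+-comm _ _)) ⟩
      (x * z + y * w) - (x * w + y * z) ∎

    morphism : differences -Raw-AlmostCommutative⟶ fromCommutativeRing R
    morphism = record
      { ⟦_⟧    = ⟦_⟧
      ; +-homo = λ (a , b) (c , d) → begin
          ⟦ a ℕ.+ c , b ℕ.+ d ⟧
            ≈⟨ ⟦⟧-difference (a ℕ.+ c , b ℕ.+ d) ⟩
          (a ℕ.+ c) · 1# - (b ℕ.+ d) · 1#
            ≈⟨ +-cong (×-homo-+ 1# a c) (-‿cong (×-homo-+ 1# b d)) ⟩
          (a · 1# + c · 1#) - (b · 1# + d · 1#)
            ≈⟨ +-congˡ (-‿+-comm _ _) ⟨
          (a · 1# + c · 1#) + (- (b · 1#) + - (d · 1#))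
            ≈⟨ N.solve 4 (λ x y z w → (x N.:+ z) N.:+ (y N.:+ w) N.:= (x N.:+ y) N.:+ (z N.:+ w)) refl _ _ _ _ ⟩
          difference (a , b) + difference (c , d)
            ≈⟨ +-cong (⟦⟧-difference (a , b)) (⟦⟧-difference (c , d)) ⟨
          ⟦ a , b ⟧ + ⟦ c , d ⟧ ∎
      ; *-homo = λ (a , b) (c , d) → begin
          ⟦ a ℕ.* c ℕ.+ b ℕ.* d , a ℕ.* d ℕ.+ b ℕ.* c ⟧
            ≈⟨ ⟦⟧-difference (a ℕ.* c ℕ.+ b ℕ.* d , a ℕ.* d ℕ.+ b ℕ.* c) ⟩
          (a ℕ.* c ℕ.+ b ℕ.* d) · 1# - (a ℕ.* d ℕ.+ b ℕ.* c) · 1#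
            ≈⟨ +-cong (bilinear a c b d) (-‿cong (bilinear a d b c)) ⟩
          (a · 1# * c · 1# + b · 1# * d · 1#) - (a · 1# * d · 1# + b · 1# * c · 1#)
            ≈⟨ *-expand _ _ _ _ ⟨
          difference (a , b) * difference (c , d)
            ≈⟨ *-cong (⟦⟧-difference (a , b)) (⟦⟧-difference (c , d)) ⟨
          ⟦ a , b ⟧ * ⟦ c , d ⟧ ∎
      ; -‿homo = λ (a , b) → begin
          ⟦ b , a ⟧                 ≈⟨ ⟦⟧-difference (b , a) ⟩
          b · 1# - a · 1#           ≈⟨ +-comm _ _ ⟩
          - (a · 1#) + b · 1#       ≈⟨ +-congˡ (-‿involutive _) ⟨
          - (a · 1#) + - - (b · 1#) ≈⟨ -‿+-comm _ _ ⟩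
          - difference (a , b)      ≈⟨ -‿cong (⟦⟧-difference (a , b)) ⟨
          - ⟦ a , b ⟧               ∎
      ; 0-homo = refl
      ; 1-homo = refl
      }
      where
      bilinear : ∀ a c b d → (a ℕ.* c ℕ.+ b ℕ.* d) · 1# ≈ a · 1# * c · 1# + b · 1# * d · 1#
      bilinear a c b d = trans (×-homo-+ 1# (a ℕ.* c) (b ℕ.* d)) (+-cong (×1-homo-* a c) (×1-homo-* b d))

    -- Pairs are never normalised, so a - b and c - d are compared through a + d and c + b, an
    -- equation of naturals.
    coefficient-≟ : WeaklyDecidable (Induced-equivalence morphism)
    coefficient-≟ (a , b) (c , d) with a ℕ.+ d ℕ.≟ c ℕ.+ b
    ... | no _   = nothing
    ... | yes eq = just (begin
      ⟦ a , b ⟧                ≈⟨ ⟦⟧-difference (a , b) ⟩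
      x - y                    ≈⟨ +-identityʳ _ ⟨
      (x - y) + 0#             ≈⟨ +-congˡ (-‿inverseʳ w) ⟨
      (x - y) + (w - w)        ≈⟨ N.solve 4 (λ x y w v → (x N.:+ y) N.:+ (w N.:+ v) N.:= (x N.:+ w) N.:+ (y N.:+ v)) refl x (- y) w (- w) ⟩
      (x + w) + (- y - w)      ≈⟨ +-congʳ (×-homo-+ 1# a d) ⟨
      (a ℕ.+ d) · 1# + (- y - w) ≡⟨ ≡.cong (λ k → k · 1# + (- y - w)) eq ⟩
      (c ℕ.+ b) · 1# + (- y - w) ≈⟨ +-congʳ (×-homo-+ 1# c b) ⟩
      (z + y) + (- y - w)      ≈⟨ N.solve 4 (λ z y u v → (z N.:+ y) N.:+ (u N.:+ v) N.:= (z N.:+ v) N.:+ (y N.:+ u)) refl z y (- y) (- w) ⟩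
      (z - w) + (y - y)        ≈⟨ +-congˡ (-‿inverseʳ y) ⟩
      (z - w) + 0#             ≈⟨ +-identityʳ _ ⟩
      z - w                    ≈⟨ ⟦⟧-difference (c , d) ⟨
      ⟦ c , d ⟧                ∎)
      where
      x y z w : Carrier
      x = a · 1#
      y = b · 1#
      z = c · 1#
      w = d · 1#

  open RingSolver differences (fromCommutativeRing R) morphism coefficient-≟ public

  :0 :1 : ∀ {n} → Polynomial n
  :0 = con (0 , 0)
  :1 = con (1 , 0)

-- Determinants as alternating forms

_[_≔_] : ∀ {a} {A : Set a} {k} → (Fin k → A) → Fin k → A → Fin k → A
M [ i ≔ x ] = updateAt M i (const x)

-- At a collision the rows B ∘ f repeat and their determinant vanishes; without one, an f between
-- sets of equal size is a permutation.
injective⊎collision : ∀ {k m} (f : Fin k → Fin m) →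
  Injective _≡_ _≡_ f ⊎ ∃ λ i → ∃ λ j → i ≢ j × f i ≡ f j
injective⊎collision f
  with any? (λ i → any? λ j → ¬? (i ≟ j) ×-dec (f i ≟ f j))
... | yes (i , j , i≢j , fi≡fj) = inj₂ (i , j , i≢j , fi≡fj)
... | no ∄ = inj₁ λ {i} {j} eq → helper i j eq (i ≟ j)
  where
  helper : ∀ i j → f i ≡ f j → Dec (i ≡ j) → i ≡ j
  helper i j eq (yes i≡j) = i≡j
  helper i j eq (no i≢j)  = contradiction (i , j , i≢j , eq) ∄

-- A missed value y could be punched out, which would embed n + 1 elements into n.
injective⇒surjective : ∀ {n} (f : Fin n → Fin n) → Injective _≡_ _≡_ f →
                       ∀ y → ∃ λ x → f x ≡ y
injective⇒surjective {suc n} f inj y with any? (λ x → f x ≟ y)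
... | yes p = p
... | no ∄ = contradiction
  (injective⇒≤ {f = λ x → punchOut (λ y≡fx → ∄ (x , ≡.sym y≡fx))}
    (λ {i} {j} eq → inj (punchOut-injective {i = y} _ _ eq)))
  ℕ.1+n≰n

module RowForms {c ℓ} (R : CommutativeRing c ℓ) where

  open CommutativeRing R hiding (zero)
  open RingProperties ring using (-‿distribˡ-*; -‿involutive)
  open SemiringSum semiring public
    using (sum; sum-cong-≋; ∑-distrib-+; ∑-comm; *-distribˡ-sum; *-distribʳ-sum; sum-replicate-zero)
  open RawSemiringDefs (RawRing.rawSemiring rawRing) using (_^_)
  open CommutativeMonoidSum *-commutativeMonoid public using ()
    renaming (sum to product; sum-cong-≋ to product-cong)
  open SemiringSolver commutativeSemiring using (solve; _:=_; _:+_; _:*_; con)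
  open SetoidReasoning setoid
  open Determinant rawRing public

  Row : ℕ → Set c
  Row n = Fin n → Carrier

  δ : ∀ {n} → Fin n → Row n
  δ i j = if does (i ≟ j) then 1# else 0#

  δ-refl : ∀ {n} (i : Fin n) → δ i i ≈ 1#
  δ-refl i rewrite dec-true (i ≟ i) ≡.refl = refl

  δ-≢ : ∀ {n} {i j : Fin n} → i ≢ j → δ i j ≈ 0#
  δ-≢ {i = i} {j} i≢j rewrite dec-false (i ≟ j) i≢j = refl

  sum-0 : ∀ {n} {t : Row n} → (∀ i → t i ≈ 0#) → sum t ≈ 0#
  sum-0 {n} t≈0 = trans (sum-cong-≋ t≈0) (sum-replicate-zero n)

  sum-δ : ∀ {n} i (t : Row n) → sum (λ j → δ i j * t j) ≈ t i
  sum-δ {suc n} zero t = begin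
    1# * t zero + sum (λ j → 0# * t (suc j)) ≈⟨ +-cong (*-identityˡ _) (sum-0 {n} λ j → zeroˡ _) ⟩
    t zero + 0#                              ≈⟨ +-identityʳ _ ⟩
    t zero                                   ∎
  sum-δ {suc n} (suc i) t = begin
    0# * t zero + sum (λ j → δ i j * t (suc j)) ≈⟨ +-cong (zeroˡ _) (sum-δ i (t ∘ suc)) ⟩
    0# + t (suc i)                              ≈⟨ +-identityˡ _ ⟩
    t (suc i)                                   ∎

  cancel : ∀ {x y} → x ≈ y + x → y ≈ 0#
  cancel {x} {y} eq = begin
    y             ≈⟨ +-identityʳ y ⟨
    y + 0#        ≈⟨ +-congˡ (-‿inverseʳ x) ⟨
    y + (x - x)   ≈⟨ +-assoc y x (- x) ⟨
    (y + x) - x   ≈⟨ +-congʳ eq ⟨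
    x - x         ≈⟨ -‿inverseʳ x ⟩
    0#            ∎

  [≔]-cong : ∀ {k n} {M N : Fin k → Row n} i {x y : Row n} →
             (∀ v → v ≢ i → ∀ j → M v j ≈ N v j) → (∀ j → x j ≈ y j) →
             ∀ v j → (M [ i ≔ x ]) v j ≈ (N [ i ≔ y ]) v j
  [≔]-cong {M = M} {N} i {x} {y} M≈N x≈y v j with v ≟ i
  ... | yes ≡.refl rewrite updateAt-updates v {const x} M | updateAt-updates v {const y} N = x≈y j
  ... | no v≢i rewrite updateAt-minimal v i {const x} M v≢i | updateAt-minimal v i {const y} N v≢i = M≈N v v≢i j

  -- Matrices are compared entrywise up to ≈. With N = M this exposes an existing row as an update,
  -- the form in which the row laws are stated.
  ≈[≔] : ∀ {k n} {M N : Fin k → Row n} i {x : Row n} →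
         (∀ v → v ≢ i → ∀ j → N v j ≈ M v j) → (∀ j → N i j ≈ x j) →
         ∀ v j → N v j ≈ (M [ i ≔ x ]) v j
  ≈[≔] {M = M} {N} i {x} N≈M Ni≈x v j with v ≟ i
  ... | yes ≡.refl rewrite updateAt-updates v {const x} M = Ni≈x j
  ... | no v≢i rewrite updateAt-minimal v i {const x} M v≢i = N≈M v v≢i j

  -- One law carries both additivity and homogeneity; homogeneity reappears once a zero row is known
  -- to give zero.
  record Multilinear {k n} (F : (Fin k → Row n) → Carrier) : Set (c Level.⊔ ℓ) where
    field
      cong   : ∀ {M N} → (∀ i j → M i j ≈ N i j) → F M ≈ F N
      linear : ∀ M i a x y →
               F (M [ i ≔ (λ j → x j + a * y j) ]) ≈ F (M [ i ≔ x ]) + a * F (M [ i ≔ y ])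

    -- Linearity applied to 0 = 0 + 1 · 0 gives F₀ = F₀ + F₀.
    zero-row : ∀ M i → F (M [ i ≔ (λ _ → 0#) ]) ≈ 0#
    zero-row M i = cancel (begin
      F₀            ≈⟨ cong ([≔]-cong i (λ _ _ _ → refl) λ j → solve 0 (con 0 := con 0 :+ con 1 :* con 0) refl) ⟩
      F (M [ i ≔ (λ _ → 0# + 1# * 0#) ]) ≈⟨ linear M i 1# _ _ ⟩
      F₀ + 1# * F₀  ≈⟨ +-congˡ (*-identityˡ _) ⟩
      F₀ + F₀       ∎)
      where F₀ = F (M [ i ≔ (λ _ → 0#) ])

    scale-row : ∀ M i a x → F (M [ i ≔ (λ j → a * x j) ]) ≈ a * F (M [ i ≔ x ])
    scale-row M i a x = begin
      F (M [ i ≔ (λ j → a * x j) ])       ≈⟨ cong ([≔]-cong i (λ _ _ _ → refl) λ j → sym (+-identityˡ _)) ⟩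
      F (M [ i ≔ (λ j → 0# + a * x j) ])  ≈⟨ linear M i a _ x ⟩
      F (M [ i ≔ (λ _ → 0#) ]) + a * F (M [ i ≔ x ]) ≈⟨ +-congʳ (zero-row M i) ⟩
      0# + a * F (M [ i ≔ x ])            ≈⟨ +-identityˡ _ ⟩
      a * F (M [ i ≔ x ])                 ∎

    sum-row : ∀ {m} M i (a : Row m) (x : Fin m → Row n) →
              F (M [ i ≔ (λ j → sum λ e → a e * x e j) ]) ≈ sum λ e → a e * F (M [ i ≔ x e ])
    sum-row {zero}  M i a x = zero-row M i
    sum-row {suc m} M i a x = begin
      F (M [ i ≔ (λ j → a zero * x zero j + sum λ e → a (suc e) * x (suc e) j) ])
        ≈⟨ cong ([≔]-cong i (λ _ _ _ → refl) λ j → +-comm _ _) ⟩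
      F (M [ i ≔ (λ j → (sum λ e → a (suc e) * x (suc e) j) + a zero * x zero j) ])
        ≈⟨ linear M i _ _ _ ⟩
      F (M [ i ≔ (λ j → sum λ e → a (suc e) * x (suc e) j) ]) + a zero * F (M [ i ≔ x zero ])
        ≈⟨ +-congʳ (sum-row M i (a ∘ suc) (x ∘ suc)) ⟩
      (sum λ e → a (suc e) * F (M [ i ≔ x (suc e) ])) + a zero * F (M [ i ≔ x zero ])
        ≈⟨ +-comm _ _ ⟩
      (sum λ e → a e * F (M [ i ≔ x e ])) ∎

  record Alternating {k n} (F : (Fin k → Row n) → Carrier) : Set (c Level.⊔ ℓ) where
    field
      multilinear : Multilinear F
      alternating : ∀ M {i j} → i ≢ j → (∀ l → M i l ≈ M j l) → F M ≈ 0#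

  -- What row reduction uses of a determinant.
  record RowForm {k n} (F : (Fin k → Row n) → Carrier) : Set (c Level.⊔ ℓ) where
    field
      cong  : ∀ {M N} → (∀ i j → M i j ≈ N i j) → F M ≈ F N
      scale : ∀ M i a x → F (M [ i ≔ (λ j → a * x j) ]) ≈ a * F (M [ i ≔ x ])
      shear : ∀ M {i v} a x → v ≢ i → F (M [ i ≔ (λ j → x j + a * M v j) ]) ≈ F (M [ i ≔ x ])

  alternating⇒rowForm : ∀ {k n} {F : (Fin k → Row n) → Carrier} → Alternating F → RowForm F
  alternating⇒rowForm {F = F} alt = record
    { cong = cong ; scale = scale-row
    ; shear = λ M {i} {v} a x v≢i → begin
        F (M [ i ≔ (λ j → x j + a * M v j) ])        ≈⟨ linear M i a x (M v) ⟩
        F (M [ i ≔ x ]) + a * F (M [ i ≔ M v ])      ≈⟨ +-congˡ (*-congˡ (alternating _ (v≢i ∘ ≡.sym) (repeated M v≢i))) ⟩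
        F (M [ i ≔ x ]) + a * 0#                     ≈⟨ +-congˡ (zeroʳ a) ⟩
        F (M [ i ≔ x ]) + 0#                         ≈⟨ +-identityʳ _ ⟩
        F (M [ i ≔ x ])                              ∎ }
    where
    open Alternating alt
    open Multilinear multilinear
    repeated : ∀ M {i v} → v ≢ i → ∀ l → (M [ i ≔ M v ]) i l ≈ (M [ i ≔ M v ]) v l
    repeated M {i} {v} v≢i l = reflexive (≡.cong (λ r → r l)
      (≡.trans (updateAt-updates i M) (≡.sym (updateAt-minimal v i M v≢i))))

  -- Sums over tuples and the expansion of all rows at once

  sumTuples : ∀ {k m} → ((Fin k → Fin m) → Carrier) → Carrier
  sumTuples {zero}  F = F λ ()
  sumTuples {suc k} F = sum λ e → sumTuples λ f → F (e ∷ᶠ f)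

  sumTuples-cong : ∀ {k m} {F G : (Fin k → Fin m) → Carrier} → (∀ f → F f ≈ G f) → sumTuples F ≈ sumTuples G
  sumTuples-cong {zero}  F≈G = F≈G _
  sumTuples-cong {suc k} F≈G = sum-cong-≋ λ e → sumTuples-cong λ f → F≈G (e ∷ᶠ f)

  sumTuples-0 : ∀ {k m} → sumTuples {k} {m} (λ _ → 0#) ≈ 0#
  sumTuples-0 {zero}  = refl
  sumTuples-0 {suc k} {m} = sum-0 {m} λ e → sumTuples-0 {k}

  sumTuples-+ : ∀ {k m} (F G : (Fin k → Fin m) → Carrier) →
                sumTuples (λ f → F f + G f) ≈ sumTuples F + sumTuples G
  sumTuples-+ {zero}  F G = refl
  sumTuples-+ {suc k} F G = trans (sum-cong-≋ λ e → sumTuples-+ (F ∘ (e ∷ᶠ_)) (G ∘ (e ∷ᶠ_)))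
    (∑-distrib-+ (λ e → sumTuples (F ∘ (e ∷ᶠ_))) (λ e → sumTuples (G ∘ (e ∷ᶠ_))))

  sumTuples-* : ∀ {k m} a (F : (Fin k → Fin m) → Carrier) → sumTuples (λ f → a * F f) ≈ a * sumTuples F
  sumTuples-* {zero}  a F = refl
  sumTuples-* {suc k} a F = trans (sum-cong-≋ λ e → sumTuples-* a (F ∘ (e ∷ᶠ_)))
    (sym (*-distribˡ-sum a (λ e → sumTuples (F ∘ (e ∷ᶠ_)))))

  ∷ᶠ-cong : ∀ {k n} {x y : Row n} {M N : Fin k → Row n} → (∀ j → x j ≈ y j) →
           (∀ i j → M i j ≈ N i j) → ∀ i j → (x ∷ᶠ M) i j ≈ (y ∷ᶠ N) i j
  ∷ᶠ-cong x≈y M≈N zero    = x≈y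
  ∷ᶠ-cong x≈y M≈N (suc i) = M≈N i

  ∷ᶠ-multilinear : ∀ {k n} {F : (Fin (suc k) → Row n) → Carrier} → Multilinear F →
                  ∀ x → Multilinear (λ M → F (x ∷ᶠ M))
  ∷ᶠ-multilinear {k} {n} {F} ml x = record
    { cong   = λ M≈N → cong (∷ᶠ-cong (λ _ → refl) M≈N)
    ; linear = λ M i a y z → trans (cong (pull M i))
        (trans (linear (x ∷ᶠ M) (suc i) a y z) (+-cong (cong (push M i)) (*-congˡ (cong (push M i))))) }
    where
    open Multilinear ml
    pull : ∀ M i {y : Row n} v j → (x ∷ᶠ (M [ i ≔ y ])) v j ≈ ((x ∷ᶠ M) [ suc i ≔ y ]) v j
    pull M i zero    j = refl
    pull M i (suc v) j = refl
    push : ∀ M i {y : Row n} v j → ((x ∷ᶠ M) [ suc i ≔ y ]) v j ≈ (x ∷ᶠ (M [ i ≔ y ])) v j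
    push M i v j = sym (pull M i v j)

  -- Row zero is expanded by linearity. Once it is fixed at B e, the other rows carry a multilinear
  -- form in one row fewer, so the induction needs F general and not just a determinant.
  expand : ∀ {k n m} {F : (Fin k → Row n) → Carrier} → Multilinear F →
           ∀ (a : Fin k → Row m) (B : Fin m → Row n) →
           F (λ v j → sum λ e → a v e * B e j) ≈ sumTuples λ f → product (λ v → a v (f v)) * F (B ∘ f)
  expand {zero} {F = F} ml a B = trans (Multilinear.cong ml λ ()) (sym (*-identityˡ _))
  expand {suc k} {n} {m} {F = F} ml a B = begin
    F M                                                      ≈⟨ cong (≈[≔] zero (λ _ _ _ → refl) (λ _ → refl)) ⟩
    F (M [ zero ≔ (λ j → sum λ e → a zero e * B e j) ])      ≈⟨ sum-row M zero (a zero) B ⟩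
    (sum λ e → a zero e * F (M [ zero ≔ B e ]))              ≈⟨ (sum-cong-≋ λ e → *-congˡ (step e)) ⟩
    (sum λ e → a zero e * sumTuples λ f → product (λ v → a (suc v) (f v)) * F (B ∘ (e ∷ᶠ f)))
                                                             ≈⟨ (sum-cong-≋ {m} λ e → sym (sumTuples-* {k} {m} (a zero e) _)) ⟩
    (sum λ e → sumTuples λ f → a zero e * (product (λ v → a (suc v) (f v)) * F (B ∘ (e ∷ᶠ f))))
                                                             ≈⟨ (sum-cong-≋ {m} λ e → sumTuples-cong {k} {m} λ f → sym (*-assoc _ _ _)) ⟩
    (sum λ e → sumTuples λ f → product (λ v → a v ((e ∷ᶠ f) v)) * F (B ∘ (e ∷ᶠ f))) ∎
    where
    open Multilinear ml
    M : Fin (suc k) → Row _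
    M v j = sum λ e → a v e * B e j
    split : ∀ e i j → (M [ zero ≔ B e ]) i j ≈ (B e ∷ᶠ (M ∘ suc)) i j
    split e zero    j = refl
    split e (suc i) j = refl
    join : ∀ e f i j → (B e ∷ᶠ (B ∘ f)) i j ≈ B ((e ∷ᶠ f) i) j
    join e f zero    j = refl
    join e f (suc i) j = refl
    step : ∀ e → F (M [ zero ≔ B e ]) ≈ sumTuples λ f → product (λ v → a (suc v) (f v)) * F (B ∘ (e ∷ᶠ f))
    step e = begin
      F (M [ zero ≔ B e ])   ≈⟨ cong (split e) ⟩
      F (B e ∷ᶠ (M ∘ suc))    ≈⟨ expand (∷ᶠ-multilinear ml (B e)) (a ∘ suc) B ⟩
      sumTuples (λ f → product (λ v → a (suc v) (f v)) * F (B e ∷ᶠ (B ∘ f))) ≈⟨ (sumTuples-cong λ f → *-congˡ (cong (join e f))) ⟩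
      sumTuples (λ f → product (λ v → a (suc v) (f v)) * F (B ∘ (e ∷ᶠ f))) ∎

  private
    σ : Carrier
    σ = - 1#

    1+σ≈0 : 1# + σ ≈ 0#
    1+σ≈0 = -‿inverseʳ 1#

    σ*σ≈1 : σ * σ ≈ 1#
    σ*σ≈1 = trans (sym (-‿distribˡ-* 1# σ)) (trans (-‿cong (*-identityˡ σ)) (-‿involutive 1#))

  -- The Laplace expansion as an alternating form

  minor : ∀ {n} → (Fin (suc n) → Row (suc n)) → Fin (suc n) → Fin n → Row n
  minor M j r s = M (suc r) (punchIn j s)

  laplaceTerm : ∀ {n} → (Fin (suc n) → Row (suc n)) → Row (suc n)
  laplaceTerm M j = σ ^ toℕ j * (M zero j * det (minor M j))

  laplaceTerm-cong : ∀ {n} (M N : Fin (suc n) → Row (suc n)) {j} → M zero j ≈ N zero j →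
                     det (minor M j) ≈ det (minor N j) → laplaceTerm M j ≈ laplaceTerm N j
  laplaceTerm-cong M N x≈y d≈e = *-congˡ (*-cong x≈y d≈e)

  laplaceTerm-0 : ∀ {n} (M : Fin (suc n) → Row (suc n)) {j} → det (minor M j) ≈ 0# → laplaceTerm M j ≈ 0#
  laplaceTerm-0 M d≈0 = trans (*-congˡ (trans (*-congˡ d≈0) (zeroʳ _))) (zeroʳ _)

  det-cong : ∀ {n} {M N : Fin n → Row n} → (∀ i j → M i j ≈ N i j) → det M ≈ det N
  det-cong {zero}          M≈N = refl
  det-cong {suc n} {M} {N} M≈N = sum-cong-≋ {suc n} {laplaceTerm M} {laplaceTerm N} λ j →
    laplaceTerm-cong M N (M≈N zero j) (det-cong λ r s → M≈N (suc r) (punchIn j s))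

  minor-[≔] : ∀ {n} (M : Fin (suc n) → Row (suc n)) i x j r s →
              minor (M [ suc i ≔ x ]) j r s ≡ (minor M j [ i ≔ x ∘ punchIn j ]) r s
  minor-[≔] M i x j r s =
    ≡.cong (λ row → row s) (map-updateAt {f = _∘ punchIn j} (λ _ → ≡.refl) (M ∘ suc) i r)

  det-multilinear : ∀ {n} → Multilinear (det {n})
  det-multilinear {zero}  = record { cong = det-cong ; linear = λ M () }
  det-multilinear {suc n} = record { cong = det-cong ; linear = linear }
    where
    gather : ∀ a {f g h : Row (suc n)} → (∀ j → f j ≈ g j + a * h j) → sum f ≈ sum g + a * sum h
    gather a {f} {g} {h} eq = begin
      sum f                          ≈⟨ sum-cong-≋ eq ⟩
      sum (λ j → g j + a * h j)      ≈⟨ ∑-distrib-+ g (λ j → a * h j) ⟩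
      sum g + sum (λ j → a * h j)    ≈⟨ +-congˡ (sym (*-distribˡ-sum a h)) ⟩
      sum g + a * sum h              ∎
    linear : ∀ M i a x y →
             det (M [ i ≔ (λ j → x j + a * y j) ]) ≈ det (M [ i ≔ x ]) + a * det (M [ i ≔ y ])
    linear M zero a x y = gather a λ j →
      solve 5 (λ e x a y d → e :* ((x :+ a :* y) :* d) := e :* (x :* d) :+ a :* (e :* (y :* d))) refl
        (σ ^ toℕ j) (x j) a (y j) (det (minor M j))
    linear M (suc i) a x y = gather a λ j → begin
      σ ^ toℕ j * (M zero j * det (minor (M [ suc i ≔ (λ j → x j + a * y j) ]) j))
        ≈⟨ *-congˡ (*-congˡ (det-cong λ r s → reflexive (minor-[≔] M i _ j r s))) ⟩
      σ ^ toℕ j * (M zero j * det (minor M j [ i ≔ (λ s → x (punchIn j s) + a * y (punchIn j s)) ]))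
        ≈⟨ *-congˡ (*-congˡ (Multilinear.linear det-multilinear (minor M j) i a _ _)) ⟩
      σ ^ toℕ j * (M zero j * (det (minor M j [ i ≔ x ∘ punchIn j ]) + a * det (minor M j [ i ≔ y ∘ punchIn j ])))
        ≈⟨ solve 5 (λ e m p a q → e :* (m :* (p :+ a :* q)) := e :* (m :* p) :+ a :* (e :* (m :* q))) refl
             (σ ^ toℕ j) (M zero j) _ a _ ⟩
      σ ^ toℕ j * (M zero j * det (minor M j [ i ≔ x ∘ punchIn j ])) + a * (σ ^ toℕ j * (M zero j * det (minor M j [ i ≔ y ∘ punchIn j ])))
        ≈⟨ +-cong (*-congˡ (*-congˡ (det-cong λ r s → sym (reflexive (minor-[≔] M i _ j r s)))))
             (*-congˡ (*-congˡ (*-congˡ (det-cong λ r s → sym (reflexive (minor-[≔] M i _ j r s)))))) ⟩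
      σ ^ toℕ j * (M zero j * det (minor (M [ suc i ≔ x ]) j)) + a * (σ ^ toℕ j * (M zero j * det (minor (M [ suc i ≔ y ]) j))) ∎

  -- Expanding along two rows indexes each pair of columns twice, with opposite signs.
  two-row-cancellation : ∀ {n} (Φ : Fin (suc (suc n)) → Fin (suc (suc n)) → (Fin n → Fin (suc (suc n))) → Carrier) →
    (∀ a b {c d} → (∀ s → c s ≡ d s) → Φ a b c ≈ Φ b a d) →
    (sum λ j → sum λ k → σ ^ toℕ j * (σ ^ toℕ k * Φ j (punchIn j k) (λ s → punchIn j (punchIn k s)))) ≈ 0#
  two-row-cancellation {n} Φ Φ-sym = begin
    sum X + sum (λ j → Y j + sum (Z j))        ≈⟨ +-congˡ (∑-distrib-+ Y (λ j → sum (Z j))) ⟩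
    sum X + (sum Y + sum (λ j → sum (Z j)))    ≈⟨ +-assoc _ _ _ ⟨
    (sum X + sum Y) + sum (λ j → sum (Z j))    ≈⟨ +-cong (trans (sym (∑-distrib-+ X Y)) (sum-0 X+Y≈0)) (ΣZ≈0 Φ Φ-sym) ⟩
    0# + 0#                                    ≈⟨ +-identityˡ 0# ⟩
    0#                                         ∎
    where
    -- Column zero is taken by the first row in X, by the second row in Y and by neither in Z.
    X Y : Row (suc n)
    X k = σ ^ 0 * (σ ^ toℕ k * Φ zero (suc k) (λ s → suc (punchIn k s)))
    Y j = σ ^ suc (toℕ j) * (σ ^ 0 * Φ (suc j) zero (λ s → suc (punchIn j s)))
    Z : Fin (suc n) → Row n
    Z j k = σ ^ suc (toℕ j) * (σ ^ suc (toℕ k) * Φ (suc j) (suc (punchIn j k)) (λ s → punchIn (suc j) (punchIn (suc k) s)))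

    X+Y≈0 : ∀ k → X k + Y k ≈ 0#
    X+Y≈0 k = begin
      X k + Y k                ≈⟨ +-congˡ (*-congˡ (*-congˡ (Φ-sym (suc k) zero λ _ → ≡.refl))) ⟩
      1# * (p * φ) + σ * p * (1# * φ) ≈⟨ solve 3 (λ e p φ → con 1 :* (p :* φ) :+ e :* p :* (con 1 :* φ) := (con 1 :+ e) :* (p :* φ)) refl σ p φ ⟩
      (1# + σ) * (p * φ)       ≈⟨ *-congʳ 1+σ≈0 ⟩
      0# * (p * φ)             ≈⟨ zeroˡ _ ⟩
      0#                       ∎
      where
      p = σ ^ toℕ k
      φ = Φ zero (suc k) (λ s → suc (punchIn k s))

    -- Column zero survives both deletions and stands first among the remaining columns. Absorbing
    -- it into Φ′ and cancelling the two extra signs leaves the same double sum with one column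
    -- fewer.
    ΣZ≈0 : ∀ {n} (Φ : Fin (suc (suc n)) → Fin (suc (suc n)) → (Fin n → Fin (suc (suc n))) → Carrier) →
      (∀ a b {c d} → (∀ s → c s ≡ d s) → Φ a b c ≈ Φ b a d) →
      sum {suc n} (λ j → sum {n} λ k → σ ^ suc (toℕ j) * (σ ^ suc (toℕ k) *
        Φ (suc j) (suc (punchIn j k)) (λ s → punchIn (suc j) (punchIn (suc k) s)))) ≈ 0#
    ΣZ≈0 {zero}  Φ Φ-sym = sum-0 {1} λ _ → refl
    ΣZ≈0 {suc n} Φ Φ-sym = trans
      (sum-cong-≋ {suc (suc n)} λ j → sum-cong-≋ {suc n} λ k → trans (signs (σ ^ toℕ j) (σ ^ toℕ k) _) (*-congˡ (*-congˡ (Φ≈Φ′ j k))))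
      (two-row-cancellation Φ′ λ a b c≗d → Φ-sym (suc a) (suc b) (lift c≗d))
      where
      Φ′ : Fin (suc (suc n)) → Fin (suc (suc n)) → (Fin n → Fin (suc (suc n))) → Carrier
      Φ′ a b c = Φ (suc a) (suc b) (zero ∷ᶠ (suc ∘ c))
      lift : ∀ {c d : Fin n → Fin (suc (suc n))} → (∀ s → c s ≡ d s) → ∀ s → (zero ∷ᶠ (suc ∘ c)) s ≡ (zero ∷ᶠ (suc ∘ d)) s
      lift c≗d zero    = ≡.refl
      lift c≗d (suc s) = ≡.cong suc (c≗d s)
      signs : ∀ p q φ → σ * p * (σ * q * φ) ≈ p * (q * φ)
      signs p q φ = begin
        σ * p * (σ * q * φ) ≈⟨ solve 4 (λ e p q φ → e :* p :* (e :* q :* φ) := e :* e :* (p :* (q :* φ))) refl σ p q φ ⟩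
        σ * σ * (p * (q * φ)) ≈⟨ *-congʳ σ*σ≈1 ⟩
        1# * (p * (q * φ))  ≈⟨ *-identityˡ _ ⟩
        p * (q * φ)         ∎
      Φ≈Φ′ : ∀ j k → Φ (suc j) (suc (punchIn j k)) (λ s → punchIn (suc j) (punchIn (suc k) s)) ≈
                     Φ′ j (punchIn j k) (λ s → punchIn j (punchIn k s))
      Φ≈Φ′ j k = trans (Φ-sym _ _ λ _ → ≡.refl) (Φ-sym _ _ λ where
        zero    → ≡.refl
        (suc s) → ≡.refl)

  det-top-rows-equal : ∀ {n} (M : Fin (suc (suc n)) → Row (suc (suc n))) →
                       (∀ l → M zero l ≈ M (suc zero) l) → det M ≈ 0#
  det-top-rows-equal {n} M eq = begin
    sum (laplaceTerm M)                        ≈⟨ sum-cong-≋ {suc (suc n)} {laplaceTerm M} expandMinor ⟩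
    (sum λ j → sum λ k → T j k)                ≈⟨ two-row-cancellation Φ Φ-sym ⟩
    0#                                         ∎
    where
    Φ : Fin (suc (suc n)) → Fin (suc (suc n)) → (Fin n → Fin (suc (suc n))) → Carrier
    -- The entry of the second row is replaced by the equal entry of the first, which makes Φ
    -- symmetric in the two columns.
    Φ a b c = M zero a * M zero b * det (λ r s → M (suc (suc r)) (c s))
    Φ-sym : ∀ a b {c d} → (∀ s → c s ≡ d s) → Φ a b c ≈ Φ b a d
    Φ-sym a b c≗d = *-cong (*-comm _ _) (det-cong λ r s → reflexive (≡.cong (M (suc (suc r))) (c≗d s)))
    T : Fin (suc (suc n)) → Row (suc n)
    T j k = σ ^ toℕ j * (σ ^ toℕ k * Φ j (punchIn j k) (λ s → punchIn j (punchIn k s)))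
    expandMinor : ∀ j → laplaceTerm M j ≈ sum (T j)
    expandMinor j = begin
      p * (x * sum L)                    ≈⟨ *-congˡ (*-distribˡ-sum x L) ⟩
      p * sum (λ k → x * L k)            ≈⟨ *-distribˡ-sum p (λ k → x * L k) ⟩
      sum (λ k → p * (x * L k))          ≈⟨ sum-cong-≋ {suc n} {λ k → p * (x * L k)} {T j} (λ k → *-congˡ (shuffle k)) ⟩
      sum (T j)                          ∎
      where
      p x : Carrier
      p = σ ^ toℕ j
      x = M zero j
      L : Row (suc n)
      L = laplaceTerm (minor M j)
      shuffle : ∀ k → x * L k ≈ σ ^ toℕ k * Φ j (punchIn j k) (λ s → punchIn j (punchIn k s))
      shuffle k = trans (*-congˡ (*-congˡ (*-congʳ (sym (eq (punchIn j k))))))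
        (solve 4 (λ x q y d → x :* (q :* (y :* d)) := q :* (x :* y :* d)) refl x (σ ^ toℕ k) (M zero (punchIn j k)) _)

  det-alternating : ∀ {n} → Alternating (det {n})
  det-alternating = record { multilinear = det-multilinear ; alternating = alternating }
    where
    top : ∀ {n} → (∀ M {i j : Fin n} → i ≢ j → (∀ l → M i l ≈ M j l) → det M ≈ 0#) →
          ∀ M (j : Fin n) → (∀ l → M zero l ≈ M (suc j) l) → det {suc n} M ≈ 0#
    top alternating M zero    eq = det-top-rows-equal M eq
    -- Polarisation: P x y puts x in row 1 and y in row k = j + 2. P a y vanishes because rows zero
    -- and 1 agree, P x x because rows 1 and k agree in every minor, so expanding P (a + b) (a + b)
    -- = 0 leaves P b a, which is det M.
    top {suc (suc n)} alternating M (suc j) eq = begin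
      det M                              ≈⟨ det-cong (≈[≔] {M = M [ k ≔ a ]} {N = M} 1F (λ v _ l → ≈[≔] {M = M} {N = M} k (λ _ _ _ → refl) (λ l → sym (eq l)) v l) (λ _ → refl)) ⟩
      P b a                              ≈⟨ +-identityˡ _ ⟨
      0# + P b a                         ≈⟨ +-cong (sym (Pxx b)) (sym (*-identityˡ _)) ⟩
      P b b + 1# * P b a                 ≈⟨ P-linʳ b ⟨
      P b a+b                            ≈⟨ +-identityʳ _ ⟨
      P b a+b + 0#                       ≈⟨ +-congˡ (trans (*-congˡ (Pa a+b)) (zeroʳ 1#)) ⟨
      P b a+b + 1# * P a a+b             ≈⟨ linear (M [ k ≔ a+b ]) 1F 1# b a ⟨
      P a+b a+b                          ≈⟨ Pxx a+b ⟩
      0#                                 ∎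
      where
      open Multilinear (det-multilinear {suc (suc (suc n))})
      1F k : Fin (suc (suc (suc n)))
      1F = suc zero
      k  = suc (suc j)
      a b a+b : Row (suc (suc (suc n)))
      a = M zero
      b = M 1F
      a+b l = b l + 1# * a l
      P : Row (suc (suc (suc n))) → Row (suc (suc (suc n))) → Carrier
      P x y = det ((M [ k ≔ y ]) [ 1F ≔ x ])
      commute : ∀ x y v l → ((M [ k ≔ y ]) [ 1F ≔ x ]) v l ≈ ((M [ 1F ≔ x ]) [ k ≔ y ]) v l
      commute x y v l = reflexive (≡.cong (λ r → r l) (updateAt-commutes 1F k (λ ()) M v))
      P-linʳ : ∀ x → P x a+b ≈ P x b + 1# * P x a
      P-linʳ x = trans (det-cong (commute x a+b)) (trans (linear (M [ 1F ≔ x ]) k 1# b a)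
        (+-cong (det-cong λ v l → sym (commute x b v l)) (*-congˡ (det-cong λ v l → sym (commute x a v l)))))
      Pa : ∀ y → P a y ≈ 0#
      Pa y = det-top-rows-equal ((M [ k ≔ y ]) [ 1F ≔ a ]) λ _ → refl
      Pxx : ∀ x → P x x ≈ 0#
      Pxx x = sum-0 {suc (suc (suc n))} {laplaceTerm N} λ c → laplaceTerm-0 N
        (alternating (minor N c) {zero} {suc j} (λ ()) λ s → sym (reflexive
          (≡.cong (λ r → r (punchIn c s)) (updateAt-updates j {const x} (λ i → M (suc (suc i)))))))
        where
        N : Fin (suc (suc (suc n))) → Row (suc (suc (suc n)))
        N = (M [ k ≔ x ]) [ 1F ≔ x ]

    alternating : ∀ {n} M {i j : Fin n} → i ≢ j → (∀ l → M i l ≈ M j l) → det M ≈ 0#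
    alternating {suc n} M {zero}  {zero}  i≢j eq = contradiction ≡.refl i≢j
    alternating {suc n} M {zero}  {suc j} i≢j eq = top alternating M j eq
    alternating {suc n} M {suc i} {zero}  i≢j eq = top alternating M i (λ l → sym (eq l))
    alternating {suc n} M {suc i} {suc j} i≢j eq = sum-0 {suc n} {laplaceTerm M} λ c →
      laplaceTerm-0 M (alternating (minor M c) (i≢j ∘ ≡.cong suc) λ s → eq (punchIn c s))

  det-δ : ∀ {n} → det (δ {n}) ≈ 1#
  det-δ {zero}  = refl
  det-δ {suc n} = begin
    σ ^ 0 * (1# * det (δ {n})) + sum {n} (λ j → laplaceTerm δ (suc j))
      ≈⟨ +-cong (trans (*-identityˡ _) (*-identityˡ _)) (sum-0 {n} {λ j → laplaceTerm δ (suc j)} λ j → trans (*-congˡ (zeroˡ _)) (zeroʳ _)) ⟩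
    det (δ {n}) + 0# ≈⟨ +-identityʳ _ ⟩
    det (δ {n})      ≈⟨ det-δ {n} ⟩
    1#               ∎

-- Row reduction along cycles

-- The steps of the walk x, xs, z with its end point kept apart, so that an induction can move the
-- start while the end stays fixed. A cycle r ∷ rs has the arcs `arcs r rs r`.
arcs : ∀ {a} {A : Set a} → A → List A → A → List (A × A)
arcs x []        z = (x , z) ∷ []
arcs x (y ∷ ys) z = (x , y) ∷ arcs y ys z

module Elimination {c ℓ} (R : CommutativeRing c ℓ) where

  open CommutativeRing R hiding (zero)
  open RingProperties ring using (-‿distribˡ-*; -‿distribʳ-*; -‿involutive; -0#≈0#)
  open SemiringSolver commutativeSemiring using (solve; _:=_; _:+_; _:*_; con)
  open SetoidReasoning setoid
  open RowForms R

  -- If f collides, B ∘ f always has two equal rows and both sides of each law vanish. Otherwise f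
  -- is a permutation, and updating row i of B updates exactly row f⁻¹ i of B ∘ f.
  reindex-rowForm : ∀ {n} (f : Fin n → Fin n) → RowForm (λ B → det (B ∘ f))
  reindex-rowForm {n} f with injective⊎collision f
  ... | inj₂ (p , q , p≢q , fp≡fq) = record
    { cong  = λ M≈N → det-cong λ i → M≈N (f i)
    ; scale = λ M i a x → trans (vanish (M [ i ≔ _ ])) (sym (trans (*-congˡ (vanish (M [ i ≔ x ]))) (zeroʳ a)))
    ; shear = λ M {i} a x v≢i → trans (vanish (M [ i ≔ _ ])) (sym (vanish (M [ i ≔ x ]))) }
    where
    vanish : ∀ M → det (M ∘ f) ≈ 0#
    vanish M = Alternating.alternating det-alternating (M ∘ f) p≢q λ l → reflexive (≡.cong (λ r → M r l) fp≡fq)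
  ... | inj₁ f-inj = record
    { cong  = λ M≈N → det-cong λ i → M≈N (f i)
    ; scale = λ M i a x → trans (transport M i _) (trans (scale (M ∘ f) (f⁻¹ i) a x) (*-congˡ (sym (transport M i x))))
    ; shear = λ M {i} {v} a x v≢i → trans (transport M i _)
        (trans (cong ([≔]-cong {M = M ∘ f} (f⁻¹ i) (λ _ _ _ → refl) λ j → +-congˡ (*-congˡ (reflexive (≡.cong (λ r → M r j) (≡.sym (ff⁻¹ v)))))))
        (trans (shear (M ∘ f) a x λ eq → v≢i (≡.trans (≡.sym (ff⁻¹ v)) (≡.trans (≡.cong f eq) (ff⁻¹ i))))
        (sym (transport M i x)))) }
    where
    open RowForm (alternating⇒rowForm (det-alternating {n}))
    f⁻¹ : Fin n → Fin n
    f⁻¹ i = proj₁ (injective⇒surjective f f-inj i)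
    ff⁻¹ : ∀ i → f (f⁻¹ i) ≡ i
    ff⁻¹ i = proj₂ (injective⇒surjective f f-inj i)
    transport : ∀ M i x → det ((M [ i ≔ x ]) ∘ f) ≈ det ((M ∘ f) [ f⁻¹ i ≔ x ])
    transport M i x = det-cong (≈[≔] {M = M ∘ f} {N = (M [ i ≔ x ]) ∘ f} (f⁻¹ i)
      (λ v v≢ l → reflexive (≡.cong (λ r → r l) (updateAt-minimal (f v) i {const x} M
         λ fv≡i → v≢ (f-inj (≡.trans fv≡i (≡.sym (ff⁻¹ i)))))))
      (λ l → reflexive (≡.cong (λ r → r l) (≡.trans (≡.cong (M [ i ≔ x ]) (ff⁻¹ i)) (updateAt-updates i {const x} M)))))

  -- The product of the transpose of C with B, that is, a sum of m rank-one matrices.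
  gram : ∀ {n m} → (Fin m → Row n) → (Fin m → Row n) → Fin n → Row n
  gram C B v u = sum λ x → C x v * B x u

  det-gram : ∀ {n m} (C B : Fin m → Row n) →
             det (gram C B) ≈ sumTuples λ f → product (λ v → C (f v) v) * det (B ∘ f)
  det-gram C B = expand det-multilinear (λ v e → C e v) B

  -- The laws hold for each `det (B ∘ f)` and pass to the sum of `det-gram`, because the weight of f
  -- involves C alone.
  gram-rowFormʳ : ∀ {n} (C : Fin n → Row n) → RowForm (λ B → det (gram C B))
  gram-rowFormʳ {n} C = record
    { cong  = λ {M} {N} M≈N → det-cong λ v u → sum-cong-≋ {n} λ x → *-congˡ (M≈N x u)
    ; scale = λ M i a x → begin
        det (gram C (M [ i ≔ (λ j → a * x j) ]))
          ≈⟨ det-gram C _ ⟩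
        sumTuples (λ f → w f * det ((M [ i ≔ (λ j → a * x j) ]) ∘ f))
          ≈⟨ sumTuples-cong (λ f → trans (*-congˡ (RowForm.scale (reindex-rowForm f) M i a x))
               (solve 3 (λ w a d → w :* (a :* d) := a :* (w :* d)) refl (w f) a _)) ⟩
        sumTuples (λ f → a * (w f * det ((M [ i ≔ x ]) ∘ f)))
          ≈⟨ sumTuples-* {n} {n} a _ ⟩
        a * sumTuples (λ f → w f * det ((M [ i ≔ x ]) ∘ f))
          ≈⟨ *-congˡ (det-gram C _) ⟨
        a * det (gram C (M [ i ≔ x ])) ∎
    ; shear = λ M {i} {v} a x v≢i → begin
        det (gram C (M [ i ≔ (λ j → x j + a * M v j) ]))
          ≈⟨ det-gram C _ ⟩
        sumTuples (λ f → w f * det ((M [ i ≔ (λ j → x j + a * M v j) ]) ∘ f))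
          ≈⟨ sumTuples-cong (λ f → *-congˡ (RowForm.shear (reindex-rowForm f) M a x v≢i)) ⟩
        sumTuples (λ f → w f * det ((M [ i ≔ x ]) ∘ f))
          ≈⟨ det-gram C _ ⟨
        det (gram C (M [ i ≔ x ])) ∎ }
    where
    w : (Fin n → Fin n) → Carrier
    w f = product λ v → C (f v) v

  sum-perturb : ∀ {n} i d {s t : Row n} → (∀ y → t y ≈ s y + δ i y * d) → sum t ≈ sum s + d
  sum-perturb {n} i d {s} {t} t≈ = begin
    sum t                              ≈⟨ sum-cong-≋ t≈ ⟩
    sum (λ y → s y + δ i y * d)        ≈⟨ ∑-distrib-+ s (λ y → δ i y * d) ⟩
    sum s + sum (λ y → δ i y * d)      ≈⟨ +-congˡ (sum-δ i (λ _ → d)) ⟩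
    sum s + d                          ∎

  -- Row operations on C are compensated by row operations on B.
  gram-rowFormˡ : ∀ {n} (B : Fin n → Row n) → RowForm (λ C → det (gram C B))
  gram-rowFormˡ {n} B = record
    { cong  = λ {M} {N} M≈N → det-cong λ v u → sum-cong-≋ {n} λ x → *-congʳ (M≈N x v)
    ; scale = λ M i a x → begin
        det (gram (M [ i ≔ (λ j → a * x j) ]) B)
          ≈⟨ (det-cong λ v u → sum-cong-≋ {n} (scale-term M i a x v u)) ⟩
        det (gram (M [ i ≔ x ]) (B [ i ≔ (λ j → a * B i j) ]))
          ≈⟨ RowForm.scale (gram-rowFormʳ (M [ i ≔ x ])) B i a (B i) ⟩
        a * det (gram (M [ i ≔ x ]) (B [ i ≔ B i ]))
          ≈⟨ *-congˡ (RowForm.cong (gram-rowFormʳ (M [ i ≔ x ])) (restore i)) ⟩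
        a * det (gram (M [ i ≔ x ]) B) ∎
    ; shear = λ M {i} {v} a x v≢i → begin
        det (gram (M [ i ≔ (λ j → x j + a * M v j) ]) B)
          -- Adding a · M v to row i on the left and adding a · B i to row v on the right change the
          -- product by the same rank-one matrix, with entries a · M v p · B i q.
          ≈⟨ (det-cong λ p q → trans
               (sum-perturb i _ {λ y → (M [ i ≔ x ]) y p * B y q} (shear-termˡ M a x p q))
               (sym (sum-perturb v _ {λ y → (M [ i ≔ x ]) y p * B y q} (shear-termʳ M a x v≢i p q)))) ⟩
        det (gram (M [ i ≔ x ]) (B [ v ≔ (λ j → B v j + a * B i j) ]))
          ≈⟨ RowForm.shear (gram-rowFormʳ (M [ i ≔ x ])) B a (B v) (v≢i ∘ ≡.sym) ⟩
        det (gram (M [ i ≔ x ]) (B [ v ≔ B v ]))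
          ≈⟨ RowForm.cong (gram-rowFormʳ (M [ i ≔ x ])) (restore v) ⟩
        det (gram (M [ i ≔ x ]) B) ∎ }
    where
    restore : ∀ i v j → (B [ i ≔ B i ]) v j ≈ B v j
    restore i v j = sym (≈[≔] {M = B} {N = B} i (λ _ _ _ → refl) (λ _ → refl) v j)

    at : ∀ (M : Fin n → Row n) i {x j} → (M [ i ≔ x ]) i j ≈ x j
    at M i {x} {j} = reflexive (≡.cong (λ r → r j) (updateAt-updates i {const x} M))

    off : ∀ (M : Fin n → Row n) {v i x j} → v ≢ i → (M [ i ≔ x ]) v j ≈ M v j
    off M {v} {i} {x} {j} v≢i = reflexive (≡.cong (λ r → r j) (updateAt-minimal v i {const x} M v≢i))

    no-perturbation : ∀ {y i s d} → y ≢ i → s + δ i y * d ≈ s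
    no-perturbation y≢i = trans (+-congˡ (trans (*-congʳ (δ-≢ (y≢i ∘ ≡.sym))) (zeroˡ _))) (+-identityʳ _)

    scale-term : ∀ (M : Fin n → Row n) i a x v u y →
      (M [ i ≔ (λ j → a * x j) ]) y v * B y u ≈ (M [ i ≔ x ]) y v * (B [ i ≔ (λ j → a * B i j) ]) y u
    scale-term M i a x v u y with y ≟ i
    ... | yes ≡.refl = begin
      (M [ i ≔ (λ j → a * x j) ]) i v * B i u                ≈⟨ *-congʳ (at M i) ⟩
      a * x v * B i u                                        ≈⟨ solve 3 (λ a x b → a :* x :* b := x :* (a :* b)) refl a (x v) (B i u) ⟩
      x v * (a * B i u)                                      ≈⟨ *-cong (at M i) (at B i) ⟨
      (M [ i ≔ x ]) i v * (B [ i ≔ (λ j → a * B i j) ]) i u  ∎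
    ... | no y≢i = *-cong (trans (off M y≢i) (sym (off M y≢i))) (sym (off B y≢i))

    shear-termˡ : ∀ (M : Fin n → Row n) {i v} a x p q y →
      (M [ i ≔ (λ j → x j + a * M v j) ]) y p * B y q ≈ (M [ i ≔ x ]) y p * B y q + δ i y * (a * (M v p * B i q))
    shear-termˡ M {i} {v} a x p q y with y ≟ i
    ... | yes ≡.refl = begin
      (M [ i ≔ (λ j → x j + a * M v j) ]) i p * B i q            ≈⟨ *-congʳ (at M i) ⟩
      (x p + a * M v p) * B i q                                  ≈⟨ solve 4 (λ x a m b → (x :+ a :* m) :* b := x :* b :+ con 1 :* (a :* (m :* b))) refl (x p) a (M v p) (B i q) ⟩
      x p * B i q + 1# * (a * (M v p * B i q))                   ≈⟨ +-cong (*-congʳ (at M i)) (*-congʳ (δ-refl i)) ⟨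
      (M [ i ≔ x ]) i p * B i q + δ i i * (a * (M v p * B i q))  ∎
    ... | no y≢i = trans (*-congʳ (trans (off M y≢i) (sym (off M y≢i)))) (sym (no-perturbation y≢i))

    shear-termʳ : ∀ (M : Fin n → Row n) {i v} a x → v ≢ i → ∀ p q y →
      (M [ i ≔ x ]) y p * (B [ v ≔ (λ j → B v j + a * B i j) ]) y q ≈ (M [ i ≔ x ]) y p * B y q + δ v y * (a * (M v p * B i q))
    shear-termʳ M {i} {v} a x v≢i p q y with y ≟ v
    ... | yes ≡.refl = begin
      (M [ i ≔ x ]) v p * (B [ v ≔ (λ j → B v j + a * B i j) ]) v q  ≈⟨ *-cong (off M v≢i) (at B v) ⟩
      M v p * (B v q + a * B i q)                                    ≈⟨ solve 4 (λ m b a d → m :* (b :+ a :* d) := m :* b :+ con 1 :* (a :* (m :* d))) refl (M v p) (B v q) a (B i q) ⟩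
      M v p * B v q + 1# * (a * (M v p * B i q))                     ≈⟨ +-cong (*-congʳ (off M v≢i)) (*-congʳ (δ-refl v)) ⟨
      (M [ i ≔ x ]) v p * B v q + δ v v * (a * (M v p * B i q))      ∎
    ... | no y≢v = trans (*-congˡ (off B y≢v)) (sym (no-perturbation y≢v))

  gram-δ : ∀ {n} (B : Fin n → Row n) → det (gram δ B) ≈ det B
  gram-δ {n} B = det-cong λ v u → trans (sum-cong-≋ {n} λ x → *-congʳ (δ-sym x v)) (sum-δ v (λ x → B x u))
    where
    δ-sym : ∀ (i j : Fin n) → δ i j ≈ δ j i
    δ-sym i j with i ≟ j
    ... | yes ≡.refl = sym (δ-refl i)
    ... | no i≢j     = sym (δ-≢ (i≢j ∘ ≡.sym))

  det-scale : ∀ {n} (d : Row n) (M : Fin n → Row n) → det (λ i j → d i * M i j) ≈ product d * det M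
  det-scale {zero}  d M = sym (*-identityˡ 1#)
  det-scale {suc n} d M = begin
    sum (laplaceTerm dM)                      ≈⟨ sum-cong-≋ {suc n} {laplaceTerm dM} {λ j → product d * laplaceTerm M j} scaled ⟩
    sum (λ j → product d * laplaceTerm M j)   ≈⟨ *-distribˡ-sum (product d) (laplaceTerm M) ⟨
    product d * det M                         ∎
    where
    dM : Fin (suc n) → Row (suc n)
    dM i j = d i * M i j
    scaled : ∀ j → laplaceTerm dM j ≈ product d * laplaceTerm M j
    scaled j = trans (*-congˡ (*-congˡ (det-scale (d ∘ suc) (minor M j))))
      (solve 5 (λ e x y p q → e :* (x :* y :* (p :* q)) := x :* p :* (e :* (y :* q))) refl
        _ (d zero) (M zero j) (product (d ∘ suc)) (det (minor M j)))

  -- Elimination along the orbits of a map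

  listProduct : List Carrier → Carrier
  listProduct = foldr _*_ 1#

  -- The matrix I - diag(t) P, with P the 0-1 matrix of the map g. Clearing entry v of t turns row v
  -- into δ v, so the progress of the elimination is recorded in t alone.
  twist : ∀ {n} → Row n → (Fin n → Fin n) → Fin n → Row n
  twist t g v j = δ v j - t v * δ (g v) j

  module _ {n} {F : (Fin n → Row n) → Carrier} (form : RowForm F) (g : Fin n → Fin n) where

    open RowForm form

    private
      towards : Fin n → Carrier → Fin n → Row n
      towards v τ u j = δ v j - τ * δ u j

      -- Adding τ times row u to row v moves its target from u to g u and multiplies the coefficient
      -- by t u. The condition u ≢ v keeps row u intact while row v is being rebuilt.
      step : ∀ t v τ u → u ≢ v →
             F (twist t g [ v ≔ towards v τ u ]) ≈ F (twist t g [ v ≔ towards v (τ * t u) (g u) ])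
      step t v τ u u≢v = begin
        F (N [ v ≔ towards v τ u ])
          ≈⟨ cong ([≔]-cong {M = N} v (λ _ _ _ → refl) λ j → sym (identity (δ v j) (δ u j) (δ (g u) j))) ⟩
        F (N [ v ≔ (λ j → towards v (τ * t u) (g u) j + (- τ) * N u j) ])
          ≈⟨ shear N (- τ) (towards v (τ * t u) (g u)) u≢v ⟩
        F (N [ v ≔ towards v (τ * t u) (g u) ]) ∎
        where
        N = twist t g
        identity : ∀ a b c → (a - τ * t u * c) + (- τ) * (b - t u * c) ≈ a - τ * b
        identity a b c = begin
          (a - τ * t u * c) + (- τ) * (b - t u * c)
            ≈⟨ solve 5 (λ a x y b z → a :+ x :+ y :* (b :+ z) := a :+ y :* b :+ (x :+ y :* z)) refl a (- (τ * t u * c)) (- τ) b (- (t u * c)) ⟩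
          a + (- τ) * b + (- (τ * t u * c) + (- τ) * (- (t u * c)))
            ≈⟨ +-cong (+-congˡ (sym (-‿distribˡ-* τ b))) (+-congˡ (trans (sym (-‿distribˡ-* τ _)) (trans (-‿cong (sym (-‿distribʳ-* τ _))) (trans (-‿involutive _) (sym (*-assoc τ (t u) c)))))) ⟩
          a - τ * b + (- (τ * t u * c) + τ * t u * c)
            ≈⟨ +-congˡ (-‿inverseˡ _) ⟩
          a - τ * b + 0#
            ≈⟨ +-identityʳ _ ⟩
          a - τ * b ∎

    untwist-at : ∀ (t : Row n) v x → (∀ j → x j ≈ δ v j) →
                 F (twist t g [ v ≔ x ]) ≈ F (twist (t [ v ≔ 0# ]) g)
    untwist-at t v x x≈δ = sym (cong (≈[≔] {M = twist t g} v
      (λ u u≢v j → reflexive (≡.cong (λ s → δ u j - s * δ (g u) j) (updateAt-minimal u v t u≢v)))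
      (λ j → trans (+-congˡ (trans (-‿cong (trans (*-congʳ (reflexive (updateAt-updates v t))) (zeroˡ _))) -0#≈0#))
               (trans (+-identityʳ _) (sym (x≈δ j))))))

    -- Going round the cycle turns the row of v into a multiple of δ v.
    untwist-cycle : ∀ t v vs → All (λ (x , y) → g x ≡ y) (arcs v vs v) → All (_≢ v) vs →
                    F (twist t g) ≈ (1# - listProduct (map t (v ∷ vs))) * F (twist (t [ v ≔ 0# ]) g)
    untwist-cycle t v vs along vs≢v = begin
      F N                                    ≈⟨ cong (≈[≔] {M = N} {N = N} v (λ _ _ _ → refl) (λ _ → refl)) ⟩
      F (N [ v ≔ towards v (t v) (g v) ])    ≈⟨ depart vs along vs≢v ⟩
      F (N [ v ≔ towards v τ v ])            ≈⟨ cong ([≔]-cong {M = N} v (λ _ _ _ → refl) λ j → trans (+-cong (sym (*-identityˡ _)) (-‿distribˡ-* τ _)) (sym (distribʳ (δ v j) 1# (- τ)))) ⟩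
      F (N [ v ≔ (λ j → (1# - τ) * δ v j) ]) ≈⟨ scale N v (1# - τ) (δ v) ⟩
      (1# - τ) * F (N [ v ≔ δ v ])           ≈⟨ *-congˡ (untwist-at t v (δ v) (λ _ → refl)) ⟩
      (1# - τ) * F (twist (t [ v ≔ 0# ]) g)  ∎
      where
      N = twist t g
      τ = listProduct (map t (v ∷ vs))
      retarget : ∀ {σ σ′ u u′} → σ ≈ σ′ → u ≡ u′ → F (N [ v ≔ towards v σ u ]) ≈ F (N [ v ≔ towards v σ′ u′ ])
      retarget {u = u} σ≈ ≡.refl = cong ([≔]-cong {M = N} v (λ _ _ _ → refl) λ j → +-congˡ (-‿cong (*-congʳ σ≈)))
      walk : ∀ x xs σ → All (λ (x , y) → g x ≡ y) (arcs x xs v) → All (_≢ v) (x ∷ xs) →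
             F (N [ v ≔ towards v σ x ]) ≈ F (N [ v ≔ towards v (σ * listProduct (map t (x ∷ xs))) v ])
      walk x [] σ (gx≡v ∷ []) (x≢v ∷ []) = trans (step t v σ x x≢v) (retarget (*-congˡ (sym (*-identityʳ _))) gx≡v)
      walk x (y ∷ ys) σ (gx≡y ∷ along) (x≢v ∷ ≢v) = trans (step t v σ x x≢v)
        (trans (retarget refl gx≡y) (trans (walk y ys (σ * t x) along ≢v) (retarget {u = v} (*-assoc _ _ _) ≡.refl)))
      depart : ∀ vs → All (λ (x , y) → g x ≡ y) (arcs v vs v) → All (_≢ v) vs →
              F (N [ v ≔ towards v (t v) (g v) ]) ≈ F (N [ v ≔ towards v (listProduct (map t (v ∷ vs))) v ])
      depart [] (gv≡v ∷ []) [] = retarget (sym (*-identityʳ _)) gv≡v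
      depart (x ∷ xs) (gv≡x ∷ along) ≢v = trans (retarget refl gv≡x) (walk x xs (t v) along ≢v)

    -- The walk from v along g strictly lowers ρ until it meets a vertex with t u ≈ 0, where the
    -- off-diagonal coefficient dies. It stays below ρ v on the way and therefore never meets v.
    untwist-ranked : ∀ t (ρ : Fin n → ℕ) → (∀ u → t u ≈ 0# ⊎ ρ (g u) ℕ.< ρ u) → ∀ v →
                     F (twist t g) ≈ F (twist (t [ v ≔ 0# ]) g)
    untwist-ranked t ρ descend v = trans (cong (≈[≔] {M = N} {N = N} v (λ _ _ _ → refl) (λ _ → refl))) (depart (descend v))
      where
      N = twist t g
      finish : ∀ {τ u} → τ ≈ 0# → F (N [ v ≔ towards v τ u ]) ≈ F (twist (t [ v ≔ 0# ]) g)
      finish {τ} {u} τ≈0 = untwist-at t v (towards v τ u) λ j →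
        trans (+-congˡ (trans (-‿cong (trans (*-congʳ τ≈0) (zeroˡ _))) -0#≈0#)) (+-identityʳ _)
      walk : ∀ k u τ → ρ u ℕ.< k → k ℕ.≤ ρ v → F (N [ v ≔ towards v τ u ]) ≈ F (twist (t [ v ≔ 0# ]) g)
      walk (suc k) u τ (ℕ.s≤s ρu≤k) k<ρv = trans (step t v τ u λ { ≡.refl → ℕ.<-irrefl ≡.refl (ℕ.≤-trans k<ρv ρu≤k) }) (continue (descend u))
        where
        continue : t u ≈ 0# ⊎ ρ (g u) ℕ.< ρ u → F (N [ v ≔ towards v (τ * t u) (g u) ]) ≈ F (twist (t [ v ≔ 0# ]) g)
        continue (inj₁ tu≈0) = finish {u = g u} (trans (*-congˡ tu≈0) (zeroʳ τ))
        continue (inj₂ ρ<) = walk k (g u) (τ * t u) (ℕ.<-≤-trans ρ< ρu≤k) (ℕ.<⇒≤ k<ρv)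
      depart : t v ≈ 0# ⊎ ρ (g v) ℕ.< ρ v → F (N [ v ≔ towards v (t v) (g v) ]) ≈ F (twist (t [ v ≔ 0# ]) g)
      depart (inj₁ tv≈0) = finish {u = g v} tv≈0
      depart (inj₂ ρ<)   = walk (ρ v) (g v) (t v) ρ< ℕ.≤-refl

    zeroOn : List (Fin n) → Row n → Row n
    zeroOn []        t = t
    zeroOn (v ∷ vs) t = zeroOn vs (t [ v ≔ 0# ])

    [≔0]-0 : ∀ (t : Row n) u {v} → t v ≈ 0# → (t [ u ≔ 0# ]) v ≈ 0#
    [≔0]-0 t u {v} tv≈0 with v ≟ u
    ... | yes ≡.refl = reflexive (updateAt-updates v t)
    ... | no v≢u     = trans (reflexive (updateAt-minimal v u t v≢u)) tv≈0

    zeroOn-0 : ∀ vs (t : Row n) {v} → t v ≈ 0# → zeroOn vs t v ≈ 0#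
    zeroOn-0 []        t tv≈0 = tv≈0
    zeroOn-0 (u ∷ vs) t tv≈0 = zeroOn-0 vs (t [ u ≔ 0# ]) ([≔0]-0 t u tv≈0)

    zeroOn-∈ : ∀ {vs} (t : Row n) {v} → v ∈ vs → zeroOn vs t v ≈ 0#
    zeroOn-∈ {u ∷ vs} t (here ≡.refl) = zeroOn-0 vs (t [ u ≔ 0# ]) (reflexive (updateAt-updates u t))
    zeroOn-∈ {u ∷ vs} t (there v∈)    = zeroOn-∈ (t [ u ≔ 0# ]) v∈

    untwist-all : ∀ (ρ : Fin n → ℕ) vs t → (∀ u → t u ≈ 0# ⊎ ρ (g u) ℕ.< ρ u) →
                  F (twist t g) ≈ F (twist (zeroOn vs t) g)
    untwist-all ρ []        t descend = refl
    untwist-all ρ (v ∷ vs) t descend = trans (untwist-ranked t ρ descend v)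
      (untwist-all ρ vs (t [ v ≔ 0# ]) λ u → map₁ ([≔0]-0 t v) (descend u))

    map-[≔]-∉ : ∀ (t : Row n) {v x} vs → v ∉ vs → map (t [ v ≔ x ]) vs ≡ map t vs
    map-[≔]-∉ t []        v∉ = ≡.refl
    map-[≔]-∉ t {v} (u ∷ vs) v∉ = ≡.cong₂ _∷_ (updateAt-minimal u v t λ u≡v → v∉ (here (≡.sym u≡v)))
      (map-[≔]-∉ t vs (v∉ ∘ there))

    -- Each cycle is opened at its head r by clearing t at r. As r lies on no later cycle, the
    -- products round the later cycles are unchanged.
    untwist-cycles : ∀ (𝒞 : List (Fin n × List (Fin n))) t →
      All (λ (r , rs) → All (λ (x , y) → g x ≡ y) (arcs r rs r) × All (_≢ r) rs) 𝒞 →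
      AllPairs (λ (r , _) (s , ss) → r ∉ s ∷ ss) 𝒞 →
      F (twist t g) ≈ listProduct (map (λ (r , rs) → 1# - listProduct (map t (r ∷ rs))) 𝒞) * F (twist (zeroOn (map proj₁ 𝒞) t) g)
    untwist-cycles [] t [] [] = sym (*-identityˡ _)
    untwist-cycles ((r , rs) ∷ 𝒞) t ((along , ≢r) ∷ cycles) (r∉ ∷ disjoint) = begin
      F (twist t g)                                        ≈⟨ untwist-cycle t r rs along ≢r ⟩
      κ * F (twist (t [ r ≔ 0# ]) g)                       ≈⟨ *-congˡ (untwist-cycles 𝒞 (t [ r ≔ 0# ]) cycles disjoint) ⟩
      κ * (listProduct (map (factor (t [ r ≔ 0# ])) 𝒞) * Z) ≈⟨ *-assoc _ _ _ ⟨
      κ * listProduct (map (factor (t [ r ≔ 0# ])) 𝒞) * Z  ≡⟨ ≡.cong (λ fs → κ * listProduct fs * Z) (unaffected 𝒞 r∉) ⟩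
      κ * listProduct (map (factor t) 𝒞) * Z               ∎
      where
      factor : Row n → Fin n × List (Fin n) → Carrier
      factor t (r , rs) = 1# - listProduct (map t (r ∷ rs))
      κ = factor t (r , rs)
      Z = F (twist (zeroOn (map proj₁ 𝒞) (t [ r ≔ 0# ])) g)
      unaffected : ∀ 𝒞 → All (λ (s , ss) → r ∉ s ∷ ss) 𝒞 → map (factor (t [ r ≔ 0# ])) 𝒞 ≡ map (factor t) 𝒞
      unaffected [] [] = ≡.refl
      unaffected ((s , ss) ∷ 𝒞) (r∉ ∷ r∉𝒞) = ≡.cong₂ (λ l → (1# - listProduct l) ∷_) (map-[≔]-∉ t (s ∷ ss) r∉) (unaffected 𝒞 r∉𝒞)

    -- Opening the cycles at their heads leaves a forest along which ρ drops; clearing it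
    -- contributes no further factor.
    untwist : ∀ (𝒞 : List (Fin n × List (Fin n))) t (ρ : Fin n → ℕ) →
      All (λ (r , rs) → All (λ (x , y) → g x ≡ y) (arcs r rs r) × All (_≢ r) rs) 𝒞 →
      AllPairs (λ (r , _) (s , ss) → r ∉ s ∷ ss) 𝒞 →
      (∀ u → u ∈ map proj₁ 𝒞 ⊎ ρ (g u) ℕ.< ρ u) →
      F (twist t g) ≈ listProduct (map (λ (r , rs) → 1# - listProduct (map t (r ∷ rs))) 𝒞) * F δ
    untwist 𝒞 t ρ cycles disjoint descend = trans (untwist-cycles 𝒞 t cycles disjoint) (*-congˡ (trans
      (untwist-all ρ (allFin n) s λ u → map₁ (zeroOn-∈ t) (descend u))
      (cong λ v j → trans (+-congˡ (trans (-‿cong (trans (*-congʳ (zeroOn-∈ s (∈-allFin v))) (zeroˡ _))) -0#≈0#)) (+-identityʳ _))))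
      where s = zeroOn (map proj₁ 𝒞) t

-- Components and orientations

steps-arcs : ∀ {a} {A : Set a} (x : A) xs z → steps (x ∷ xs ∷ʳ z) ≡ arcs x xs z
steps-arcs x []       z = ≡.refl
steps-arcs x (y ∷ ys) z = ≡.cong ((x , y) ∷_) (steps-arcs y ys z)

module _ {a} {A : Set a} where

  arcs-source : ∀ {x : A} xs {z u v} → (u , v) ∈ arcs x xs z → u ∈ x ∷ xs
  arcs-source []       (here ≡.refl) = here ≡.refl
  arcs-source (y ∷ ys) (here ≡.refl) = here ≡.refl
  arcs-source (y ∷ ys) (there p)     = there (arcs-source ys p)

  arcs-target : ∀ {x : A} xs {z u v} → (u , v) ∈ arcs x xs z → v ∈ z ∷ xs
  arcs-target []       (here ≡.refl) = here ≡.refl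
  arcs-target (y ∷ ys) (here ≡.refl) = there (here ≡.refl)
  arcs-target (y ∷ ys) (there p) with arcs-target ys p
  ... | here v≡z = here v≡z
  ... | there v∈ = there (there v∈)

  arcs-successor : ∀ {x : A} xs {z u} → u ∈ x ∷ xs → ∃ λ v → (u , v) ∈ arcs x xs z
  arcs-successor []       (here ≡.refl) = _ , here ≡.refl
  arcs-successor (y ∷ ys) (here ≡.refl) = y , here ≡.refl
  arcs-successor (y ∷ ys) (there u∈) with v , p ← arcs-successor ys u∈ = v , there p

  arcs-functional : ∀ {x : A} xs {z u v v′} → Unique (x ∷ xs) →
                    (u , v) ∈ arcs x xs z → (u , v′) ∈ arcs x xs z → v ≡ v′
  arcs-functional []       _          (here ≡.refl) (here ≡.refl) = ≡.refl
  arcs-functional (y ∷ ys) (x∉ ∷ uni) (here ≡.refl) (here ≡.refl) = ≡.refl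
  arcs-functional (y ∷ ys) (x∉ ∷ uni) (here ≡.refl) (there q) = contradiction ≡.refl (All.lookup x∉ (arcs-source ys q))
  arcs-functional (y ∷ ys) (x∉ ∷ uni) (there p) (here ≡.refl) = contradiction ≡.refl (All.lookup x∉ (arcs-source ys p))
  arcs-functional (y ∷ ys) (x∉ ∷ uni) (there p) (there q) = arcs-functional ys uni p q

  -- r is followed by y and y by z, and z differs from r once there are three vertices.
  no-arc-back : ∀ {r : A} rs {v} → 3 ℕ.≤ length (r ∷ rs) → Unique (r ∷ rs) →
                (r , v) ∈ arcs r rs r → (v , r) ∈ arcs r rs r → ⊥
  no-arc-back (y ∷ [])      (s≤s (s≤s ()))
  no-arc-back (y ∷ z ∷ zs) _ uni p q with ≡.refl ← arcs-functional (y ∷ z ∷ zs) uni p (here ≡.refl)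
    with ≡.refl ← arcs-functional (y ∷ z ∷ zs) uni q (there (here ≡.refl))
    with (_ ∷ r≢r ∷ _) ∷ _ ← uni = r≢r ≡.refl

least : ∀ {p} {P : Pred ℕ p} → Unary.Decidable P → ∀ k → P k → ∃ λ l → P l × (∀ j → P j → l ℕ.≤ j)
least P? zero    Pk = zero , Pk , λ _ _ → z≤n
least P? (suc k) Pk with P? zero
... | yes P0 = zero , P0 , λ _ _ → z≤n
... | no ¬P0 with l , Pl , min ← least (P? ∘ suc) k Pk =
  suc l , Pl , λ { zero P0 → contradiction P0 ¬P0 ; (suc j) Pj → s≤s (min j Pj) }

∈-tabulate⁺ : ∀ {p k} {P : Pred (Fin k) p} (P? : Unary.Decidable P) {i} →
              P i → i Subset.∈ Vec.tabulate (does ∘ P?)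
∈-tabulate⁺ P? {i} Pi = Vec.lookup⇒[]= i _
  (≡.trans (Vec.lookup∘tabulate (does ∘ P?) i) (dec-true (P? i) Pi))

∈-tabulate⁻ : ∀ {p k} {P : Pred (Fin k) p} (P? : Unary.Decidable P) {i} →
              i Subset.∈ Vec.tabulate (does ∘ P?) → P i
∈-tabulate⁻ P? {i} i∈ with P? i | ≡.trans (≡.sym (Vec.lookup∘tabulate (does ∘ P?) i)) (Vec.[]=⇒lookup i∈)
... | yes Pi | _ = Pi

map-injective-on : ∀ {a b} {A : Set a} {B : Set b} (f : A → B) {xs x y} → Unique (map f xs) →
                   x ∈ xs → y ∈ xs → f x ≡ f y → x ≡ y
map-injective-on f _         (here ≡.refl) (here ≡.refl) eq = ≡.refl
map-injective-on f (x∉ ∷ _)  (here ≡.refl) (there y∈)    eq = contradiction eq (All.lookup x∉ (∈-map⁺ f y∈))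
map-injective-on f (y∉ ∷ _)  (there x∈)    (here ≡.refl) eq = contradiction (≡.sym eq) (All.lookup y∉ (∈-map⁺ f x∈))
map-injective-on f (_ ∷ uni) (there x∈)    (there y∈)    eq = map-injective-on f uni x∈ y∈ eq

module Components {n m} (G : OrientedGraph n m) where

  open OrientedGraph G
  open Graph G

  joins-sym : ∀ {e i j} → Joins e i j → Joins e j i
  joins-sym (inj₁ p) = inj₂ p
  joins-sym (inj₂ p) = inj₁ p

  joins-endpoints : ∀ {e i j i′ j′} → Joins e i j → Joins e i′ j′ → (i ≡ i′ × j ≡ j′) ⊎ (i ≡ j′ × j ≡ i′)
  joins-endpoints (inj₁ (≡.refl , ≡.refl)) (inj₁ (≡.refl , ≡.refl)) = inj₁ (≡.refl , ≡.refl)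
  joins-endpoints (inj₁ (≡.refl , ≡.refl)) (inj₂ (≡.refl , ≡.refl)) = inj₂ (≡.refl , ≡.refl)
  joins-endpoints (inj₂ (≡.refl , ≡.refl)) (inj₁ (≡.refl , ≡.refl)) = inj₂ (≡.refl , ≡.refl)
  joins-endpoints (inj₂ (≡.refl , ≡.refl)) (inj₂ (≡.refl , ≡.refl)) = inj₁ (≡.refl , ≡.refl)

  joins-unique : ∀ {e f i j} → Joins e i j → Joins f i j → e ≡ f
  joins-unique p (inj₁ (≡.refl , ≡.refl)) = simple p
  joins-unique p (inj₂ (≡.refl , ≡.refl)) = simple (joins-sym p)

  joins-irrefl : ∀ {e i} → ¬ Joins e i i
  joins-irrefl (inj₁ (p , q)) = loopless _ (≡.trans p (≡.sym q))
  joins-irrefl (inj₂ (p , q)) = loopless _ (≡.trans p (≡.sym q))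

  module _ (S : Subset m) where

    H : Subgraph
    H = spanning S

    adjacent-sym : ∀ {i j} → Adjacent H i j → Adjacent H j i
    adjacent-sym (e , e∈S , p) = e , e∈S , joins-sym p

    Reaches : Fin n → Fin n → Set
    Reaches = Star (Adjacent H)

    reaches-sym : ∀ {i j} → Reaches i j → Reaches j i
    reaches-sym = Star.reverse adjacent-sym

    ∈-component⁺ : ∀ {v e} → e Subset.∈ S → Reaches v (src e) → e Subset.∈ edges (component H v)
    ∈-component⁺ {v} e∈S v⇝ = ∈-tabulate⁺ (λ e → (e ∈? S) ×-dec reachable? H v (src e)) (e∈S , v⇝)

    ∈-component⁻ : ∀ {v e} → e Subset.∈ edges (component H v) → e Subset.∈ S × Reaches v (src e)
    ∈-component⁻ {v} = ∈-tabulate⁻ (λ e → (e ∈? S) ×-dec reachable? H v (src e))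

    component-adjacent⁻ : ∀ {v i j} → Adjacent (component H v) i j → Adjacent H i j × Reaches v i × Reaches v j
    component-adjacent⁻ {v} (e , e∈ , inj₁ (≡.refl , ≡.refl)) with e∈S , v⇝ ← ∈-component⁻ {v} e∈ =
      (e , e∈S , inj₁ (≡.refl , ≡.refl)) , v⇝ , v⇝ ◅◅ (e , e∈S , inj₁ (≡.refl , ≡.refl)) ◅ ε
    component-adjacent⁻ {v} (e , e∈ , inj₂ (≡.refl , ≡.refl)) with e∈S , v⇝ ← ∈-component⁻ {v} e∈ =
      (e , e∈S , inj₂ (≡.refl , ≡.refl)) , v⇝ ◅◅ (e , e∈S , inj₁ (≡.refl , ≡.refl)) ◅ ε , v⇝

    component-adjacent⁺ : ∀ {v i j} → Reaches v i → Adjacent H i j → Adjacent (component H v) i j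
    component-adjacent⁺ {v} v⇝i (e , e∈S , inj₁ (≡.refl , ≡.refl)) = e , ∈-component⁺ {v} e∈S v⇝i , inj₁ (≡.refl , ≡.refl)
    component-adjacent⁺ {v} v⇝i (e , e∈S , inj₂ (≡.refl , ≡.refl)) =
      e , ∈-component⁺ {v} e∈S (v⇝i ◅◅ (e , e∈S , inj₂ (≡.refl , ≡.refl)) ◅ ε) , inj₂ (≡.refl , ≡.refl)

    -- Repeats the test local to `components`, so that the list of components of H unfolds to the
    -- components of `leastVertices`.
    Least : Fin n → Set
    Least v = ∀ u → Reaches v u → v Fin.≤ u

    least? : Unary.Decidable Least
    least? v = all? λ u → reachable? H v u →-dec (v Fin.≤? u)

    leastVertices : List (Fin n)
    leastVertices = List.filter least? (allFin n)

    leastVertices-unique : Unique leastVertices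
    leastVertices-unique = Unique.filter⁺ least? (Unique.allFin⁺ n)

    leastVertex : ∀ v → ∃ λ b → b ∈ leastVertices × Reaches b v
    leastVertex v = go v (<-wellFounded (toℕ v))
      where
      go : ∀ v → Acc ℕ._<_ (toℕ v) → ∃ λ b → b ∈ leastVertices × Reaches b v
      go v (acc rec) with least? v
      ... | yes lst = v , ∈-filter⁺ least? (∈-allFin v) lst , ε
      ... | no ¬lst with u , ¬p ← ¬∀⟶∃¬ n _ (λ u → reachable? H v u →-dec (v Fin.≤? u)) ¬lst with reachable? H v u
      ...   | no ¬v⇝u = contradiction (λ v⇝u → contradiction v⇝u ¬v⇝u) ¬p
      ...   | yes v⇝u with b , b∈ , b⇝u ← go u (rec (ℕ.≰⇒> λ v≤u → ¬p λ _ → v≤u)) = b , b∈ , b⇝u ◅◅ reaches-sym v⇝u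

    leastVertices-separated : ∀ {b c} → b ∈ leastVertices → c ∈ leastVertices → Reaches b c → b ≡ c
    leastVertices-separated b∈ c∈ b⇝c = Fin.≤-antisym
      (proj₂ (∈-filter⁻ least? {xs = allFin n} b∈) _ b⇝c) (proj₂ (∈-filter⁻ least? {xs = allFin n} c∈) _ (reaches-sym b⇝c))

    -- A triple (b , r , rs) pairs a vertex b, later the least of its component, with a cycle there.
    -- Splitting off the head r makes the cycle non-empty and singles out the vertex at which it
    -- will be opened.
    Anchored : Fin n × Fin n × List (Fin n) → Set
    Anchored (b , r , rs) = IsCycle (component H b) (r ∷ rs)

    anchored-arc : ∀ {b r rs u v} → Anchored (b , r , rs) → (u , v) ∈ arcs r rs r → Adjacent (component H b) u v
    anchored-arc {r = r} {rs} cyc uv∈ = All.lookup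
      (≡.subst (All _) (steps-arcs r rs r) (IsCycle.adjacent cyc)) uv∈

    anchored-reaches : ∀ {b r rs v} → Anchored (b , r , rs) → v ∈ r ∷ rs → Reaches b v
    anchored-reaches {b} {rs = rs} cyc v∈ with _ , vu∈ ← arcs-successor rs v∈ =
      proj₁ (proj₂ (component-adjacent⁻ {b} (anchored-arc {b} {rs = rs} cyc vu∈)))

    -- f v is the edge along which v moves to g v; the root of a cycle is its head.
    record Orientation (𝒞 : List (Fin n × Fin n × List (Fin n))) : Set where
      field
        f        : Fin n → Fin m
        g        : Fin n → Fin n
        ρ        : Fin n → ℕ
        f∈S      : ∀ v → f v Subset.∈ S
        joins    : ∀ v → Joins (f v) v (g v)
        f-inj    : Injective _≡_ _≡_ f
        along    : All (λ (_ , r , rs) → All (λ (u , v) → g u ≡ v) (arcs r rs r)) 𝒞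
        disjoint : AllPairs (λ (_ , r , _) (_ , s , ss) → r ∉ s ∷ ss) 𝒞
        descend  : ∀ v → v ∈ map (proj₁ ∘ proj₂) 𝒞 ⊎ ρ (g v) ℕ.< ρ v

    -- Orienting every component towards a chosen cycle

    module _ (𝒞 : List (Fin n × Fin n × List (Fin n))) (bases : map proj₁ 𝒞 ≡ leastVertices)
             (cycles : All Anchored 𝒞) where

      private
        bases-unique : Unique (map proj₁ 𝒞)
        bases-unique = ≡.subst Unique (≡.sym bases) leastVertices-unique

        base∈ : ∀ {c} → c ∈ 𝒞 → proj₁ c ∈ leastVertices
        base∈ c∈ = ≡.subst (_ ∈_) bases (∈-map⁺ proj₁ c∈)

        -- Both bases are least in the same component, hence equal, and each base is listed once.
        cycle-unique : ∀ {b r rs c s ss u v} → (b , r , rs) ∈ 𝒞 → (c , s , ss) ∈ 𝒞 →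
                       u ∈ r ∷ rs → v ∈ s ∷ ss → Reaches u v → (b , r , rs) ≡ (c , s , ss)
        cycle-unique p q u∈ v∈ u⇝v = map-injective-on proj₁ bases-unique p q
          (leastVertices-separated (base∈ p) (base∈ q)
            (anchored-reaches (All.lookup cycles p) u∈ ◅◅ u⇝v ◅◅ reaches-sym (anchored-reaches (All.lookup cycles q) v∈)))

        OnCycle : Fin n → Set
        OnCycle v = Any (λ (_ , r , rs) → v ∈ r ∷ rs) 𝒞

        Arc : Fin n → Fin n → Set
        Arc u v = Any (λ (_ , r , rs) → (u , v) ∈ arcs r rs r) 𝒞

        onCycle? : Unary.Decidable OnCycle
        onCycle? v = Any.any? (λ (_ , r , rs) → v ∈ˡ? (r ∷ rs)) 𝒞
          where open DecMembership _≟_ renaming (_∈?_ to _∈ˡ?_)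

        arc? : ∀ u v → Dec (Arc u v)
        arc? u v = Any.any? (λ (_ , r , rs) → (u , v) ∈ˡ? arcs r rs r) 𝒞
          where open DecMembership (≡-dec _≟_ _≟_) renaming (_∈?_ to _∈ˡ?_)

        arc⇒adjacent : ∀ {u v} → Arc u v → Adjacent H u v
        arc⇒adjacent arc with (b , r , rs) , c∈ , uv∈ ← find arc =
          proj₁ (component-adjacent⁻ {b} (anchored-arc {b} (All.lookup cycles c∈) uv∈))

        arc-functional : ∀ {u v v′} → Arc u v → Arc u v′ → v ≡ v′
        arc-functional arc arc′
          with (b , r , rs) , c∈ , uv∈ ← find arc
          with (c , s , ss) , d∈ , uv′∈ ← find arc′
          with ≡.refl ← cycle-unique c∈ d∈ (arcs-source rs uv∈) (arcs-source ss uv′∈) ε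
          = arcs-functional rs (IsCycle.distinct (All.lookup cycles c∈)) uv∈ uv′∈

        -- A vertex on a cycle may only be left along that cycle.
        Allowed : Fin n → Fin n → Set
        Allowed v u = Adjacent H v u × (OnCycle v → Arc v u)

        arc⇒allowed : ∀ {u v} → Arc u v → Allowed u v
        arc⇒allowed arc = arc⇒adjacent arc , λ _ → arc

        roots : List (Fin n)
        roots = map (proj₁ ∘ proj₂) 𝒞

        -- Only allowed walks are counted, so that a shortest walk from a vertex on a cycle runs
        -- along that cycle.
        Within : ℕ → Fin n → Set
        Within zero    v = v ∈ roots
        Within (suc k) v = ∃ λ u → Allowed v u × Within k u

        within? : ∀ k v → Dec (Within k v)
        within? zero    v = v ∈ˡ? roots
          where open DecMembership _≟_ renaming (_∈?_ to _∈ˡ?_)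
        within? (suc k) v = any? λ u → (adjacent? H v u ×-dec (onCycle? v →-dec arc? v u)) ×-dec within? k u

        onCycle⇒within : ∀ {v} → OnCycle v → ∃ λ k → Within k v
        onCycle⇒within v-on with (b , r , rs) , c∈ , v∈ ← find v-on = go rs (λ p → p) v∈
          where
          go : ∀ {x} xs → (∀ {u v} → (u , v) ∈ arcs x xs r → (u , v) ∈ arcs r rs r) → ∀ {v} → v ∈ x ∷ xs → ∃ λ k → Within k v
          go [] sub (here ≡.refl) = 1 , r , arc⇒allowed (lose c∈ (sub (here ≡.refl))) , ∈-map⁺ (proj₁ ∘ proj₂) c∈
          go (y ∷ ys) sub (here ≡.refl) with k , y-within ← go ys (sub ∘ there) (here ≡.refl) =
            suc k , y , arc⇒allowed (lose c∈ (sub (here ≡.refl))) , y-within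
          go (y ∷ ys) sub (there v∈) = go ys (sub ∘ there) v∈

        -- An arbitrary path may leave a cycle in a forbidden way. It is therefore followed only
        -- until it first meets a cycle, and from there the cycle itself leads to its root.
        reaches-root⇒within : ∀ {v r} → Reaches v r → r ∈ roots → ∃ λ k → Within k v
        reaches-root⇒within ε r∈ = 0 , r∈
        reaches-root⇒within {v} (adj ◅ u⇝r) r∈ with onCycle? v
        ... | yes v-on = onCycle⇒within v-on
        ... | no v-off with k , u-within ← reaches-root⇒within u⇝r r∈ =
          suc k , _ , (adj , λ v-on → contradiction v-on v-off) , u-within

        within : ∀ v → ∃ λ k → Within k v
        within v with b , b∈ , b⇝v ← leastVertex v
          with (_ , r , rs) , c∈ , ≡.refl ← ∈-map⁻ proj₁ (≡.subst (b ∈_) (≡.sym bases) b∈)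
          = reaches-root⇒within (reaches-sym b⇝v ◅◅ anchored-reaches (All.lookup cycles c∈) (here ≡.refl))
              (∈-map⁺ (proj₁ ∘ proj₂) c∈)

        abstract
          rank : ∀ v → ∃ λ l → Within l v × (∀ j → Within j v → l ℕ.≤ j)
          rank v = least (λ k → within? k v) (proj₁ (within v)) (proj₂ (within v))

        ρ : Fin n → ℕ
        ρ v = proj₁ (rank v)

        ρ-min : ∀ {v k} → Within k v → ρ v ℕ.≤ k
        ρ-min {v} {k} = proj₂ (proj₂ (rank v)) k

        root⇒arc : ∀ {v} → v ∈ roots → ∃ λ u → ∃ λ b → ∃ λ rs → (b , v , rs) ∈ 𝒞 × (v , u) ∈ arcs v rs v
        root⇒arc v∈ with (b , r , rs) , c∈ , ≡.refl ← ∈-map⁻ (proj₁ ∘ proj₂) v∈ =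
          let u , ru∈ = arcs-successor rs {z = r} (here ≡.refl) in u , b , rs , c∈ , ru∈

        abstract
          -- A root has rank zero, so no shorter walk remains; it takes the arc of its own cycle,
          -- which closes the orbit. Any other vertex takes the first step of a shortest allowed
          -- walk.
          next : ∀ v → ∃ λ u → Allowed v u × (v ∈ roots ⊎ ρ u ℕ.< ρ v)
          next v = go (ρ v) (proj₁ (proj₂ (rank v))) ≡.refl
           where
           go : ∀ k → Within k v → k ≡ ρ v → ∃ λ u → Allowed v u × (v ∈ roots ⊎ ρ u ℕ.< ρ v)
           go zero v∈ _ = let u , _ , _ , c∈ , vu∈ = root⇒arc v∈ in u , arc⇒allowed (lose c∈ vu∈) , inj₁ v∈
           go (suc k) (u , allowed , u-within) eq = u , allowed , inj₂ (≡.subst (ρ u ℕ.<_) eq (s≤s (ρ-min u-within)))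

        g : Fin n → Fin n
        g v = proj₁ (next v)

        f : Fin n → Fin m
        f v = proj₁ (proj₁ (proj₁ (proj₂ (next v))))

        joins : ∀ v → Joins (f v) v (g v)
        joins v = proj₂ (proj₂ (proj₁ (proj₁ (proj₂ (next v)))))

        descend : ∀ v → v ∈ roots ⊎ ρ (g v) ℕ.< ρ v
        descend v = proj₂ (proj₂ (next v))

        g-onCycle : ∀ {v} → OnCycle v → Arc v (g v)
        g-onCycle {v} = proj₂ (proj₁ (proj₂ (next v)))

        g-along : ∀ {u v} → Arc u v → g u ≡ v
        g-along arc with _ , c∈ , uv∈ ← find arc = arc-functional (g-onCycle (lose c∈ (arcs-source _ uv∈))) arc

        no-arc-back-to-root : ∀ {b r rs c s ss v} → (b , r , rs) ≡ (c , s , ss) → (b , r , rs) ∈ 𝒞 →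
                              (r , v) ∈ arcs r rs r → (v , r) ∈ arcs s ss s → ⊥
        no-arc-back-to-root {rs = rs} ≡.refl c∈ rv∈ vr∈ =
          no-arc-back rs (IsCycle.length≥3 cyc) (IsCycle.distinct cyc) rv∈ vr∈
          where cyc = All.lookup cycles c∈

        no-swap-at-root : ∀ {u v} → u ∈ roots → g u ≡ v → g v ≡ u → ⊥
        no-swap-at-root {u} u∈ gu≡v gv≡u =
          let w , b , rs , c∈ , uw∈ = root⇒arc u∈
              gw≡u = ≡.trans (≡.cong g (≡.trans (≡.sym (g-along (lose c∈ uw∈))) gu≡v)) gv≡u
              (c , s , ss) , d∈ , wu∈ = find (g-onCycle {w} (lose c∈ (arcs-target rs uw∈)))
          in no-arc-back-to-root (cycle-unique c∈ d∈ (arcs-target rs uw∈) (arcs-source ss wu∈) ε) c∈ uw∈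
               (≡.subst (λ x → (w , x) ∈ arcs s ss s) gw≡u wu∈)

        -- Distinct vertices with the same edge under f would be exchanged by g. If neither is a
        -- root, ρ would drop in both directions; if one is, its cycle would contain an arc together
        -- with the reversed arc.
        no-swap : ∀ {u v} → g u ≡ v → g v ≡ u → ⊥
        no-swap {u} {v} gu≡v gv≡u with descend u | descend v
        ... | inj₁ u∈ | _ = no-swap-at-root u∈ gu≡v gv≡u
        ... | inj₂ _  | inj₁ v∈ = no-swap-at-root v∈ gv≡u gu≡v
        ... | inj₂ p  | inj₂ q = ℕ.<-asym (≡.subst (λ x → ρ x ℕ.< ρ u) gu≡v p) (≡.subst (λ x → ρ x ℕ.< ρ v) gv≡u q)

        f-inj : Injective _≡_ _≡_ f
        f-inj {u} {v} eq with joins-endpoints (joins u) (≡.subst (λ e → Joins e v (g v)) (≡.sym eq) (joins v))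
        ... | inj₁ (u≡v , _)     = u≡v
        ... | inj₂ (u≡gv , gu≡v) = contradiction (≡.sym u≡gv) (no-swap gu≡v)

        disjoint′ : ∀ {𝒟} → All (_∈ 𝒞) 𝒟 → Unique (map proj₁ 𝒟) → AllPairs (λ (_ , r , _) (_ , s , ss) → r ∉ s ∷ ss) 𝒟
        disjoint′ [] [] = []
        disjoint′ {(b , r , rs) ∷ 𝒟} (c∈ ∷ 𝒟∈) (b∉ ∷ uni) = All.tabulate (λ d∈ r∈ → All.lookup b∉ (∈-map⁺ proj₁ d∈)
          (≡.cong proj₁ (cycle-unique c∈ (All.lookup 𝒟∈ d∈) (here ≡.refl) r∈ ε))) ∷ disjoint′ 𝒟∈ uni

      orientation : Orientation 𝒞
      orientation = record
        { f = f ; g = g ; ρ = ρ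
        ; f∈S = λ v → proj₁ (proj₂ (proj₁ (proj₁ (proj₂ (next v)))))
        ; joins = joins ; f-inj = f-inj
        ; along = All.tabulate λ c∈ → All.tabulate λ uv∈ → g-along (lose c∈ uv∈)
        ; disjoint = disjoint′ (All.tabulate λ c∈ → c∈) bases-unique
        ; descend = descend }

-- Functional graphs

unique⇒lookup-injective : ∀ {a} {A : Set a} {xs : List A} → Unique xs → Injective _≡_ _≡_ (List.lookup xs)
unique⇒lookup-injective (x∉ ∷ uni) {zero}  {zero}  eq = ≡.refl
unique⇒lookup-injective (x∉ ∷ uni) {zero}  {suc j} eq = contradiction eq (All.lookup x∉ (∈-lookup j))
unique⇒lookup-injective (x∉ ∷ uni) {suc i} {zero}  eq = contradiction (≡.sym eq) (All.lookup x∉ (∈-lookup i))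
unique⇒lookup-injective (x∉ ∷ uni) {suc i} {suc j} eq = ≡.cong suc (unique⇒lookup-injective uni eq)

unique⇒length≤n : ∀ {n} {xs : List (Fin n)} → Unique xs → length xs ℕ.≤ n
unique⇒length≤n uni = Fin.injective⇒≤ (unique⇒lookup-injective uni)

module _ {a} {A : Set a} where

  arcs-predecessor : ∀ {x : A} xs {z u} → u ∈ z ∷ xs → ∃ λ t → (t , u) ∈ arcs x xs z
  arcs-predecessor []       (here ≡.refl) = _ , here ≡.refl
  arcs-predecessor (y ∷ ys) (there (here ≡.refl)) = _ , here ≡.refl
  arcs-predecessor (y ∷ ys) (here u≡z) with t , p ← arcs-predecessor ys (here u≡z) = t , there p
  arcs-predecessor (y ∷ ys) (there (there u∈)) with t , p ← arcs-predecessor ys (there u∈) = t , there p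

  path-asymmetric : ∀ {x : A} xs {z u v} → Unique (x ∷ xs) → z ∉ x ∷ xs →
                    (u , v) ∈ arcs x xs z → (v , u) ∈ arcs x xs z → ⊥
  path-asymmetric []       uni z∉ (here ≡.refl) (here ≡.refl) = z∉ (here ≡.refl)
  path-asymmetric (y ∷ ys) (x∉ ∷ uni) z∉ (here ≡.refl) (here ≡.refl) = contradiction ≡.refl (All.lookup x∉ (here ≡.refl))
  path-asymmetric (y ∷ ys) (x∉ ∷ uni) z∉ (here ≡.refl) (there q) with arcs-target ys q
  ... | here x≡z = z∉ (here (≡.sym x≡z))
  ... | there x∈ = All.lookup x∉ (there x∈) ≡.refl
  path-asymmetric (y ∷ ys) (x∉ ∷ uni) z∉ (there p) (here ≡.refl) with arcs-target ys p
  ... | here x≡z = z∉ (here (≡.sym x≡z))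
  ... | there x∈ = All.lookup x∉ (there x∈) ≡.refl
  path-asymmetric (y ∷ ys) (x∉ ∷ uni) z∉ (there p) (there q) = path-asymmetric ys uni (z∉ ∘ there) p q

  -- Pairs involving the first arc fall to `no-arc-back`. The other arcs form a path into r that
  -- does not pass through r earlier, which is the situation of `path-asymmetric`.
  cycle-asymmetric : ∀ {r : A} rs {u v} → 3 ℕ.≤ length (r ∷ rs) → Unique (r ∷ rs) →
                     (u , v) ∈ arcs r rs r → (v , u) ∈ arcs r rs r → ⊥
  cycle-asymmetric []       (s≤s ())
  cycle-asymmetric (y ∷ ys) l uni (here ≡.refl) q = no-arc-back (y ∷ ys) l uni (here ≡.refl) q
  cycle-asymmetric (y ∷ ys) l uni (there p) (here ≡.refl) = no-arc-back (y ∷ ys) l uni (here ≡.refl) (there p)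
  cycle-asymmetric (y ∷ ys) l (r∉ ∷ uni) (there p) (there q) =
    path-asymmetric ys uni (λ r∈ → All.lookup r∉ r∈ ≡.refl) p q

  module _ {t} {T : A → A → Set t} where

    arcs-from-start : ∀ {x} xs {z} → All (uncurry T) (arcs x xs z) → ∀ {u} → u ∈ x ∷ xs → Star T x u
    arcs-from-start xs       _          (here ≡.refl) = ε
    arcs-from-start (y ∷ ys) (Txy ∷ Ts) (there u∈)    = Txy ◅ arcs-from-start ys Ts u∈

    arcs-to-end : ∀ {x} xs {z} → All (uncurry T) (arcs x xs z) → ∀ {u} → u ∈ x ∷ xs → Star T u z
    arcs-to-end []       (Txz ∷ []) (here ≡.refl) = Txz ◅ ε
    arcs-to-end (y ∷ ys) (Txy ∷ Ts) (here ≡.refl) = Txy ◅ arcs-to-end ys Ts (here ≡.refl)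
    arcs-to-end (y ∷ ys) (Txy ∷ Ts) (there u∈)    = arcs-to-end ys Ts u∈

    cycle-connected : ∀ {r} rs → All (uncurry T) (arcs r rs r) → ∀ {u v} → u ∈ r ∷ rs → v ∈ r ∷ rs → Star T u v
    cycle-connected rs Ts u∈ v∈ = arcs-to-end rs Ts u∈ ◅◅ arcs-from-start rs Ts v∈

  -- The path is cut just after z and continued by the step from z to w.
  close-path : ∀ {t} {T : A → A → Set t} {x xs z w} → z ∈ x ∷ xs → T z w → Linked T (x ∷ xs) → Unique (x ∷ xs) →
               ∃ λ ys → x ∷ ys ⊆ x ∷ xs × Unique (x ∷ ys) × All (uncurry T) (arcs x ys w)
  close-path (here ≡.refl) Tzw _ _ = [] , (λ { (here ≡.refl) → here ≡.refl }) , [] ∷ [] , Tzw ∷ []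
  close-path {xs = y ∷ xs} (there z∈) Tzw (Txy ∷ linked) (x∉ ∷ uni) with ys , sub , uni′ , Ts ← close-path z∈ Tzw linked uni =
    y ∷ ys , (λ { (here ≡.refl) → here ≡.refl ; (there p) → there (sub p) }) ,
    All.tabulate (λ p → All.lookup x∉ (sub p)) ∷ uni′ , Txy ∷ Ts

module FunctionalGraph {n m} (G : OrientedGraph n m) (S : Subset m)
  (f : Fin n → Fin m) (g : Fin n → Fin n) (f∈S : ∀ v → f v Subset.∈ S)
  (joins : ∀ v → OrientedGraph.Joins G (f v) v (g v))
  (f-inj : Injective _≡_ _≡_ f) (f-surj : ∀ {e} → e Subset.∈ S → ∃ λ v → f v ≡ e) where

  open OrientedGraph G
  open Graph G
  open Components G hiding (H; Reaches)

  private
    H : Subgraph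
    H = spanning S

    Reaches Next : Fin n → Fin n → Set
    Reaches = Star (Adjacent H)
    Next u v = g u ≡ v

  adjacent-next : ∀ v → Adjacent H v (g v)
  adjacent-next v = f v , f∈S v , joins v

  adjacent⇒next : ∀ {u v} → Adjacent H u v → Next u v ⊎ Next v u
  adjacent⇒next (e , e∈S , e-joins) with x , ≡.refl ← f-surj e∈S with joins-endpoints (joins x) e-joins
  ... | inj₁ (≡.refl , gx≡v) = inj₁ gx≡v
  ... | inj₂ (≡.refl , gx≡u) = inj₂ gx≡u

  -- By simplicity u and g u would carry the same edge, so u = g u by injectivity of f, and that
  -- edge would be a loop.
  no-swap : ∀ {u v} → Next u v → Next v u → ⊥
  no-swap {u} ≡.refl gv≡u with f-inj (joins-unique (joins u) (joins-sym (≡.subst (Joins _ _) gv≡u (joins (g u)))))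
  ... | u≡gu = joins-irrefl (≡.subst (Joins (f u) u) (≡.sym u≡gu) (joins u))

  no-loop : ∀ {u} → ¬ Next u u
  no-loop {u} gu≡u = joins-irrefl (≡.subst (Joins (f u) u) gu≡u (joins u))

  reaches-lift : ∀ {b i j} → Reaches b i → Reaches i j → Star (Adjacent (component H b)) i j
  reaches-lift b⇝i ε = ε
  reaches-lift {b} b⇝i (adj ◅ k⇝j) = component-adjacent⁺ S {b} b⇝i adj ◅ reaches-lift (b⇝i ◅◅ adj ◅ ε) k⇝j

  component-connected : ∀ b → Connected (component H b)
  component-connected b i j i∈ j∈ = reaches-lift (reach i∈) (reaches-sym S (reach i∈) ◅◅ reach j∈)
    where
    reach : ∀ {i} → i Subset.∈ vertices (component H b) → Reaches b i
    reach = ∈-tabulate⁻ (reachable? H b)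

  -- The path is listed backwards, from its current end to b.
  follow : ∀ b k x xs → k ℕ.+ length xs ≡ n → Unique (x ∷ xs) → Linked (λ u v → Next v u) (x ∷ xs) →
           All (Reaches b) (x ∷ xs) → ∃ λ γ → IsCycle (component H b) γ
  follow b k x xs len uni linked reach with g x ∈ˡ? (x ∷ xs)
    where open DecMembership _≟_ renaming (_∈?_ to _∈ˡ?_)
  -- With k exhausted, the path would consist of n + 1 distinct vertices.
  follow b zero    x xs len uni linked reach | no gx∉ = contradiction
    (≡.subst (λ k → suc k ℕ.≤ n) len (unique⇒length≤n uni)) ℕ.1+n≰n
  follow b (suc k) x xs len uni linked reach | no gx∉ = follow b k (g x) (x ∷ xs)
    (≡.trans (ℕ.+-suc k _) len) (All.tabulate (λ p eq → gx∉ (≡.subst (_∈ x ∷ xs) (≡.sym eq) p)) ∷ uni) (≡.refl ∷ linked)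
    ((All.head reach ◅◅ adjacent-next x ◅ ε) ∷ reach)
  follow b k       x xs len uni linked reach | yes gx∈
    with ys , sub , uni′ , back ← close-path gx∈ ≡.refl linked uni = x ∷ ys , record
      { length≥3 = long ys back
      ; distinct = uni′
      ; adjacent = ≡.subst (All _) (≡.sym (steps-arcs x ys x)) (All.tabulate λ {(u , v)} uv∈ →
          component-adjacent⁺ S {b} (All.lookup reach (sub (arcs-source ys uv∈)))
            (adjacent-sym S (≡.subst (Adjacent H v) (All.lookup back uv∈) (adjacent-next v)))) }
    where
    long : ∀ ys → All (λ (u , v) → Next v u) (arcs x ys x) → 3 ℕ.≤ length (x ∷ ys)
    long []           (gx≡x ∷ [])        = contradiction gx≡x no-loop
    long (y ∷ [])     (gy≡x ∷ gx≡y ∷ []) = contradiction gy≡x (no-swap gx≡y)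
    long (y ∷ z ∷ zs) _                  = s≤s (s≤s (s≤s z≤n))

  component-cycle : ∀ b → ∃ λ γ → IsCycle (component H b) γ
  component-cycle b = follow b n b [] (ℕ.+-identityʳ n) ([] ∷ []) [-] (ε ∷ [])

  -- Runs backwards from the last arc, which `end` forces to be forward. A backward arc (x , y)
  -- before a forward arc (y , w) would give y two images under g, unless w = x, and then an arc and
  -- its reverse both occur.
  all-forward : ∀ x xs z → All (λ (u , v) → Next u v ⊎ Next v u) (arcs x xs z) →
    (∀ {u v} → (u , v) ∈ arcs x xs z → (v , u) ∈ arcs x xs z → ⊥) →
    (∀ {u} → (u , z) ∈ arcs x xs z → ¬ Next z u) → All (uncurry Next) (arcs x xs z)
  all-forward x [] z (either ∷ []) asym end = [ id , (λ zx → contradiction zx (end (here ≡.refl))) ]′ either ∷ []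
  all-forward x (y ∷ ys) z (either ∷ eithers) asym end = head either ∷ tail
    where
    tail : All (uncurry Next) (arcs y ys z)
    tail = all-forward y ys z eithers (λ p q → asym (there p) (there q)) (end ∘ there)
    head : Next x y ⊎ Next y x → Next x y
    head (inj₁ xy) = xy
    head (inj₂ yx) with w , yw∈ ← arcs-successor ys {z} {y} (here ≡.refl)
      with ≡.refl ← ≡.trans (≡.sym yx) (All.lookup tail yw∈) = contradiction (there yw∈) (asym (here ≡.refl))

  -- The mirror image, running from the first arc: after g y ≡ x a forward arc out of y could only
  -- be the reverse of (x , y).
  all-backward : ∀ x y ys z → All (λ (u , v) → Next u v ⊎ Next v u) (arcs x (y ∷ ys) z) →
    (∀ {u v} → (u , v) ∈ arcs x (y ∷ ys) z → (v , u) ∈ arcs x (y ∷ ys) z → ⊥) →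
    Next y x → All (λ (u , v) → Next v u) (arcs x (y ∷ ys) z)
  all-backward x y [] z (_ ∷ inj₁ yz ∷ []) asym yx with ≡.refl ← ≡.trans (≡.sym yx) yz =
    contradiction (there (here ≡.refl)) (asym (here ≡.refl))
  all-backward x y [] z (_ ∷ inj₂ zy ∷ []) asym yx = yx ∷ zy ∷ []
  all-backward x y (w ∷ ws) z (_ ∷ inj₁ yw ∷ _) asym yx with ≡.refl ← ≡.trans (≡.sym yx) yw =
    contradiction (there (here ≡.refl)) (asym (here ≡.refl))
  all-backward x y (w ∷ ws) z (_ ∷ eithers@(inj₂ wy ∷ _)) asym yx =
    yx ∷ all-backward y w ws z eithers (λ p q → asym (there p) (there q)) wy

  -- Since g gives each vertex a single way out, the direction of the first arc fixes that of all
  -- the others.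
  cycle-consistent : ∀ {b r rs} → IsCycle (component H b) (r ∷ rs) →
    All (uncurry Next) (arcs r rs r) ⊎ All (λ (u , v) → Next v u) (arcs r rs r)
  cycle-consistent {b} {r} {[]}     cyc with s≤s () ← IsCycle.length≥3 cyc
  cycle-consistent {b} {r} {y ∷ ys} cyc = go (All.head either)
    where
    asym : ∀ {u v} → (u , v) ∈ arcs r (y ∷ ys) r → (v , u) ∈ arcs r (y ∷ ys) r → ⊥
    asym = cycle-asymmetric (y ∷ ys) (IsCycle.length≥3 cyc) (IsCycle.distinct cyc)
    either : All (λ (u , v) → Next u v ⊎ Next v u) (arcs r (y ∷ ys) r)
    either = All.tabulate λ uv∈ → adjacent⇒next (proj₁ (component-adjacent⁻ S {b} (anchored-arc S {b} cyc uv∈)))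
    go : Next r y ⊎ Next y r → All (uncurry Next) (arcs r (y ∷ ys) r) ⊎ All (λ (u , v) → Next v u) (arcs r (y ∷ ys) r)
    go (inj₁ ry) = inj₁ (all-forward r (y ∷ ys) r either asym λ ur∈ ru → asym ur∈ (≡.subst (λ w → (r , w) ∈ arcs r (y ∷ ys) r) (≡.trans (≡.sym ry) ru) (here ≡.refl)))
    go (inj₂ yr) = inj₂ (all-backward r y ys r either asym yr)

  -- What remains of a cycle when its direction is forgotten: an orbit of g, whose edges are the
  -- images under f of its vertices.
  record Circuit (r : Fin n) (rs : List (Fin n)) : Set where
    field
      closed    : ∀ {x} → x ∈ r ∷ rs → g x ∈ r ∷ rs
      connected : ∀ {x y} → x ∈ r ∷ rs → y ∈ r ∷ rs → Star Next x y
      edge⁺     : ∀ {x} → x ∈ r ∷ rs → Any (uncurry (Joins (f x))) (arcs r rs r)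
      edge⁻     : ∀ {e} → Any (uncurry (Joins e)) (arcs r rs r) → ∃ λ x → x ∈ r ∷ rs × e ≡ f x

  circuit : ∀ {b r rs} → IsCycle (component H b) (r ∷ rs) → Circuit r rs
  circuit {b} {r} {rs} cyc with cycle-consistent {b} cyc
  ... | inj₁ forward = record
    { closed = λ x∈ → let v , xv∈ = arcs-successor rs x∈ in
        ≡.subst (_∈ r ∷ rs) (≡.sym (All.lookup forward xv∈)) (arcs-target rs xv∈)
    ; connected = cycle-connected rs forward
    ; edge⁺ = λ {x} x∈ → let v , xv∈ = arcs-successor rs x∈ in
        lose xv∈ (≡.subst (Joins (f x) x) (All.lookup forward xv∈) (joins x))
    ; edge⁻ = λ any → let (u , v) , uv∈ , e-joins = find any in
        u , arcs-source rs uv∈ , joins-unique e-joins (≡.subst (Joins (f u) u) (All.lookup forward uv∈) (joins u)) }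
  ... | inj₂ backward = record
    { closed = λ x∈ → let u , ux∈ = arcs-predecessor rs x∈ in
        ≡.subst (_∈ r ∷ rs) (≡.sym (All.lookup backward ux∈)) (arcs-source rs ux∈)
    ; connected = λ x∈ y∈ → Star.reverse id (cycle-connected rs backward y∈ x∈)
    ; edge⁺ = λ {x} x∈ → let u , ux∈ = arcs-predecessor rs x∈ in
        lose ux∈ (joins-sym (≡.subst (Joins (f x) x) (All.lookup backward ux∈) (joins x)))
    ; edge⁻ = λ any → let (u , v) , uv∈ , e-joins = find any in
        v , arcs-target rs uv∈ , joins-unique e-joins (joins-sym (≡.subst (Joins (f v) v) (All.lookup backward uv∈) (joins v))) }

  -- Every edge is a step of g one way or the other. A step out of i extends the orbit. A step from
  -- k into i is the first step of the orbit of k, so it is dropped, or, if that orbit had not moved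
  -- yet, added on the other side.
  orbits-meet : ∀ {i j} → Reaches i j → ∃ λ z → Star Next i z × Star Next j z
  orbits-meet ε = _ , ε , ε
  orbits-meet {i} (adj ◅ k⇝j) with adjacent⇒next adj | orbits-meet k⇝j
  ... | inj₁ ik | z , k⇝z , j⇝z = z , ik ◅ k⇝z , j⇝z
  ... | inj₂ ki | z , ε , j⇝z = i , ε , j⇝z ◅◅ ki ◅ ε
  ... | inj₂ ≡.refl | z , ≡.refl ◅ i⇝z , j⇝z = z , i⇝z , j⇝z

  orbit-closed : ∀ {r rs} → Circuit r rs → ∀ {x y} → Star Next x y → x ∈ r ∷ rs → y ∈ r ∷ rs
  orbit-closed circ ε x∈ = x∈
  orbit-closed circ (≡.refl ◅ p) x∈ = orbit-closed circ p (Circuit.closed circ x∈)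

  -- Both circuits are closed under g, so a meeting point of the orbits of r and s lies on both.
  -- From there g runs through all of the first circuit without leaving the second.
  circuit-⊆ : ∀ {r rs s ss} → Circuit r rs → Circuit s ss → Reaches r s → r ∷ rs ⊆ s ∷ ss
  circuit-⊆ {r} {rs} {s} {ss} circ circ′ r⇝s x∈ with z , r⇝z , s⇝z ← orbits-meet r⇝s =
    orbit-closed circ′ (Circuit.connected circ (orbit-closed circ r⇝z (here ≡.refl)) x∈) (orbit-closed circ′ s⇝z (here ≡.refl))

  component-unicyclic : ∀ b → Unicyclic (component H b)
  component-unicyclic b with component-cycle b
  ... | γ , cyc = record
    { connected = component-connected b ; cycle = γ ; isCycle = cyc
    ; unique = λ γ′ cyc′ → Vec.tabulate-cong λ e → does-⇔
        (mk⇔ (transfer cyc′ cyc) (transfer cyc cyc′))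
        (Any.any? (uncurry (joins? e)) (steps (closeUp γ′))) (Any.any? (uncurry (joins? e)) (steps (closeUp γ))) }
    where
    transfer : ∀ {γ γ′ e} → IsCycle (component H b) γ → IsCycle (component H b) γ′ →
               Any (uncurry (Joins e)) (steps (closeUp γ)) → Any (uncurry (Joins e)) (steps (closeUp γ′))
    transfer {[]}              cyc cyc′ with () ← IsCycle.length≥3 cyc
    transfer {_}      {[]}     cyc cyc′ with () ← IsCycle.length≥3 cyc′
    transfer {r ∷ rs} {s ∷ ss} {e} cyc cyc′ any
      with x , x∈ , ≡.refl ← Circuit.edge⁻ (circuit {b} cyc) (≡.subst (Any _) (steps-arcs r rs r) any)
      = ≡.subst (Any _) (≡.sym (steps-arcs s ss s)) (Circuit.edge⁺ (circuit {b} cyc′)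
          (circuit-⊆ (circuit {b} cyc) (circuit {b} cyc′)
            (reaches-sym S (anchored-reaches S cyc (here ≡.refl)) ◅◅ anchored-reaches S cyc′ (here ≡.refl)) x∈))

-- Complex numbers

module ComplexProperties {ℓ} (ℝ : Reals ℓ) where

  open Complex ℝ

  module R where
    open Reals ℝ public
    open RealProperties ℝ public
    open RingProperties ring public using (-0#≈0#; -‿involutive)

  private
    module S = DifferenceSolver R.commutativeRing
  open S using (solve; _:=_; _:+_; _:*_; _:-_; :-_; :0; :1)

  ℂ-commutativeRing : CommutativeRing ℓ ℓ
  ℂ-commutativeRing = record
    { RawRing ℂ-rawRing
    ; isCommutativeRing = record
      { isRing = record
        { +-isAbelianGroup = record
          { isGroup = record
            { isMonoid = record
              { isSemigroup = record
                { isMagma = record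
                  { isEquivalence = record
                    { refl  = R.refl , R.refl
                    ; sym   = λ (p , q) → R.sym p , R.sym q
                    ; trans = λ (p , q) (r , s) → R.trans p r , R.trans q s }
                  ; ∙-cong = λ (p , q) (r , s) → R.+-cong p r , R.+-cong q s }
                ; assoc = λ z u v → R.+-assoc _ _ _ , R.+-assoc _ _ _ }
              ; identity = (λ z → R.+-identityˡ _ , R.+-identityˡ _) , (λ z → R.+-identityʳ _ , R.+-identityʳ _) }
            ; inverse = (λ z → R.-‿inverseˡ _ , R.-‿inverseˡ _) , (λ z → R.-‿inverseʳ _ , R.-‿inverseʳ _)
            ; ⁻¹-cong = λ (p , q) → R.-‿cong p , R.-‿cong q }
          ; comm = λ z u → R.+-comm _ _ , R.+-comm _ _ }
        ; *-cong = λ (p , q) (r , s) → R.+-cong (R.*-cong p r) (R.-‿cong (R.*-cong q s)) , R.+-cong (R.*-cong p s) (R.*-cong q r)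
        ; *-assoc = λ (a +i b) (c +i d) (e +i f) →
            solve 6 (λ a b c d e f → (a :* c :- b :* d) :* e :- (a :* d :+ b :* c) :* f := a :* (c :* e :- d :* f) :- b :* (c :* f :+ d :* e)) R.refl a b c d e f ,
            solve 6 (λ a b c d e f → (a :* c :- b :* d) :* f :+ (a :* d :+ b :* c) :* e := a :* (c :* f :+ d :* e) :+ b :* (c :* e :- d :* f)) R.refl a b c d e f
        ; *-identity =
            (λ (a +i b) → solve 2 (λ a b → :1 :* a :- :0 :* b := a) R.refl a b ,
                          solve 2 (λ a b → :1 :* b :+ :0 :* a := b) R.refl a b) ,
            (λ (a +i b) → solve 2 (λ a b → a :* :1 :- b :* :0 := a) R.refl a b ,
                          solve 2 (λ a b → a :* :0 :+ b :* :1 := b) R.refl a b)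
        ; distrib =
            (λ (a +i b) (c +i d) (e +i f) →
              solve 6 (λ a b c d e f → a :* (c :+ e) :- b :* (d :+ f) := (a :* c :- b :* d) :+ (a :* e :- b :* f)) R.refl a b c d e f ,
              solve 6 (λ a b c d e f → a :* (d :+ f) :+ b :* (c :+ e) := (a :* d :+ b :* c) :+ (a :* f :+ b :* e)) R.refl a b c d e f) ,
            (λ (a +i b) (c +i d) (e +i f) →
              solve 6 (λ a b c d e f → (c :+ e) :* a :- (d :+ f) :* b := (c :* a :- d :* b) :+ (e :* a :- f :* b)) R.refl a b c d e f ,
              solve 6 (λ a b c d e f → (c :+ e) :* b :+ (d :+ f) :* a := (c :* b :+ d :* a) :+ (e :* b :+ f :* a)) R.refl a b c d e f) }
      ; *-comm = λ (a +i b) (c +i d) →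
          solve 4 (λ a b c d → a :* c :- b :* d := c :* a :- d :* b) R.refl a b c d ,
          solve 4 (λ a b c d → a :* d :+ b :* c := c :* b :+ d :* a) R.refl a b c d } }

  open CommutativeRing ℂ-commutativeRing hiding (zero)
  open RingProperties ring using (-‿distribʳ-*)

  infix 4 _≟ℂ_
  _≟ℂ_ : ∀ z u → Dec (z ≈ u)
  z ≟ℂ u = (re z R.≟ re u) ×-dec (im z R.≟ im u)

  fromℝ-cong : ∀ {x y} → x R.≈ y → fromℝ x ≈ fromℝ y
  fromℝ-cong p = p , R.refl

  fromℝ-+ : ∀ x y → fromℝ (x R.+ y) ≈ fromℝ x + fromℝ y
  fromℝ-+ x y = R.refl , R.sym (R.+-identityˡ _)

  fromℝ-* : ∀ x y → fromℝ (x R.* y) ≈ fromℝ x * fromℝ y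
  fromℝ-* x y = solve 2 (λ x y → x :* y := x :* y :- :0 :* :0) R.refl x y ,
                solve 2 (λ x y → :0 := x :* :0 :+ :0 :* y) R.refl x y

  conj-cong : ∀ {z u} → z ≈ u → conj z ≈ conj u
  conj-cong (p , q) = p , R.-‿cong q

  conj-* : ∀ z u → conj (z * u) ≈ conj z * conj u
  conj-* (a +i b) (c +i d) =
    solve 4 (λ a b c d → a :* c :- b :* d := a :* c :- (:- b) :* (:- d)) R.refl a b c d ,
    solve 4 (λ a b c d → :- (a :* d :+ b :* c) := a :* (:- d) :+ (:- b) :* c) R.refl a b c d

  conj-fromℝ : ∀ x → conj (fromℝ x) ≈ fromℝ x
  conj-fromℝ x = R.refl , R.-0#≈0#

  conj-involutive : ∀ z → conj (conj z) ≈ z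
  conj-involutive z = R.refl , R.-‿involutive _

  normSquared : ℂ → R.Carrier
  normSquared z = re z R.* re z R.+ im z R.* im z

  *-conj : ∀ z → z * conj z ≈ fromℝ (normSquared z)
  *-conj (a +i b) = solve 2 (λ a b → a :* a :- b :* (:- b) := a :* a :+ b :* b) R.refl a b ,
                    solve 2 (λ a b → a :* (:- b) :+ b :* a := :0) R.refl a b

  +-conj : ∀ z → z + conj z ≈ fromℝ (re z R.+ re z)
  +-conj z = R.refl , R.-‿inverseʳ _

  modulus-nonNeg : ∀ z → R.0# R.≤ modulus z
  modulus-nonNeg z = proj₁ (proj₂ (R.squareRoot (normSquared z) _))

  modulus² : ∀ z → modulus z R.* modulus z R.≈ normSquared z
  modulus² z = proj₂ (proj₂ (R.squareRoot (normSquared z) _))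

  x²≈0⇒x≈0 : ∀ {x} → x R.* x R.≈ R.0# → x R.≈ R.0#
  x²≈0⇒x≈0 {x} x²≈0 = decidable-stable (x R.≟ R.0#) λ x≉0 → R.*-≉0 x≉0 x≉0 x²≈0

  nonNeg-+≈0 : ∀ {x y} → R.0# R.≤ x → R.0# R.≤ y → x R.+ y R.≈ R.0# → x R.≈ R.0#
  nonNeg-+≈0 {x} {y} 0≤x 0≤y x+y≈0 = R.antisym
    (R.≤-respʳ-≈ x+y≈0 (R.≤-respˡ-≈ (R.+-identityʳ x) (R.+-monoʳ-≤ x 0≤y))) 0≤x

  -- (y - x) (x + y) = 0, and a vanishing sum of non-negative numbers makes both of them zero.
  square-injective : ∀ {x y} → R.0# R.≤ x → R.0# R.≤ y → x R.* x R.≈ y R.* y → x R.≈ y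
  square-injective {x} {y} 0≤x 0≤y x²≈y² = decidable-stable (x R.≟ y) λ x≉y →
    R.*-≉0 (λ y-x≈0 → x≉y (R.-≈0⇒≈ y-x≈0))
           (λ x+y≈0 → x≉y (R.trans (nonNeg-+≈0 0≤x 0≤y x+y≈0)
              (R.sym (nonNeg-+≈0 0≤y 0≤x (R.trans (R.+-comm y x) x+y≈0)))))
      (R.trans (solve 2 (λ x y → (y :- x) :* (x :+ y) := y :* y :- x :* x) R.refl x y)
        (R.trans (R.+-congˡ (R.-‿cong x²≈y²)) (R.-‿inverseʳ _)))

  -- The modulus is the root delivered by `squareRoot`; its identities are obtained by comparing
  -- squares of non-negative numbers.
  modulus-unique : ∀ {z x} → R.0# R.≤ x → x R.* x R.≈ normSquared z → modulus z R.≈ x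
  modulus-unique {z} 0≤x x² = square-injective (modulus-nonNeg z) 0≤x (R.trans (modulus² z) (R.sym x²))

  modulus-cong : ∀ {z u} → z ≈ u → modulus z R.≈ modulus u
  modulus-cong {z} {u} (p , q) = modulus-unique (modulus-nonNeg u)
    (R.trans (modulus² u) (R.sym (R.+-cong (R.*-cong p p) (R.*-cong q q))))

  modulus-* : ∀ z u → modulus (z * u) R.≈ modulus z R.* modulus u
  modulus-* z@(a +i b) u@(c +i d) = modulus-unique (R.*-nonNeg (modulus-nonNeg z) (modulus-nonNeg u))
    (R.trans (solve 2 (λ x y → (x :* y) :* (x :* y) := (x :* x) :* (y :* y)) R.refl (modulus z) (modulus u))
    (R.trans (R.*-cong (modulus² z) (modulus² u))
      (solve 4 (λ a b c d → (a :* a :+ b :* b) :* (c :* c :+ d :* d) :=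
        (a :* c :- b :* d) :* (a :* c :- b :* d) :+ (a :* d :+ b :* c) :* (a :* d :+ b :* c)) R.refl a b c d)))

  modulus-1 : modulus 1# R.≈ R.1#
  modulus-1 = modulus-unique R.0≤1 (solve 0 (:1 :* :1 := :1 :* :1 :+ :0 :* :0) R.refl)

  modulus-conj : ∀ z → modulus (conj z) R.≈ modulus z
  modulus-conj z@(a +i b) = modulus-unique (modulus-nonNeg z)
    (R.trans (modulus² z) (solve 2 (λ a b → a :* a :+ b :* b := a :* a :+ (:- b) :* (:- b)) R.refl a b))

  modulus-0 : modulus 0# R.≈ R.0#
  modulus-0 = modulus-unique R.≤-refl (solve 0 (:0 :* :0 := :0 :* :0 :+ :0 :* :0) R.refl)

  modulus≈0⇒≈0 : ∀ {z} → modulus z R.≈ R.0# → z ≈ 0#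
  modulus≈0⇒≈0 {z@(a +i b)} |z|≈0 = x²≈0⇒x≈0 (nonNeg-+≈0 (R.x*x-nonNeg a) (R.x*x-nonNeg b) n≈0) ,
    x²≈0⇒x≈0 (nonNeg-+≈0 (R.x*x-nonNeg b) (R.x*x-nonNeg a) (R.trans (R.+-comm _ _) n≈0))
    where
    n≈0 : normSquared z R.≈ R.0#
    n≈0 = R.trans (R.sym (modulus² z)) (R.trans (R.*-cong |z|≈0 |z|≈0) (R.zeroˡ _))

  -- Total, with zero sent to zero, so that phases can be formed without a proof that the weight is
  -- non-zero.
  inv : R.Carrier → R.Carrier
  inv x with x R.≟ R.0#
  ... | yes _   = R.0#
  ... | no x≉0 = proj₁ (R.inverse x x≉0)

  inv-inverse : ∀ {x} → ¬ x R.≈ R.0# → x R.* inv x R.≈ R.1#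
  inv-inverse {x} x≉0 with x R.≟ R.0#
  ... | yes x≈0 = contradiction x≈0 x≉0
  ... | no x≉0′ = proj₂ (R.inverse x x≉0′)

  -- z / ∣ z ∣, and 0 at 0
  phase : ℂ → ℂ
  phase z = fromℝ (inv (modulus z)) * z

  modulus-phase : ∀ {z} → ¬ z ≈ 0# → fromℝ (modulus z) * phase z ≈ z
  modulus-phase {z} z≉0 = begin
    fromℝ (modulus z) * (fromℝ (inv (modulus z)) * z) ≈⟨ *-assoc _ _ _ ⟨
    fromℝ (modulus z) * fromℝ (inv (modulus z)) * z   ≈⟨ *-congʳ (fromℝ-* _ _) ⟨
    fromℝ (modulus z R.* inv (modulus z)) * z         ≈⟨ *-congʳ (fromℝ-cong (inv-inverse (z≉0 ∘ modulus≈0⇒≈0))) ⟩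
    1# * z                                            ≈⟨ *-identityˡ z ⟩
    z                                                 ∎
    where open SetoidReasoning setoid

  private
    module C = DifferenceSolver ℂ-commutativeRing

  modulus-conj-phase : ∀ {z} → ¬ z ≈ 0# → fromℝ (modulus z) * conj (phase z) ≈ conj z
  modulus-conj-phase {z} z≉0 = begin
    fromℝ (modulus z) * conj (phase z)        ≈⟨ *-congʳ (conj-fromℝ _) ⟨
    conj (fromℝ (modulus z)) * conj (phase z) ≈⟨ conj-* _ _ ⟨
    conj (fromℝ (modulus z) * phase z)        ≈⟨ conj-cong (modulus-phase z≉0) ⟩
    conj z                                    ∎
    where open SetoidReasoning setoid

  phase-unit : ∀ {z} → ¬ z ≈ 0# → phase z * conj (phase z) ≈ 1#
  phase-unit {z} z≉0 = begin
    phase z * conj (phase z)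
      ≈⟨ *-cong refl (conj-* _ z) ⟩
    ι * z * (conj ι * conj z)
      ≈⟨ *-congˡ (*-congʳ (conj-fromℝ _)) ⟩
    ι * z * (ι * conj z)
      ≈⟨ C.solve 3 (λ i z c → i C.:* z C.:* (i C.:* c) C.:= i C.:* i C.:* (z C.:* c)) refl ι z (conj z) ⟩
    ι * ι * (z * conj z)
      ≈⟨ *-congˡ (trans (*-conj z) (trans (fromℝ-cong (R.sym (modulus² z))) (fromℝ-* _ _))) ⟩
    ι * ι * (μ * μ)
      ≈⟨ C.solve 2 (λ i m → i C.:* i C.:* (m C.:* m) C.:= (m C.:* i) C.:* (m C.:* i)) refl ι μ ⟩
    (μ * ι) * (μ * ι)
      ≈⟨ *-cong μι≈1 μι≈1 ⟩
    1# * 1#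
      ≈⟨ *-identityˡ 1# ⟩
    1# ∎
    where
    open SetoidReasoning setoid
    ι μ : ℂ
    ι = fromℝ (inv (modulus z))
    μ = fromℝ (modulus z)
    μι≈1 : μ * ι ≈ 1#
    μι≈1 = trans (sym (fromℝ-* _ _)) (fromℝ-cong (inv-inverse (z≉0 ∘ modulus≈0⇒≈0)))

  -- Products of weights round a cycle

  listProductℂ : List ℂ → ℂ
  listProductℂ = foldr _*_ 1#

  listProductℝ : List R.Carrier → R.Carrier
  listProductℝ = foldr R._*_ R.1#

  modulus-listProduct : ∀ zs → modulus (listProductℂ zs) R.≈ listProductℝ (map modulus zs)
  modulus-listProduct []       = modulus-1
  modulus-listProduct (z ∷ zs) = R.trans (modulus-* z _) (R.*-congˡ (modulus-listProduct zs))

  -- For the weights met round a cycle this is the number τ.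
  negPhases : List ℂ → ℂ
  negPhases zs = listProductℂ (map (-_ ∘ phase) zs)

  negPhases-unit : ∀ {zs} → All (λ z → ¬ z ≈ 0#) zs → negPhases zs * conj (negPhases zs) ≈ 1#
  negPhases-unit [] = trans (*-conj 1#) (fromℝ-cong (solve 0 (:1 :* :1 :+ :0 :* :0 := :1) R.refl))
  negPhases-unit {z ∷ zs} (z≉0 ∷ zs≉0) = begin
    (- p * q) * conj (- p * q)            ≈⟨ *-congˡ (conj-* (- p) q) ⟩
    (- p * q) * (- conj p * conj q)       ≈⟨ C.solve 4 (λ p q p̄ q̄ → (C.:- p C.:* q) C.:* (C.:- p̄ C.:* q̄) C.:= (p C.:* p̄) C.:* (q C.:* q̄)) refl p q (conj p) (conj q) ⟩
    (p * conj p) * (q * conj q)           ≈⟨ *-cong (phase-unit z≉0) (negPhases-unit zs≉0) ⟩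
    1# * 1#                               ≈⟨ *-identityˡ 1# ⟩
    1#                                    ∎
    where
    open SetoidReasoning setoid
    p = phase z
    q = negPhases zs

  -- Oddness is recorded as evenness of the successor, a form that the induction on k can pass on.
  even-or-odd : ∀ k → (2 ∣ k) ⊎ (2 ∣ suc k)
  even-or-odd zero = inj₁ (divides 0 ≡.refl)
  even-or-odd (suc k) with even-or-odd k
  ... | inj₁ 2∣k = inj₂ (∣m∣n⇒∣m+n (∣-refl {2}) 2∣k)
  ... | inj₂ 2∣1+k = inj₁ 2∣1+k

  odd⇒¬even : ∀ {k} → 2 ∣ suc k → ¬ 2 ∣ k
  odd⇒¬even {k} 2∣1+k 2∣k with () ← ∣1⇒≡1 (∣m+n∣m⇒∣n (≡.subst (2 ∣_) (≡.sym (ℕ.+-comm k 1)) 2∣1+k) 2∣k)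

  -- This is (-1)^k z, written with the divisibility test of `α` so that both can be split together.
  signed : ℕ → ℂ → ℂ
  signed k z = if does (2 ∣? k) then z else - z

  signed-even : ∀ {k} z → 2 ∣ k → signed k z ≡ z
  signed-even {k} z 2∣k rewrite dec-true (2 ∣? k) 2∣k = ≡.refl

  signed-odd : ∀ {k} z → 2 ∣ suc k → signed k z ≡ - z
  signed-odd {k} z 2∣1+k rewrite dec-false (2 ∣? k) (odd⇒¬even 2∣1+k) = ≡.refl

  signed-suc : ∀ k z → signed (suc k) z ≈ - signed k z
  signed-suc k z with even-or-odd k
  ... | inj₁ 2∣k = trans (reflexive (signed-odd z (∣m∣n⇒∣m+n (∣-refl {2}) 2∣k))) (-‿cong (reflexive (≡.sym (signed-even z 2∣k))))
  ... | inj₂ 2∣1+k = trans (reflexive (signed-even z 2∣1+k)) (trans (sym (R.-‿involutive _ , R.-‿involutive _)) (-‿cong (reflexive (≡.sym (signed-odd z 2∣1+k)))))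

  signed-* : ∀ k z u → signed k (z * u) ≈ z * signed k u
  signed-* k z u with does (2 ∣? k)
  ... | true = refl
  ... | false = -‿distribʳ-* z u

  -- Each factor satisfies |z| · (- z / |z|) = - z, and the k signs collect into `signed`.
  moduli-negPhases : ∀ {zs} → All (λ z → ¬ z ≈ 0#) zs →
    fromℝ (listProductℝ (map modulus zs)) * negPhases zs ≈ signed (length zs) (listProductℂ zs)
  moduli-negPhases [] = *-identityˡ 1#
  moduli-negPhases {z ∷ zs} (z≉0 ∷ zs≉0) = begin
    fromℝ (modulus z R.* P) * (- phase z * q)              ≈⟨ *-congʳ (fromℝ-* _ _) ⟩
    fromℝ (modulus z) * fromℝ P * (- phase z * q)          ≈⟨ C.solve 4 (λ m p f q → m C.:* p C.:* (C.:- f C.:* q) C.:= C.:- ((m C.:* f) C.:* (p C.:* q))) refl (fromℝ (modulus z)) (fromℝ P) (phase z) q ⟩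
    - (fromℝ (modulus z) * phase z * (fromℝ P * q))        ≈⟨ -‿cong (*-cong (modulus-phase z≉0) (moduli-negPhases zs≉0)) ⟩
    - (z * signed (length zs) (listProductℂ zs))           ≈⟨ -‿cong (signed-* (length zs) z _) ⟨
    - signed (length zs) (listProductℂ (z ∷ zs))           ≈⟨ signed-suc (length zs) _ ⟨
    signed (length (z ∷ zs)) (listProductℂ (z ∷ zs))       ∎
    where
    open SetoidReasoning setoid
    P = listProductℝ (map modulus zs)
    q = negPhases zs

  signed-re : ∀ k z x → x R.+ x R.- (re (signed k z) R.+ re (signed k z)) R.≈
              (R.1# R.+ R.1#) R.* (if does (2 ∣? k) then x R.- re z else x R.+ re z)
  signed-re k z x with does (2 ∣? k)
  ... | true = solve 2 (λ x y → x :+ x :- (y :+ y) := (:1 :+ :1) :* (x :- y)) R.refl x (re z)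
  ... | false = solve 2 (λ x y → x :+ x :- (:- y :+ :- y) := (:1 :+ :1) :* (x :+ y)) R.refl x (re z)

  -- With P the product of the moduli, P (1 - τ)(1 - conj τ) is P + P |τ|² - (P τ + conj (P τ)).
  -- Here |τ| = 1 and P τ = ± wt, which leaves 2 (|wt| ∓ Re wt).
  cycle-factor : ∀ {zs} → All (λ z → ¬ z ≈ 0#) zs →
    fromℝ (listProductℝ (map modulus zs)) * ((1# - negPhases zs) * (1# - conj (negPhases zs))) ≈
    fromℝ ((R.1# R.+ R.1#) R.* (if does (2 ∣? length zs)
      then modulus (listProductℂ zs) R.- re (listProductℂ zs)
      else modulus (listProductℂ zs) R.+ re (listProductℂ zs)))
  cycle-factor {zs} zs≉0 = begin
    P * ((1# - τ) * (1# - τ̄))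
      ≈⟨ C.solve 3 (λ p t u → p C.:* ((C.:1 C.:- t) C.:* (C.:1 C.:- u)) C.:= p C.:+ p C.:* (t C.:* u) C.:- (p C.:* t C.:+ p C.:* u)) refl P τ τ̄ ⟩
    P + P * (τ * τ̄) - (P * τ + P * τ̄)
      ≈⟨ +-cong (+-congˡ (trans (*-congˡ (negPhases-unit zs≉0)) (*-identityʳ P))) (-‿cong (+-cong Pτ (trans (*-congʳ (sym (conj-fromℝ _))) (trans (sym (conj-* P τ)) (conj-cong Pτ))))) ⟩
    P + P - (s + conj s)
      ≈⟨ +-cong refl (-‿cong (+-conj s)) ⟩
    P + P - fromℝ (re s R.+ re s)
      ≈⟨ R.refl , solve 0 (:0 :+ :0 :- :0 := :0) R.refl ⟩
    fromℝ (x R.+ x R.- (re s R.+ re s))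
      ≈⟨ fromℝ-cong (R.+-congʳ (R.+-cong (R.sym (modulus-listProduct zs)) (R.sym (modulus-listProduct zs)))) ⟩
    fromℝ (modulus wt R.+ modulus wt R.- (re s R.+ re s))
      ≈⟨ fromℝ-cong (signed-re (length zs) wt (modulus wt)) ⟩
    fromℝ _ ∎
    where
    open SetoidReasoning setoid
    x = listProductℝ (map modulus zs)
    wt = listProductℂ zs
    P = fromℝ x
    τ = negPhases zs
    τ̄ = conj τ
    s = signed (length zs) wt
    Pτ : P * τ ≈ s
    Pτ = moduli-negPhases zs≉0

-- Finite sums and products

-- Written additively but used for sums over ℂ and ℕ and for products over ℝ; in the last case the
-- default value `0#` of a false indicator is one.
module Indicator {c ℓ} (M : CommutativeMonoid c ℓ) where

  open CommutativeMonoid M renaming (ε to 0#; _∙_ to _+_)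
  open CommutativeMonoidSum M using (sum; sum-cong-≋; ∑-distrib-+; sum-replicate-zero)
  open SetoidReasoning setoid

  private
    variable
      a p q : Level.Level
      A : Set a
      P : Set p
      Q : Set q

  [_]_ : Dec P → Carrier → Carrier
  [ P? ] x = if does P? then x else 0#

  []-yes : (P? : Dec P) → P → ∀ x → [ P? ] x ≡ x
  []-yes P? p x rewrite dec-true P? p = ≡.refl

  []-no : (P? : Dec P) → ¬ P → ∀ x → [ P? ] x ≡ 0#
  []-no P? ¬p x rewrite dec-false P? ¬p = ≡.refl

  []-⇔ : (P? : Dec P) (Q? : Dec Q) → (P → Q) → (Q → P) → ∀ x → [ P? ] x ≡ [ Q? ] x
  []-⇔ (yes p) Q? f g x = ≡.sym ([]-yes Q? (f p) x)
  []-⇔ (no ¬p) Q? f g x = ≡.sym ([]-no Q? (¬p ∘ g) x)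

  listSum : List Carrier → Carrier
  listSum = foldr _+_ 0#

  listSum-map-cong : ∀ {f g : A → Carrier} xs → (∀ {x} → x ∈ xs → f x ≈ g x) → listSum (map f xs) ≈ listSum (map g xs)
  listSum-map-cong []       eq = refl
  listSum-map-cong (x ∷ xs) eq = ∙-cong (eq (here ≡.refl)) (listSum-map-cong xs (eq ∘ there))

  listSum-++ : ∀ xs ys → listSum (xs ++ ys) ≈ listSum xs + listSum ys
  listSum-++ []       ys = sym (identityˡ _)
  listSum-++ (x ∷ xs) ys = trans (∙-congˡ (listSum-++ xs ys)) (sym (assoc _ _ _))

  listSum-0 : ∀ {f : A → Carrier} xs → (∀ {x} → x ∈ xs → f x ≈ 0#) → listSum (map f xs) ≈ 0#
  listSum-0 []       f≈0 = refl
  listSum-0 (x ∷ xs) f≈0 = trans (∙-cong (f≈0 (here ≡.refl)) (listSum-0 xs (f≈0 ∘ there))) (identityˡ 0#)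

  listSum-single : ∀ {f : A → Carrier} {xs y} → Unique xs → y ∈ xs → (∀ {x} → x ∈ xs → x ≢ y → f x ≈ 0#) →
                   listSum (map f xs) ≈ f y
  listSum-single {xs = x ∷ xs} (x∉ ∷ _) (here ≡.refl) f≈0 =
    trans (∙-congˡ (listSum-0 xs λ z∈ → f≈0 (there z∈) λ { ≡.refl → All.lookup x∉ z∈ ≡.refl })) (identityʳ _)
  listSum-single {xs = x ∷ xs} (x∉ ∷ uni) (there y∈) f≈0 =
    trans (∙-cong (f≈0 (here ≡.refl) (All.lookup x∉ y∈)) (listSum-single uni y∈ (f≈0 ∘ there))) (identityˡ _)

  sum-0 : ∀ {n} {t : Fin n → Carrier} → (∀ i → t i ≈ 0#) → sum t ≈ 0#
  sum-0 {n} t≈0 = trans (sum-cong-≋ t≈0) (sum-replicate-zero n)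

  sum-single : ∀ {n} {t : Fin n → Carrier} i → (∀ j → j ≢ i → t j ≈ 0#) → sum t ≈ t i
  sum-single {suc n} zero    t≈0 = trans (∙-congˡ (sum-0 {n} λ j → t≈0 (suc j) λ ())) (identityʳ _)
  sum-single {suc n} (suc i) t≈0 = trans (∙-cong (t≈0 zero λ ()) (sum-single i λ j j≢i → t≈0 (suc j) (j≢i ∘ Fin.suc-injective))) (identityˡ _)

  sum-listSum : ∀ {n} (t : Fin n → Carrier) → sum t ≈ listSum (map t (allFin n))
  sum-listSum t = trans (go t) (reflexive (≡.cong listSum (≡.sym (List.map-tabulate id t))))
    where
    go : ∀ {n} (t : Fin n → Carrier) → sum t ≈ listSum (tabulate t)
    go {zero}  t = refl
    go {suc n} t = ∙-congˡ (go (t ∘ suc))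

  listSum-sum : ∀ {n} (t : A → Fin n → Carrier) xs → listSum (map (sum ∘ t) xs) ≈ sum λ i → listSum (map (λ x → t x i) xs)
  listSum-sum {n = n} t []       = sym (sum-0 {n} λ _ → refl)
  listSum-sum {n = n} t (x ∷ xs) = trans (∙-congˡ (listSum-sum t xs)) (sym (∑-distrib-+ (t x) λ i → listSum (map (λ x → t x i) xs)))

  sum-over-list : ∀ {m} (t : Fin m → Carrier) {xs} → Unique xs → {P : Pred (Fin m) p} (P? : Unary.Decidable P) →
                  (∀ {e} → P e → e ∈ xs) → (∀ {e} → e ∈ xs → P e) →
                  sum (λ e → [ P? e ] t e) ≈ listSum (map t xs)
  sum-over-list {m = m} t {[]}     uni P? ⊆xs xs⊆ = sum-0 {m} λ e → reflexive ([]-no (P? e) (λ Pe → ∉[] (⊆xs Pe)) (t e))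
    where
    ∉[] : ∀ {e : Fin m} → e ∉ []
    ∉[] ()
  sum-over-list {m = m} t {x ∷ xs} (x∉ ∷ uni) P? ⊆xs xs⊆ = begin
    sum (λ e → [ P? e ] t e)
      ≈⟨ sum-cong-≋ {m} split ⟩
    sum (λ e → [ e ≟ x ] t e + [ e ∈ˡ? xs ] t e)
      ≈⟨ ∑-distrib-+ (λ e → [ e ≟ x ] t e) (λ e → [ e ∈ˡ? xs ] t e) ⟩
    sum (λ e → [ e ≟ x ] t e) + sum (λ e → [ e ∈ˡ? xs ] t e)
      ≈⟨ ∙-cong (trans (sum-single {m} x λ e e≢x → reflexive ([]-no (e ≟ x) e≢x (t e))) (reflexive ([]-yes (x ≟ x) ≡.refl (t x))))
           (sum-over-list t uni (_∈ˡ? xs) id id) ⟩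
    t x + listSum (map t xs) ∎
    where
    open DecMembership (_≟_ {m}) using () renaming (_∈?_ to _∈ˡ?_)
    split : ∀ e → [ P? e ] t e ≈ [ e ≟ x ] t e + [ e ∈ˡ? xs ] t e
    split e with e ≟ x
    ... | yes ≡.refl = trans (reflexive ([]-yes (P? e) (xs⊆ (here ≡.refl)) (t e)))
      (sym (trans (∙-congˡ (reflexive ([]-no (e ∈ˡ? xs) (λ e∈ → All.lookup x∉ e∈ ≡.refl) (t e)))) (identityʳ _)))
    ... | no e≢x = trans (reflexive ([]-⇔ (P? e) (e ∈ˡ? xs) (λ Pe → tail (⊆xs Pe)) (xs⊆ ∘ there) (t e))) (sym (identityˡ _))
      where
      tail : e ∈ x ∷ xs → e ∈ xs
      tail (here e≡x) = contradiction e≡x e≢x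
      tail (there e∈) = e∈

  sum-over-image : ∀ {n m} (f : Fin n → Fin m) → Injective _≡_ _≡_ f → (t : Fin m → Carrier) →
                   {P : Pred (Fin m) p} (P? : Unary.Decidable P) →
                   (∀ {e} → P e → ∃ λ x → f x ≡ e) → (∀ x → P (f x)) →
                   sum (λ e → [ P? e ] t e) ≈ sum (t ∘ f)
  sum-over-image {n = n} f f-inj t {P} P? P⊆im im⊆P = begin
    sum (λ e → [ P? e ] t e)
      ≈⟨ sum-over-list t (Unique.map⁺ f-inj (Unique.allFin⁺ n)) P?
           (λ Pe → let x , fx≡e = P⊆im Pe in ≡.subst (_∈ map f (allFin n)) fx≡e (∈-map⁺ f (∈-allFin x)))
           (λ e∈ → let x , _ , e≡fx = ∈-map⁻ f e∈ in ≡.subst P (≡.sym e≡fx) (im⊆P x)) ⟩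
    listSum (map t (map f (allFin n)))   ≡⟨ ≡.cong listSum (List.map-∘ (allFin n)) ⟨
    listSum (map (t ∘ f) (allFin n))     ≈⟨ sum-listSum (t ∘ f) ⟨
    sum (t ∘ f)                          ∎

  sum-over-subsets : ∀ m (S₀ : Subset m) (h : Subset m → Carrier) → (∀ S → S ≢ S₀ → h S ≈ 0#) →
                     listSum (map h (allSubsets m)) ≈ h S₀
  sum-over-subsets zero    Vec.[] h h≈0 = identityʳ _
  sum-over-subsets (suc m) (b Vec.∷ S₀) h h≈0 = begin
    listSum (map h (map (outside Vec.∷_) (allSubsets m) ++ map (inside Vec.∷_) (allSubsets m)))
      ≡⟨ ≡.cong listSum (List.map-++ h (map (outside Vec.∷_) (allSubsets m)) (map (inside Vec.∷_) (allSubsets m))) ⟩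
    listSum (map h (map (outside Vec.∷_) (allSubsets m)) ++ map h (map (inside Vec.∷_) (allSubsets m)))
      ≈⟨ listSum-++ (map h (map (outside Vec.∷_) (allSubsets m))) _ ⟩
    listSum (map h (map (outside Vec.∷_) (allSubsets m))) + listSum (map h (map (inside Vec.∷_) (allSubsets m)))
      ≡⟨ ≡.cong₂ (λ xs ys → listSum xs + listSum ys) (≡.sym (List.map-∘ (allSubsets m))) (≡.sym (List.map-∘ (allSubsets m))) ⟩
    listSum (map (h ∘ (outside Vec.∷_)) (allSubsets m)) + listSum (map (h ∘ (inside Vec.∷_)) (allSubsets m))
      ≈⟨ pick b h≈0 ⟩
    h (b Vec.∷ S₀) ∎
    where
    pick : ∀ b → (∀ S → S ≢ b Vec.∷ S₀ → h S ≈ 0#) →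
           listSum (map (h ∘ (outside Vec.∷_)) (allSubsets m)) + listSum (map (h ∘ (inside Vec.∷_)) (allSubsets m)) ≈ h (b Vec.∷ S₀)
    pick false h≈0 = trans (∙-cong (sum-over-subsets m S₀ _ λ S S≢ → h≈0 _ (S≢ ∘ Vec.∷-injectiveʳ))
      (listSum-0 (allSubsets m) λ _ → h≈0 _ λ ())) (identityʳ _)
    pick true  h≈0 = trans (∙-cong (listSum-0 (allSubsets m) λ _ → h≈0 _ λ ())
      (sum-over-subsets m S₀ _ λ S S≢ → h≈0 _ (S≢ ∘ Vec.∷-injectiveʳ))) (identityˡ _)

private
  module ℕ-Sum where
    open CommutativeMonoidSum ℕ.+-0-commutativeMonoid public using (sum)
    open Indicator ℕ.+-0-commutativeMonoid public

∣∣-sum : ∀ {m} (S : Subset m) → ∣ S ∣ ≡ ℕ-Sum.sum λ e → ℕ-Sum.[ e ∈? S ] 1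
∣∣-sum Vec.[]            = ≡.refl
∣∣-sum (true  Vec.∷ S) = ≡.cong suc (∣∣-sum S)
∣∣-sum (false Vec.∷ S) = ∣∣-sum S

sum-ones : ∀ n → ℕ-Sum.sum {n} (λ _ → 1) ≡ n
sum-ones zero    = ≡.refl
sum-ones (suc n) = ≡.cong suc (sum-ones n)

-- Images of injections

module _ {n m} (f : Fin n → Fin m) (f-inj : Injective _≡_ _≡_ f) where

  image : Subset m
  image = Vec.tabulate λ e → does (any? λ x → f x ≟ e)

  ∈-image⁺ : ∀ x → f x Subset.∈ image
  ∈-image⁺ x = ∈-tabulate⁺ (λ e → any? λ x → f x ≟ e) (x , ≡.refl)

  ∈-image⁻ : ∀ {e} → e Subset.∈ image → ∃ λ x → f x ≡ e
  ∈-image⁻ = ∈-tabulate⁻ λ e → any? λ x → f x ≟ e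

  ∣image∣≡n : ∣ image ∣ ≡ n
  ∣image∣≡n = ≡.trans (∣∣-sum image) (≡.trans
    (ℕ-Sum.sum-over-image f f-inj (λ _ → 1) (_∈? image) ∈-image⁻ ∈-image⁺) (sum-ones n))

  -- The image has n elements already, so a set of n elements containing it cannot be strictly
  -- larger.
  image-onto : ∀ {S} → ∣ S ∣ ≡ n → (∀ x → f x Subset.∈ S) → ∀ {e} → e Subset.∈ S → ∃ λ x → f x ≡ e
  image-onto {S} ∣S∣≡n f∈S {e} e∈S with e ∈? image
  ... | yes e∈ = ∈-image⁻ e∈
  ... | no e∉  = contradiction (p⊂q⇒∣p∣<∣q∣ (image⊆S , e , e∈S , e∉)) (ℕ.<-irrefl (≡.trans ∣image∣≡n (≡.sym ∣S∣≡n)))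
    where
    image⊆S : image Subset.⊆ S
    image⊆S e∈ with x , ≡.refl ← ∈-image⁻ e∈ = f∈S x

  image-unique : ∀ {S} → ∣ S ∣ ≡ n → (∀ x → f x Subset.∈ S) → S ≡ image
  image-unique {S} ∣S∣≡n f∈S = ⊆-antisym
    (λ e∈S → ≡.subst (Subset._∈ image) (proj₂ (image-onto ∣S∣≡n f∈S e∈S)) (∈-image⁺ _))
    (λ e∈ → ≡.subst (Subset._∈ S) (proj₂ (∈-image⁻ e∈)) (f∈S _))

-- Expansion of the determinant

module Expansion {ℓ} (ℝ : Reals ℓ) {n m} (G : OrientedGraph n m) (w : Fin m → Complex.ℂ ℝ)
  (w≉0 : ∀ e → ¬ RawRing._≈_ (Complex.ℂ-rawRing ℝ) (w e) (RawRing.0# (Complex.ℂ-rawRing ℝ))) where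

  open Complex ℝ
  open ComplexProperties ℝ
  open OrientedGraph G
  open Graph G
  open Weighted ℝ G w
  open Components G
  open CommutativeRing ℂ-commutativeRing hiding (zero)
  open RowForms ℂ-commutativeRing hiding (sum-0)
  open Elimination ℂ-commutativeRing
  open Indicator +-commutativeMonoid
  open DifferenceSolver ℂ-commutativeRing using (solve; _:=_; _:+_; _:*_)
  open SetoidReasoning setoid

  A-forward : ∀ {e i j} → src e ≡ i → tgt e ≡ j → A i j ≡ w e
  A-forward {e} {i} {j} p q with any? (λ e → (src e ≟ i) ×-dec (tgt e ≟ j)) | any? (λ e → (src e ≟ j) ×-dec (tgt e ≟ i))
  ... | yes (f , p′ , q′) | _ = ≡.cong w (joins-unique (inj₁ (p′ , q′)) (inj₁ (p , q)))
  ... | no ∄ | _ = contradiction (e , p , q) ∄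

  A-backward : ∀ {e i j} → src e ≡ j → tgt e ≡ i → A i j ≡ conj (w e)
  A-backward {e} {i} {j} p q with any? (λ e → (src e ≟ i) ×-dec (tgt e ≟ j)) | any? (λ e → (src e ≟ j) ×-dec (tgt e ≟ i))
  ... | yes (f , p′ , q′) | _ with ≡.refl ← joins-unique (inj₁ (p′ , q′)) (inj₂ (p , q)) =
    contradiction (≡.trans p′ (≡.sym q)) (loopless e)
  A-backward p q | no _ | yes (f , p′ , q′) = ≡.cong (conj ∘ w) (joins-unique (inj₁ (p′ , q′)) (inj₁ (p , q)))
  A-backward {e} p q | no _ | no ∄ = contradiction (e , p , q) ∄

  A-none : ∀ {i j} → (∀ e → ¬ Joins e i j) → A i j ≡ 0#
  A-none {i} {j} none with any? (λ e → (src e ≟ i) ×-dec (tgt e ≟ j)) | any? (λ e → (src e ≟ j) ×-dec (tgt e ≟ i))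
  ... | yes (e , p) | _ = contradiction (inj₁ p) (none e)
  ... | no _ | yes (e , p) = contradiction (inj₂ p) (none e)
  ... | no _ | no _ = ≡.refl

  conj≉0 : ∀ {z} → ¬ z ≈ 0# → ¬ conj z ≈ 0#
  conj≉0 {z} z≉0 z̄≈0 = z≉0 (trans (sym (conj-involutive z)) (trans (conj-cong z̄≈0) (conj-fromℝ R.0#)))

  A≉0 : ∀ {e i j} → Joins e i j → ¬ A i j ≈ 0#
  A≉0 {e} (inj₁ (p , q)) rewrite A-forward p q  = w≉0 e
  A≉0 {e} (inj₂ (p , q)) rewrite A-backward p q = conj≉0 (w≉0 e)

  modulus-A : ∀ {e i j} → Joins e i j → modulus (A i j) R.≈ modulus (w e)
  modulus-A (inj₁ (p , q)) rewrite A-forward p q  = R.refl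
  modulus-A {e} (inj₂ (p , q)) rewrite A-backward p q = modulus-conj (w e)

  -- The contribution to Q of an edge from u to v of weight a.
  edgeForm : Fin n → Fin n → ℂ → Fin n → Row n
  edgeForm u v a i j = fromℝ (modulus a) * (δ u i * δ u j + δ v i * δ v j) + (a * (δ u i * δ v j) + conj a * (δ v i * δ u j))

  edgeForm-swap : ∀ u v a i j → edgeForm u v a i j ≈ edgeForm v u (conj a) i j
  edgeForm-swap u v a i j = +-cong
    (*-cong (fromℝ-cong (R.sym (modulus-conj a))) (+-comm _ _))
    (trans (+-comm _ _) (+-congˡ (*-congʳ (sym (conj-involutive a)))))

  -- The 2 × 2 block of the edge is the column (1 , conj p) times the row (|a| , a), where p is the
  -- phase of a: |a| conj p = conj a and conj p · a = |a|.
  edgeForm-rank1 : ∀ u v {a} → ¬ a ≈ 0# → ∀ i j →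
    edgeForm u v a i j ≈ (δ u i + conj (phase a) * δ v i) * (fromℝ (modulus a) * δ u j + a * δ v j)
  edgeForm-rank1 u v {a} a≉0 i j = sym (begin
    (ui + p̄ * vi) * (μ * uj + a * vj)
      ≈⟨ solve 7 (λ ui p̄ vi μ uj a vj → (ui :+ p̄ :* vi) :* (μ :* uj :+ a :* vj) :=
           μ :* (ui :* uj) :+ (p̄ :* a) :* (vi :* vj) :+ (a :* (ui :* vj) :+ (μ :* p̄) :* (vi :* uj))) refl ui p̄ vi μ uj a vj ⟩
    μ * (ui * uj) + (p̄ * a) * (vi * vj) + (a * (ui * vj) + (μ * p̄) * (vi * uj))
      ≈⟨ +-cong (+-congˡ (*-congʳ p̄a≈μ)) (+-congˡ (*-congʳ (modulus-conj-phase a≉0))) ⟩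
    μ * (ui * uj) + μ * (vi * vj) + (a * (ui * vj) + conj a * (vi * uj))
      ≈⟨ +-congʳ (sym (distribˡ μ _ _)) ⟩
    edgeForm u v a i j ∎)
    where
    ui vi uj vj μ p̄ : ℂ
    ui = δ u i
    vi = δ v i
    uj = δ u j
    vj = δ v j
    μ = fromℝ (modulus a)
    p̄ = conj (phase a)
    p̄a≈μ : p̄ * a ≈ μ
    p̄a≈μ = begin
      p̄ * a                ≈⟨ *-congˡ (modulus-phase a≉0) ⟨
      p̄ * (μ * phase a)    ≈⟨ solve 3 (λ p m q → p :* (m :* q) := m :* (q :* p)) refl p̄ μ (phase a) ⟩
      μ * (phase a * p̄)    ≈⟨ *-congˡ (phase-unit a≉0) ⟩
      μ * 1#               ≈⟨ *-identityʳ μ ⟩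
      μ                    ∎

  -- Q as a sum over the edges

  E : Fin m → Fin n → Row n
  E e = edgeForm (src e) (tgt e) (w e)

  E-joins : ∀ {e u v} → Joins e u v → ∀ i j → E e i j ≈ edgeForm u v (A u v) i j
  E-joins {e} (inj₁ (≡.refl , ≡.refl)) i j = reflexive (≡.cong (λ a → edgeForm (src e) (tgt e) a i j) (≡.sym (A-forward ≡.refl ≡.refl)))
  E-joins {e} (inj₂ (≡.refl , ≡.refl)) i j = trans (edgeForm-swap (src e) (tgt e) (w e) i j)
    (reflexive (≡.cong (λ a → edgeForm (tgt e) (src e) a i j) (≡.sym (A-backward ≡.refl ≡.refl))))

  -- The graph is simple, so at most one summand survives.
  sum-joins : ∀ {i j} (x : Fin n → Row n) → (∀ {i j} → (∀ e → ¬ Joins e i j) → x i j ≈ 0#) → x i j ≈ sum λ e → [ joins? e i j ] x i j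
  sum-joins {i} {j} x x≈0 with any? (λ e → joins? e i j)
  ... | yes (e , e-joins) = sym (trans (sum-single {m} e λ f f≢e →
          reflexive ([]-no (joins? f i j) (λ f-joins → f≢e (joins-unique f-joins e-joins)) (x i j)))
        (reflexive ([]-yes (joins? e i j) e-joins (x i j))))
  ... | no ∄ = trans (x≈0 λ e e-joins → ∄ (e , e-joins))
        (sym (sum-0 {m} λ e → reflexive ([]-no (joins? e i j) (λ e-joins → ∄ (e , e-joins)) (x i j))))

  δδ-0 : ∀ (s t : Fin n) {i j} → ¬ (s ≡ i × t ≡ j) → δ s i * δ t j ≈ 0#
  δδ-0 s t {i} {j} ¬p = go (s ≟ i)
    where
    go : Dec (s ≡ i) → δ s i * δ t j ≈ 0#
    go (no s≢i)  = trans (*-congʳ (δ-≢ s≢i)) (zeroˡ _)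
    go (yes s≡i) = trans (*-congˡ (δ-≢ λ t≡j → ¬p (s≡i , t≡j))) (zeroʳ _)

  δδ-1 : ∀ (s t : Fin n) → δ s s * δ t t ≈ 1#
  δδ-1 s t = trans (*-cong (δ-refl s) (δ-refl t)) (*-identityˡ 1#)

  at-joins : ∀ {e i j} a b x → (src e ≡ i → tgt e ≡ j → a ≈ x) → (src e ≡ j → tgt e ≡ i → b ≈ x) →
             a * (δ (src e) i * δ (tgt e) j) + b * (δ (tgt e) i * δ (src e) j) ≈ [ joins? e i j ] x
  at-joins {e} {i} {j} a b x a≈x b≈x = go (joins? e i j)
    where
    go : (d : Dec (Joins e i j)) → a * (δ (src e) i * δ (tgt e) j) + b * (δ (tgt e) i * δ (src e) j) ≈ [ d ] x
    go (yes (inj₁ (≡.refl , ≡.refl))) = trans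
      (+-cong (trans (*-congˡ (δδ-1 (src e) (tgt e))) (*-identityʳ a)) (trans (*-congˡ (δδ-0 (tgt e) (src e) λ (t≡s , _) → loopless e (≡.sym t≡s))) (zeroʳ b)))
      (trans (+-identityʳ a) (a≈x ≡.refl ≡.refl))
    go (yes (inj₂ (≡.refl , ≡.refl))) = trans
      (+-cong (trans (*-congˡ (δδ-0 (src e) (tgt e) λ (s≡t , _) → loopless e s≡t)) (zeroʳ a)) (trans (*-congˡ (δδ-1 (tgt e) (src e))) (*-identityʳ b)))
      (trans (+-identityˡ b) (b≈x ≡.refl ≡.refl))
    go (no ¬joins) = trans
      (+-cong (trans (*-congˡ (δδ-0 (src e) (tgt e) λ p → ¬joins (inj₁ p))) (zeroʳ a)) (trans (*-congˡ (δδ-0 (tgt e) (src e) λ (p , q) → ¬joins (inj₂ (q , p)))) (zeroʳ b)))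
      (+-identityˡ 0#)

  A-sum : ∀ i j → A i j ≈ sum λ e → w e * (δ (src e) i * δ (tgt e) j) + conj (w e) * (δ (tgt e) i * δ (src e) j)
  A-sum i j = trans (sum-joins A λ none → reflexive (A-none none)) (sum-cong-≋ {m} λ e →
    sym (at-joins (w e) (conj (w e)) (A i j) (λ p q → reflexive (≡.sym (A-forward p q))) (λ p q → reflexive (≡.sym (A-backward p q)))))

  μ : Fin m → ℂ
  μ e = fromℝ (modulus (w e))

  modulus-A-sum : ∀ i k → fromℝ (modulus (A i k)) ≈ sum λ e → μ e * (δ (src e) i * δ (tgt e) k) + μ e * (δ (tgt e) i * δ (src e) k)
  modulus-A-sum i k = trans
    (sum-joins (λ i k → fromℝ (modulus (A i k))) λ none → fromℝ-cong (R.trans (modulus-cong (reflexive (A-none none))) modulus-0))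
    (sum-cong-≋ {m} λ e → sym (at-joins (μ e) (μ e) _
      (λ p q → fromℝ-cong (R.sym (modulus-A (inj₁ (p , q))))) (λ p q → fromℝ-cong (R.sym (modulus-A (inj₂ (p , q)))))))

  degreePart : Fin m → Fin n → Row n
  degreePart e i j = μ e * (δ (src e) i * δ (src e) j + δ (tgt e) i * δ (tgt e) j)

  -- After exchanging the sums, each edge adds its modulus to the degree of both of its ends.
  degree-sum : ∀ i → (sum λ k → fromℝ (modulus (A i k))) ≈ sum λ e → degreePart e i i
  degree-sum i = begin
    (sum λ k → fromℝ (modulus (A i k)))   ≈⟨ sum-cong-≋ {n} (modulus-A-sum i) ⟩
    (sum λ k → sum λ e → T k e)           ≈⟨ ∑-comm T ⟩
    (sum λ e → sum λ k → T k e)           ≈⟨ sum-cong-≋ {m} collect ⟩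
    (sum λ e → degreePart e i i)          ∎
    where
    T : Fin n → Fin m → ℂ
    T k e = μ e * (δ (src e) i * δ (tgt e) k) + μ e * (δ (tgt e) i * δ (src e) k)
    δ-idem : ∀ (s : Fin n) → δ s i ≈ δ s i * δ s i
    δ-idem s with s ≟ i
    ... | yes _ = sym (*-identityˡ 1#)
    ... | no _  = sym (zeroˡ 0#)
    sum-δ-const : ∀ (s : Fin n) x → sum (λ k → δ s k * x) ≈ x
    sum-δ-const s x = sum-δ s λ _ → x
    collect : ∀ e → (sum λ k → T k e) ≈ degreePart e i i
    collect e = begin
      (sum λ k → T k e)
        ≈⟨ sum-cong-≋ {n} {λ k → T k e} {λ k → δ t k * x + δ s k * y} (λ k →
             solve 5 (λ m a b c d → m :* (a :* b) :+ m :* (c :* d) := b :* (m :* a) :+ d :* (m :* c)) refl (μ e) (δ s i) (δ t k) (δ t i) (δ s k)) ⟩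
      (sum λ k → δ t k * x + δ s k * y)
        ≈⟨ ∑-distrib-+ (λ k → δ t k * x) (λ k → δ s k * y) ⟩
      (sum λ k → δ t k * x) + (sum λ k → δ s k * y)
        ≈⟨ +-cong (sum-δ-const t x) (sum-δ-const s y) ⟩
      x + y
        ≈⟨ distribˡ (μ e) (δ s i) (δ t i) ⟨
      μ e * (δ s i + δ t i)
        ≈⟨ *-congˡ {μ e} (+-cong (δ-idem s) (δ-idem t)) ⟩
      degreePart e i i ∎
      where
      s t : Fin n
      s = src e
      t = tgt e
      x y : ℂ
      x = μ e * δ s i
      y = μ e * δ t i

  fromℝ-sum : ∀ {k} (t : Fin k → R.Carrier) → fromℝ (CommutativeMonoidSum.sum R.+-commutativeMonoid t) ≈ sum (fromℝ ∘ t)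
  fromℝ-sum {zero}  t = refl
  fromℝ-sum {suc k} t = trans (fromℝ-+ _ _) (+-congˡ (fromℝ-sum (t ∘ suc)))

  D-sum : ∀ i j → D i j ≈ sum λ e → degreePart e i j
  D-sum i j with i ≟ j
  ... | no i≢j = sym (sum-0 {m} λ e → trans (*-congˡ (trans
          (+-cong (δδ-0 (src e) (src e) λ (p , q) → i≢j (≡.trans (≡.sym p) q)) (δδ-0 (tgt e) (tgt e) λ (p , q) → i≢j (≡.trans (≡.sym p) q))) (+-identityˡ 0#))) (zeroʳ _))
  ... | yes ≡.refl = trans (trans (fromℝ-sum {n} _) (sum-cong-≋ {n} off-diagonal)) (degree-sum i)
    where
    -- `D` leaves out k = i, where A i i is zero because there are no loops; so the whole row may be
    -- summed.
    off-diagonal : ∀ k → fromℝ (if does (k ≟ i) then R.0# else modulus (A i k)) ≈ fromℝ (modulus (A i k))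
    off-diagonal k with k ≟ i
    ... | yes ≡.refl = fromℝ-cong (R.sym (R.trans (modulus-cong (reflexive (A-none λ e → joins-irrefl))) modulus-0))
    ... | no _ = refl

  Q-sum : ∀ i j → Q i j ≈ sum λ e → E e i j
  Q-sum i j = trans (+-cong (D-sum i j) (A-sum i j)) (sym (∑-distrib-+ (λ e → degreePart e i j) _))

  -- Expansion over maps from vertices to edges

  C B : Fin m → Row n
  C e i = δ (src e) i + conj (phase (w e)) * δ (tgt e) i
  B e j = fromℝ (modulus (w e)) * δ (src e) j + w e * δ (tgt e) j

  C-nonincident : ∀ {e i} → (∀ u → ¬ Joins e i u) → C e i ≈ 0#
  C-nonincident {e} none = trans
    (+-cong (δ-≢ λ s≡i → none _ (inj₁ (s≡i , ≡.refl))) (trans (*-congˡ (δ-≢ λ t≡i → none _ (inj₂ (≡.refl , t≡i)))) (zeroʳ _)))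
    (+-identityˡ 0#)

  -- Only the C side is masked. B is then common to all S, and the terms of a fixed f for different
  -- S differ just in their coefficient.
  restricted : Subset m → Fin m → Row n
  restricted S e i = [ e ∈? S ] C e i

  X : Subset m → ℂ
  X S = det λ i j → sum λ e → [ e ∈? S ] E e i j

  X-gram : ∀ S → X S ≈ det (gram (restricted S) B)
  X-gram S = det-cong λ i j → sum-cong-≋ {m} λ e → masked e (e ∈? S) i j
    where
    masked : ∀ e (d : Dec (e Subset.∈ S)) i j → [ d ] E e i j ≈ [ d ] C e i * B e j
    masked e (yes _) i j = edgeForm-rank1 (src e) (tgt e) (w≉0 e) i j
    masked e (no _)  i j = sym (zeroˡ _)

  term-of : (Fin m → Row n) → (Fin n → Fin m) → ℂ
  term-of C f = product (λ v → C (f v) v) * det (B ∘ f)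

  product-0 : ∀ {k} {t : Row k} i → t i ≈ 0# → product t ≈ 0#
  product-0 zero    t≈0 = trans (*-congʳ t≈0) (zeroˡ _)
  product-0 (suc i) t≈0 = trans (*-congˡ (product-0 i t≈0)) (zeroʳ _)

  term-0 : ∀ C f v → C (f v) v ≈ 0# → term-of C f ≈ 0#
  term-0 C f v Cv≈0 = trans (*-congʳ (product-0 {n} v Cv≈0)) (zeroˡ _)

  term-collision : ∀ C f {i j} → i ≢ j → f i ≡ f j → term-of C f ≈ 0#
  term-collision C f i≢j fi≡fj = trans (*-congˡ
    (Alternating.alternating det-alternating (B ∘ f) i≢j λ l → reflexive (≡.cong (λ e → B e l) fi≡fj))) (zeroʳ _)

  -- Allows an injective incident f into S to be assumed while proving X S ≈ 0. If X S were
  -- non-zero, each such f would contradict the assumption on it, every other f has a repeated row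
  -- or a zero coefficient, and the sum would be zero after all.
  X-vanishes : ∀ S → (∀ f → Injective _≡_ _≡_ f → (∀ v → f v Subset.∈ S) → (∀ v → ∃ (Joins (f v) v)) → X S ≈ 0#) → X S ≈ 0#
  X-vanishes S hyp = decidable-stable (X S ≟ℂ 0#) λ X≉0 → X≉0 (begin
    X S                                   ≈⟨ X-gram S ⟩
    det (gram (restricted S) B)           ≈⟨ det-gram (restricted S) B ⟩
    sumTuples (term-of (restricted S))    ≈⟨ sumTuples-cong (λ f → vanish X≉0 f) ⟩
    sumTuples (λ (_ : Fin n → Fin m) → 0#) ≈⟨ sumTuples-0 {n} {m} ⟩
    0#                                    ∎)
    where
    vanish : ¬ X S ≈ 0# → ∀ f → term-of (restricted S) f ≈ 0#
    vanish X≉0 f = cases (injective⊎collision f)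
      where
      injective : Injective _≡_ _≡_ f → Dec (∀ v → f v Subset.∈ S) → Dec (∀ v → ∃ (Joins (f v) v)) → term-of (restricted S) f ≈ 0#
      injective f-inj (yes f∈S) (yes incident) = contradiction (hyp f f-inj f∈S incident) X≉0
      injective f-inj (no ¬f∈S) _ = let v , fv∉ = ¬∀⟶∃¬ n _ (λ v → f v ∈? S) ¬f∈S in
        term-0 (restricted S) f v (reflexive ([]-no (f v ∈? S) fv∉ _))
      injective f-inj (yes f∈S) (no ¬incident) = let v , none = ¬∀⟶∃¬ n _ (λ v → any? λ u → joins? (f v) v u) ¬incident in
        term-0 (restricted S) f v (trans (reflexive ([]-yes (f v ∈? S) (f∈S v) _)) (C-nonincident λ u p → none (u , p)))

      cases : Injective _≡_ _≡_ f ⊎ (∃ λ i → ∃ λ j → i ≢ j × f i ≡ f j) → term-of (restricted S) f ≈ 0#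
      cases (inj₁ f-inj) = injective f-inj (all? λ v → f v ∈? S) (all? λ v → any? λ u → joins? (f v) v u)
      cases (inj₂ (_ , _ , i≢j , fi≡fj)) = term-collision (restricted S) f i≢j fi≡fj

  listSum-sumTuples : ∀ {a} {T : Set a} (h : T → (Fin n → Fin m) → ℂ) xs →
    listSum (map (sumTuples ∘ h) xs) ≈ sumTuples λ f → listSum (map (λ x → h x f) xs)
  listSum-sumTuples h []       = sym (sumTuples-0 {n} {m})
  listSum-sumTuples h (x ∷ xs) = trans (+-congˡ (listSum-sumTuples h xs)) (sym (sumTuples-+ (h x) _))

  det-Q-expansion : det Q ≈ listSum (map (λ S → [ ∣ S ∣ ℕ.≟ n ] X S) (allSubsets m))
  det-Q-expansion = begin
    det Q
      ≈⟨ det-cong (λ i j → trans (Q-sum i j) (sum-cong-≋ {m} λ e → edgeForm-rank1 (src e) (tgt e) (w≉0 e) i j)) ⟩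
    det (gram C B)
      ≈⟨ det-gram C B ⟩
    sumTuples (term-of C)
      ≈⟨ sumTuples-cong by-image ⟩
    sumTuples (λ f → listSum (map (λ S → [ ∣ S ∣ ℕ.≟ n ] term-of (restricted S) f) (allSubsets m)))
      ≈⟨ listSum-sumTuples (λ S f → [ ∣ S ∣ ℕ.≟ n ] term-of (restricted S) f) (allSubsets m) ⟨
    listSum (map (λ S → sumTuples λ f → [ ∣ S ∣ ℕ.≟ n ] term-of (restricted S) f) (allSubsets m))
      ≈⟨ listSum-map-cong (allSubsets m) (λ {S} _ → collect S (∣ S ∣ ℕ.≟ n)) ⟩
    listSum (map (λ S → [ ∣ S ∣ ℕ.≟ n ] X S) (allSubsets m)) ∎
    where
    collect : ∀ S (d : Dec (∣ S ∣ ≡ n)) → sumTuples (λ f → [ d ] term-of (restricted S) f) ≈ [ d ] X S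
    collect S (yes _) = sym (trans (X-gram S) (det-gram (restricted S) B))
    collect S (no _)  = sumTuples-0 {n} {m}

    -- A summand vanishes unless f maps into S, and the only set of n edges that receives an
    -- injective f is its image. For other f, two rows of B agree and both sides are zero.
    by-image : ∀ f → term-of C f ≈ listSum (map (λ S → [ ∣ S ∣ ℕ.≟ n ] term-of (restricted S) f) (allSubsets m))
    by-image f = cases (injective⊎collision f)
      where
      F : ℂ
      F = listSum (map (λ S → [ ∣ S ∣ ℕ.≟ n ] term-of (restricted S) f) (allSubsets m))

      collision : ∀ {i j} → i ≢ j → f i ≡ f j → term-of C f ≈ F
      collision i≢j fi≡fj = trans (term-collision C f i≢j fi≡fj) (sym (listSum-0 (allSubsets m) λ {S} _ → each S (∣ S ∣ ℕ.≟ n)))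
        where
        each : ∀ S (d : Dec (∣ S ∣ ≡ n)) → [ d ] term-of (restricted S) f ≈ 0#
        each S (yes _) = term-collision (restricted S) f i≢j fi≡fj
        each S (no _)  = refl

      injective : Injective _≡_ _≡_ f → term-of C f ≈ F
      injective f-inj = sym (begin
        F
          ≈⟨ sum-over-subsets m I _ (λ S S≢ → others S (∣ S ∣ ℕ.≟ n) (all? λ v → f v ∈? S) S≢) ⟩
        [ ∣ I ∣ ℕ.≟ n ] term-of (restricted I) f
          ≡⟨ []-yes (∣ I ∣ ℕ.≟ n) (∣image∣≡n f f-inj) _ ⟩
        term-of (restricted I) f
          ≈⟨ *-congʳ (product-cong {n} λ v → reflexive ([]-yes (f v ∈? I) (∈-image⁺ f f-inj v) _)) ⟩
        term-of C f ∎)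
        where
        I : Subset m
        I = image f f-inj
        others : ∀ S (d : Dec (∣ S ∣ ≡ n)) → Dec (∀ v → f v Subset.∈ S) → S ≢ I → [ d ] term-of (restricted S) f ≈ 0#
        others S (no _)      _          _  = refl
        others S (yes ∣S∣≡n) (yes f∈S)  S≢ = contradiction (image-unique f f-inj ∣S∣≡n f∈S) S≢
        others S (yes _)     (no ¬f∈S)  _  = let v , fv∉ = ¬∀⟶∃¬ n _ (λ v → f v ∈? S) ¬f∈S in
          term-0 (restricted S) f v (reflexive ([]-no (f v ∈? S) fv∉ _))

      cases : Injective _≡_ _≡_ f ⊎ (∃ λ i → ∃ λ j → i ≢ j × f i ≡ f j) → term-of C f ≈ F
      cases (inj₁ f-inj) = injective f-inj
      cases (inj₂ (_ , _ , i≢j , fi≡fj)) = collision i≢j fi≡fj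

-- Evaluation on a spanning subgraph

x∈p─q⇒x∉q : ∀ {k} (p q : Subset k) {x} → x Subset.∈ p Subset.─ q → x Subset.∉ q
x∈p─q⇒x∉q (_ Vec.∷ p) (outside Vec.∷ q) (Vec.there x∈) (Vec.there x∈q) = x∈p─q⇒x∉q p q x∈ x∈q
x∈p─q⇒x∉q (_ Vec.∷ p) (inside  Vec.∷ q) (Vec.there x∈) (Vec.there x∈q) = x∈p─q⇒x∉q p q x∈ x∈q

arcs-map : ∀ {a b} {A : Set a} {B : Set b} (h : A → A → B) {g : A → A} {x} xs {z} →
           All (λ (u , v) → g u ≡ v) (arcs x xs z) → map (uncurry h) (arcs x xs z) ≡ map (λ u → h u (g u)) (x ∷ xs)
arcs-map h []       (≡.refl ∷ [])    = ≡.refl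
arcs-map h (y ∷ ys) (≡.refl ∷ along) = ≡.cong (_ ∷_) (arcs-map h ys along)

module Evaluation {ℓ} (ℝ : Reals ℓ) {n m} (G : OrientedGraph n m) (w : Fin m → Complex.ℂ ℝ)
  (w≉0 : ∀ e → ¬ RawRing._≈_ (Complex.ℂ-rawRing ℝ) (w e) (RawRing.0# (Complex.ℂ-rawRing ℝ))) where

  open Complex ℝ
  open ComplexProperties ℝ
  open OrientedGraph G
  open Graph G
  open Weighted ℝ G w
  open Components G
  open CommutativeRing ℂ-commutativeRing hiding (zero)
  open RingProperties ring using (-‿distribˡ-*; -‿involutive)
  open RowForms ℂ-commutativeRing hiding (sum-0)
  open Elimination ℂ-commutativeRing
  open Expansion ℝ G w w≉0
  module ∑ = Indicator +-commutativeMonoid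
  module ∏ = Indicator R.*-commutativeMonoid
  module ∏ᶠ = CommutativeMonoidSum R.*-commutativeMonoid

  -- The `factor` of a component as a function of a listed cycle instead of a proof of unicyclicity,
  -- so that it can be taken at any cycle.
  component-factor : Subset m → Fin n × Fin n × List (Fin n) → R.Carrier
  component-factor S (b , r , rs) =
    (R.1# R.+ R.1#) R.* modulus (Weighted.W ℝ G w (edges (component (spanning S) b) Subset.─ cycleEdges (r ∷ rs))) R.* α (r ∷ rs)

  modulus-W : ∀ F → modulus (W F) R.≈ ∏ᶠ.sum λ e → ∏.[ e ∈? F ] modulus (w e)
  modulus-W F = R.trans (modulus-product {m} λ e → if does (e ∈? F) then w e else 1#) (∏ᶠ.sum-cong-≋ {m} λ e → masked e (e ∈? F))
    where
    modulus-product : ∀ {k} (t : Row k) → modulus (product t) R.≈ ∏ᶠ.sum (modulus ∘ t)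
    modulus-product {zero}  t = modulus-1
    modulus-product {suc k} t = R.trans (modulus-* _ _) (R.*-congˡ (modulus-product (t ∘ suc)))
    masked : ∀ e (d : Dec (e Subset.∈ F)) → modulus (if does d then w e else 1#) R.≈ ∏.[ d ] modulus (w e)
    masked e (yes _) = R.refl
    masked e (no _)  = modulus-1

  product-fromℝ : ∀ {k} (t : Fin k → R.Carrier) → product (fromℝ ∘ t) ≈ fromℝ (∏ᶠ.sum t)
  product-fromℝ {zero}  t = refl
  product-fromℝ {suc k} t = trans (*-congˡ (product-fromℝ (t ∘ suc))) (sym (fromℝ-* _ _))

  module _ (S : Subset m) (∣S∣≡n : ∣ S ∣ ≡ n) (𝒞 : List (Fin n × Fin n × List (Fin n)))
           (bases : map proj₁ 𝒞 ≡ leastVertices S) (cycles : All (Anchored S) 𝒞) where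

    open Orientation (orientation S 𝒞 bases cycles)

    private
      a : Fin n → ℂ
      a x = A x (g x)

      a≉0 : ∀ x → ¬ a x ≈ 0#
      a≉0 x = A≉0 (joins x)

      t t̄ d : Row n
      -- `twist` subtracts; with this sign its row is δ x + phase (a x) δ (g x).
      t x = - phase (a x)
      t̄ x = - conj (phase (a x))
      d x = fromℝ (modulus (a x))

      onto : ∀ {e} → e Subset.∈ S → ∃ λ x → f x ≡ e
      onto = image-onto f f-inj ∣S∣≡n f∈S

      scaled : Fin n → Row n
      scaled x j = d x * twist t g x j

      -- The edge f x may point either way; `E-joins` reads it as leaving x for g x with weight a x,
      -- before it is factored.
      rank1 : ∀ x i j → E (f x) i j ≈ twist t̄ g x i * scaled x j
      rank1 x i j = trans (E-joins (joins x) i j) (trans (edgeForm-rank1 x (g x) (a≉0 x) i j) (*-cong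
        (+-congˡ {δ x i} (trans (*-congʳ (sym (-‿involutive (conj (phase (a x)))))) (sym (-‿distribˡ-* (t̄ x) (δ (g x) i)))))
        (trans (+-congˡ {d x * δ x j} (trans (*-congʳ (sym (modulus-phase (a≉0 x)))) (trans (*-assoc (d x) (phase (a x)) (δ (g x) j))
          (*-congˡ (trans (*-congʳ (sym (-‿involutive (phase (a x))))) (sym (-‿distribˡ-* (t x) (δ (g x) j))))))))
          (sym (distribˡ (d x) (δ x j) (- (t x * δ (g x) j)))))))

      X-oriented : X S ≈ det (gram (twist t̄ g) scaled)
      X-oriented = det-cong λ i j → trans
        (∑.sum-over-image f f-inj (λ e → E e i j) (_∈? S) onto f∈S)
        (sum-cong-≋ {n} λ x → rank1 x i j)

      𝒟 : List (Fin n × List (Fin n))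
      𝒟 = map proj₂ 𝒞

      roots≡ : map (proj₁ ∘ proj₂) 𝒞 ≡ map proj₁ 𝒟
      roots≡ = List.map-∘ 𝒞

      rooted : All (λ (r , rs) → All (λ (x , y) → g x ≡ y) (arcs r rs r) × All (_≢ r) rs) 𝒟
      rooted = All.map⁺ (All.zipWith (λ (along , cyc) → along , distinct-head cyc) (along , cycles))
        where
        distinct-head : ∀ {U r rs} → IsCycle U (r ∷ rs) → All (_≢ r) rs
        distinct-head cyc with r∉ ∷ _ ← IsCycle.distinct cyc = All.map (λ r≢x x≡r → r≢x (≡.sym x≡r)) r∉

      untwisted : ∀ {F} → RowForm F → ∀ s →
        F (twist s g) ≈ listProduct (map (λ (r , rs) → 1# - listProduct (map s (r ∷ rs))) 𝒟) * F δ
      untwisted form s = untwist form g 𝒟 s ρ rooted (AllPairs.map⁺ disjoint)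
        (λ u → ≡.subst (λ rs → u ∈ rs ⊎ ρ (g u) ℕ.< ρ u) roots≡ (descend u))

      κ κ̄ : ℂ
      κ = listProduct (map (λ (r , rs) → 1# - listProduct (map t (r ∷ rs))) 𝒟)
      κ̄ = listProduct (map (λ (r , rs) → 1# - listProduct (map t̄ (r ∷ rs))) 𝒟)

      X-factored : X S ≈ κ̄ * (product d * κ)
      X-factored = begin
        X S                                 ≈⟨ X-oriented ⟩
        det (gram (twist t̄ g) scaled)       ≈⟨ untwisted (gram-rowFormˡ scaled) t̄ ⟩
        κ̄ * det (gram δ scaled)             ≈⟨ *-congˡ (gram-δ scaled) ⟩
        κ̄ * det scaled                      ≈⟨ *-congˡ (det-scale d (twist t g)) ⟩
        κ̄ * (product d * det (twist t g))   ≈⟨ *-congˡ (*-congˡ (untwisted (alternating⇒rowForm det-alternating) t)) ⟩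
        κ̄ * (product d * (κ * det (δ {n}))) ≈⟨ *-congˡ (*-congˡ (trans (*-congˡ (det-δ {n})) (*-identityʳ κ))) ⟩
        κ̄ * (product d * κ)                 ∎
        where open SetoidReasoning setoid

      x : Fin m → R.Carrier
      x e = modulus (w e)

      cycle-moduli : List (Fin n) → R.Carrier
      cycle-moduli γ = listProductℝ (map modulus (map a γ))

      outside-cycle : Fin n × Fin n × List (Fin n) → R.Carrier
      outside-cycle (b , r , rs) = modulus (W (edges (component (spanning S) b) Subset.─ cycleEdges (r ∷ rs)))

      module _ {b r rs} (cyc : Anchored S (b , r , rs)) (along : All (λ (u , v) → g u ≡ v) (arcs r rs r)) where

        private
          joins-step? : ∀ e → Dec (Any (uncurry (Joins e)) (steps (closeUp (r ∷ rs))))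
          joins-step? e = Any.any? (uncurry (joins? e)) (steps (closeUp (r ∷ rs)))

        ∈-cycleEdges⁺ : ∀ {u} → u ∈ r ∷ rs → f u Subset.∈ cycleEdges (r ∷ rs)
        ∈-cycleEdges⁺ {u} u∈ with v , uv∈ ← arcs-successor rs {z = r} u∈ = ∈-tabulate⁺ joins-step?
          (≡.subst (Any (uncurry (Joins (f u)))) (≡.sym (steps-arcs r rs r))
            (lose uv∈ (≡.subst (Joins (f u) u) (All.lookup along uv∈) (joins u))))

        ∈-cycleEdges⁻ : ∀ {e} → e Subset.∈ cycleEdges (r ∷ rs) → ∃ λ u → u ∈ r ∷ rs × f u ≡ e
        ∈-cycleEdges⁻ {e} e∈
          with (u , v) , uv∈ , e-joins ← find (≡.subst (Any (uncurry (Joins e))) (steps-arcs r rs r) (∈-tabulate⁻ joins-step? e∈))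
          = u , arcs-source rs uv∈ , joins-unique (≡.subst (Joins (f u) u) (All.lookup along uv∈) (joins u)) e-joins

        cycleEdges⊆ : cycleEdges (r ∷ rs) Subset.⊆ edges (component (spanning S) b)
        cycleEdges⊆ e∈ with u , u∈ , ≡.refl ← ∈-cycleEdges⁻ e∈ = ∈-component⁺ S {b} (f∈S u) (v⇝src (joins u))
          where
          b⇝u : Reaches S b u
          b⇝u = anchored-reaches S cyc u∈
          v⇝src : Joins (f u) u (g u) → Reaches S b (src (f u))
          v⇝src (inj₁ (s≡u , _)) = ≡.subst (Reaches S b) (≡.sym s≡u) b⇝u
          v⇝src (inj₂ (s≡gu , _)) = ≡.subst (Reaches S b) (≡.sym s≡gu) (b⇝u ◅◅ (f u , f∈S u , joins u) ◅ ε)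

        cycleEdges-product : ∏ᶠ.sum (λ e → ∏.[ e ∈? cycleEdges (r ∷ rs) ] x e) R.≈ cycle-moduli (r ∷ rs)
        cycleEdges-product = R.trans
          (∏.sum-over-list x (Unique.map⁺ f-inj (IsCycle.distinct cyc)) (_∈? cycleEdges (r ∷ rs))
            (λ e∈ → let u , u∈ , fu≡e = ∈-cycleEdges⁻ e∈ in ≡.subst (_∈ map f (r ∷ rs)) fu≡e (∈-map⁺ f u∈))
            (λ e∈ → let u , u∈ , e≡fu = ∈-map⁻ f e∈ in ≡.subst (Subset._∈ cycleEdges (r ∷ rs)) (≡.sym e≡fu) (∈-cycleEdges⁺ u∈)))
          (R.trans (R.reflexive (≡.cong listProductℝ (≡.sym (List.map-∘ (r ∷ rs)))))
          (R.trans (∏.listSum-map-cong (r ∷ rs) (λ {u} _ → R.sym (modulus-A (joins u))))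
            (R.reflexive (≡.cong listProductℝ (List.map-∘ (r ∷ rs))))))

        -- The edges off the cycle give the modulus of `W`; those on it are the images under f of
        -- the cycle's vertices.
        component-product : ∏ᶠ.sum (λ e → ∏.[ e ∈? edges (component (spanning S) b) ] x e) R.≈
                            outside-cycle (b , r , rs) R.* cycle-moduli (r ∷ rs)
        component-product = R.trans (∏ᶠ.sum-cong-≋ {m} λ e → split e (e ∈? cycleEdges (r ∷ rs)))
          (R.trans (∏ᶠ.∑-distrib-+ (λ e → ∏.[ e ∈? U─C ] x e) (λ e → ∏.[ e ∈? cycleEdges (r ∷ rs) ] x e))
            (R.*-cong (R.sym (modulus-W U─C)) cycleEdges-product))
          where
          U U─C : Subset m
          U   = edges (component (spanning S) b)
          U─C = U Subset.─ cycleEdges (r ∷ rs)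
          split : ∀ e (c : Dec (e Subset.∈ cycleEdges (r ∷ rs))) → ∏.[ e ∈? U ] x e R.≈ (∏.[ e ∈? U─C ] x e) R.* (∏.[ c ] x e)
          split e (yes e∈C) = R.trans (R.reflexive (∏.[]-yes (e ∈? U) (cycleEdges⊆ e∈C) (x e)))
            (R.sym (R.trans (R.*-congʳ (R.reflexive (∏.[]-no (e ∈? U─C) (λ e∈ → x∈p─q⇒x∉q U _ e∈ e∈C) (x e)))) (R.*-identityˡ (x e))))
          split e (no e∉C) = R.trans (R.reflexive (∏.[]-⇔ (e ∈? U) (e ∈? U─C) (λ e∈ → x∈p∧x∉q⇒x∈p─q e∈ e∉C) (p─q⊆p U _) (x e)))
            (R.sym (R.*-identityʳ _))

        -- The moduli on the cycle combine with the two conjugate elimination factors into 2 α, by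
        -- `cycle-factor`; the moduli off the cycle pass through.
        component-value : fromℝ (outside-cycle (b , r , rs) R.* cycle-moduli (r ∷ rs)) *
          ((1# - listProduct (map t (r ∷ rs))) * (1# - listProduct (map t̄ (r ∷ rs)))) ≈ fromℝ (component-factor S (b , r , rs))
        component-value = begin
          fromℝ (o R.* P) * ((1# - listProduct (map t (r ∷ rs))) * (1# - listProduct (map t̄ (r ∷ rs))))
            ≈⟨ *-cong (fromℝ-* o P) (*-cong (+-congˡ (-‿cong (reflexive τ≡))) (+-congˡ (-‿cong (τ̄≈ (r ∷ rs))))) ⟩
          fromℝ o * fromℝ P * ((1# - negPhases zs) * (1# - conj (negPhases zs)))
            ≈⟨ *-assoc (fromℝ o) (fromℝ P) _ ⟩
          fromℝ o * (fromℝ P * ((1# - negPhases zs) * (1# - conj (negPhases zs))))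
            ≈⟨ *-congˡ {fromℝ o} (cycle-factor (All.map⁺ (All.universal a≉0 (r ∷ rs)))) ⟩
          fromℝ o * fromℝ (two R.* α′ (length zs) (listProductℂ zs))
            ≈⟨ fromℝ-* o _ ⟨
          fromℝ (o R.* (two R.* α′ (length zs) (listProductℂ zs)))
            ≈⟨ fromℝ-cong (R.trans (R.*-congˡ (R.*-congˡ (R.reflexive (≡.cong₂ α′ (List.length-map a (r ∷ rs)) zs-wt)))) (rearrange o (α (r ∷ rs)))) ⟩
          fromℝ (component-factor S (b , r , rs)) ∎
          where
          open SetoidReasoning setoid
          o P two : R.Carrier
          o = outside-cycle (b , r , rs)
          P = cycle-moduli (r ∷ rs)
          two = R.1# R.+ R.1#
          zs : List ℂ
          zs = map a (r ∷ rs)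
          α′ : ℕ → ℂ → R.Carrier
          α′ k z = if does (2 ∣? k) then modulus z R.- re z else modulus z R.+ re z
          rearrange : ∀ o y → o R.* (two R.* y) R.≈ two R.* o R.* y
          rearrange o y = R.trans (R.sym (R.*-assoc o two y)) (R.*-congʳ (R.*-comm o two))
          zs-wt : listProductℂ zs ≡ wtCycle (r ∷ rs)
          zs-wt = ≡.cong listProductℂ (≡.sym (≡.trans (≡.cong (map (uncurry A)) (steps-arcs r rs r)) (arcs-map A rs along)))
          τ≡ : listProduct (map t (r ∷ rs)) ≡ negPhases zs
          τ≡ = ≡.cong listProductℂ (List.map-∘ (r ∷ rs))
          τ̄≈ : ∀ us → listProduct (map t̄ us) ≈ conj (negPhases (map a us))
          τ̄≈ []       = sym (conj-fromℝ R.1#)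
          τ̄≈ (u ∷ us) = trans (*-congˡ {t̄ u} (τ̄≈ us)) (sym (conj-* (t u) (negPhases (map a us))))

      -- The product over vertices becomes one over S through the bijection f, and each edge of S
      -- lies in the component of exactly one least vertex.
      modulus-total : ∏ᶠ.sum (modulus ∘ a) R.≈ listProductℝ (map (λ (b , _) → ∏ᶠ.sum (λ e → ∏.[ e ∈? edges (component (spanning S) b) ] x e)) 𝒞)
      modulus-total = R.trans (∏ᶠ.sum-cong-≋ {n} λ v → modulus-A (joins v))
        (R.trans (R.sym (∏.sum-over-image f f-inj x (_∈? S) onto f∈S))
        (R.trans (∏ᶠ.sum-cong-≋ {m} λ e → by-component e (e ∈? S))
        (R.trans (R.sym (∏.listSum-sum (λ b e → ∏.[ e ∈? edges (component (spanning S) b) ] x e) (leastVertices S)))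
          (R.reflexive (≡.cong listProductℝ (≡.trans (≡.cong (map _) (≡.sym bases)) (≡.sym (List.map-∘ 𝒞))))))))
        where
        by-component : ∀ e (d : Dec (e Subset.∈ S)) → ∏.[ d ] x e R.≈
                       listProductℝ (map (λ b → ∏.[ e ∈? edges (component (spanning S) b) ] x e) (leastVertices S))
        by-component e (no e∉S) = R.sym (∏.listSum-0 (leastVertices S) λ {b} _ →
          R.reflexive (∏.[]-no (e ∈? edges (component (spanning S) b)) (λ e∈ → e∉S (proj₁ (∈-component⁻ S {b} e∈))) (x e)))
        by-component e (yes e∈S) with b , b∈ , b⇝e ← leastVertex S (src e) = R.sym (R.trans
          (∏.listSum-single (leastVertices-unique S) b∈ λ {c} c∈ c≢b →
            R.reflexive (∏.[]-no (e ∈? edges (component (spanning S) c))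
              (λ e∈ → c≢b (leastVertices-separated S c∈ b∈ (proj₂ (∈-component⁻ S {c} e∈) ◅◅ reaches-sym S b⇝e))) (x e)))
          (R.reflexive (∏.[]-yes (e ∈? edges (component (spanning S) b)) (∈-component⁺ S {b} e∈S b⇝e) (x e))))

      -- Stated for an arbitrary list of cycles, since the condition that the bases are all the
      -- least vertices does not pass to tails.
      combine : ∀ 𝒞 → All (Anchored S) 𝒞 → All (λ (_ , r , rs) → All (λ (u , v) → g u ≡ v) (arcs r rs r)) 𝒞 →
        listProduct (map (λ (r , rs) → 1# - listProduct (map t̄ (r ∷ rs))) (map proj₂ 𝒞)) *
          (fromℝ (listProductℝ (map (λ (b , _) → ∏ᶠ.sum (λ e → ∏.[ e ∈? edges (component (spanning S) b) ] x e)) 𝒞)) *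
           listProduct (map (λ (r , rs) → 1# - listProduct (map t (r ∷ rs))) (map proj₂ 𝒞)))
        ≈ fromℝ (listProductℝ (map (component-factor S) 𝒞))
      combine [] [] [] = trans (*-identityˡ _) (*-identityʳ _)
      combine ((b , r , rs) ∷ 𝒞) (cyc ∷ cycles) (along ∷ alongs) = begin
        (k̄ * K̄) * (fromℝ (e R.* O) * (k * K))
          ≈⟨ *-congˡ {k̄ * K̄} (*-congʳ {k * K} (fromℝ-* e O)) ⟩
        (k̄ * K̄) * (fromℝ e * fromℝ O * (k * K))
          ≈⟨ solve 6 (λ k̄ K̄ e O k K → (k̄ :* K̄) :* (e :* O :* (k :* K)) := (e :* (k :* k̄)) :* (K̄ :* (O :* K))) refl k̄ K̄ (fromℝ e) (fromℝ O) k K ⟩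
        (fromℝ e * (k * k̄)) * (K̄ * (fromℝ O * K))
          ≈⟨ *-cong (trans (*-congʳ {k * k̄} (fromℝ-cong (component-product {b} {r} {rs} cyc along))) (component-value {b} {r} {rs} cyc along)) (combine 𝒞 cycles alongs) ⟩
        fromℝ (component-factor S (b , r , rs)) * fromℝ (listProductℝ (map (component-factor S) 𝒞))
          ≈⟨ fromℝ-* _ _ ⟨
        fromℝ (listProductℝ (map (component-factor S) ((b , r , rs) ∷ 𝒞))) ∎
        where
        open SetoidReasoning setoid
        open DifferenceSolver ℂ-commutativeRing using (solve; _:=_; _:*_)
        k k̄ K K̄ : ℂ
        k = 1# - listProduct (map t (r ∷ rs))
        k̄ = 1# - listProduct (map t̄ (r ∷ rs))
        K = listProduct (map (λ (r , rs) → 1# - listProduct (map t (r ∷ rs))) (map proj₂ 𝒞))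
        K̄ = listProduct (map (λ (r , rs) → 1# - listProduct (map t̄ (r ∷ rs))) (map proj₂ 𝒞))
        e O : R.Carrier
        e = ∏ᶠ.sum (λ e → ∏.[ e ∈? edges (component (spanning S) b) ] x e)
        O = listProductℝ (map (λ (b , _) → ∏ᶠ.sum (λ e → ∏.[ e ∈? edges (component (spanning S) b) ] x e)) 𝒞)

    X-value : X S ≈ fromℝ (listProductℝ (map (component-factor S) 𝒞))
    X-value = trans X-factored (trans
      (*-congˡ {κ̄} (*-congʳ {κ} (trans (product-fromℝ (modulus ∘ a)) (fromℝ-cong modulus-total))))
      (combine 𝒞 cycles along))

-- Comparison with the sum over 𝒰(G)

module Assembly {ℓ} (ℝ : Reals ℓ) {n m} (G : OrientedGraph n m) (w : Fin m → Complex.ℂ ℝ)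
  (w≉0 : ∀ e → ¬ RawRing._≈_ (Complex.ℂ-rawRing ℝ) (w e) (RawRing.0# (Complex.ℂ-rawRing ℝ))) where

  open Complex ℝ
  open ComplexProperties ℝ
  open Graph G
  open Weighted ℝ G w
  open Components G
  open CommutativeRing ℂ-commutativeRing hiding (zero)
  open RowForms ℂ-commutativeRing using (det)
  open Expansion ℝ G w w≉0
  open Evaluation ℝ G w w≉0
  open DifferenceSolver R.commutativeRing using (solve; _:=_; _:+_; _:*_; :-_; :0)

  modulus-real : ∀ {z} x → R.0# R.≤ x → x R.* x R.≈ re z R.* re z → im z R.≈ R.0# → modulus z R.≈ x
  modulus-real {z} x 0≤x x² im≈0 = modulus-unique 0≤x (R.trans x²
    (R.trans (solve 1 (λ a → a := a :+ :0 :* :0) R.refl (re z R.* re z)) (R.+-congˡ (R.sym (R.*-cong im≈0 im≈0)))))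

  -- An even inadmissible cycle has positive real weight, so |wt| = Re wt; an odd one has negative
  -- real weight, so |wt| = - Re wt.
  inadmissible⇒α≈0 : ∀ {γ} → ¬ Admissible γ → α γ R.≈ R.0#
  inadmissible⇒α≈0 {γ} ¬adm = go (isEven? γ) ¬adm
    where
    z : ℂ
    z = wtCycle γ
    go : (d : Dec (IsEven γ)) → ¬ ((¬ IsEven γ → ¬ ℝ⁻ z) × (IsEven γ → ¬ ℝ⁺ z)) →
         (if does d then modulus z R.- re z else modulus z R.+ re z) R.≈ R.0#
    go (yes even) ¬adm with ℝ⁺? z
    ... | no ¬pos = contradiction ((λ odd → contradiction even odd) , λ _ → ¬pos) ¬adm
    ... | yes ((0≤re , _) , im≈0) = R.trans (R.+-congʳ (modulus-real (re z) 0≤re R.refl im≈0)) (R.-‿inverseʳ (re z))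
    go (no odd) ¬adm with ℝ⁻? z
    ... | no ¬neg = contradiction ((λ _ → ¬neg) , λ even → contradiction even odd) ¬adm
    ... | yes ((re≤0 , _) , im≈0) = R.trans (R.+-congʳ (modulus-real (R.- re z) (R.≤0⇒0≤- re≤0)
            (solve 1 (λ a → :- a :* :- a := a :* a) R.refl (re z)) im≈0)) (R.-‿inverseˡ (re z))

  listProduct-0 : ∀ {a} {T : Set a} (h : T → R.Carrier) {xs x} → x ∈ xs → h x R.≈ R.0# → listProductℝ (map h xs) R.≈ R.0#
  listProduct-0 h (here ≡.refl) hx≈0 = R.trans (R.*-congʳ hx≈0) (R.zeroˡ _)
  listProduct-0 h (there x∈)    hx≈0 = R.trans (R.*-congˡ (listProduct-0 h x∈ hx≈0)) (R.zeroʳ _)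

  -- Takes exactly the cycles stored in the proofs, so that the resulting factors are literally
  -- those of `term`.
  unicyclics⇒cycles : ∀ S L (us : All Unicyclic (map (component (spanning S)) L)) →
    ∃ λ 𝒞 → map proj₁ 𝒞 ≡ L × All (Anchored S) 𝒞 × map (component-factor S) 𝒞 ≡ All.reduce factor us
  unicyclics⇒cycles S []      [] = [] , ≡.refl , [] , ≡.refl
  unicyclics⇒cycles S (b ∷ L) (record { cycle = [] ; isCycle = cyc } ∷ us) with () ← IsCycle.length≥3 cyc
  unicyclics⇒cycles S (b ∷ L) (record { cycle = r ∷ rs ; isCycle = cyc } ∷ us) =
    let 𝒞 , bases , cycles , factors = unicyclics⇒cycles S L us in
    (b , r , rs) ∷ 𝒞 , ≡.cong (b ∷_) bases , cyc ∷ cycles , ≡.cong (component-factor S (b , r , rs) ∷_) factors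

  X-term : ∀ S → ∣ S ∣ ≡ n → (p : In𝒰 (spanning S)) → X S ≈ fromℝ (term p)
  X-term S ∣S∣≡n p = let 𝒞 , bases , cycles , factors = unicyclics⇒cycles S (leastVertices S) (In𝒰.unicyclic p) in
    trans (X-value S ∣S∣≡n 𝒞 bases cycles) (reflexive (≡.cong (fromℝ ∘ listProductℝ) factors))

  module _ (S : Subset m) (∣S∣≡n : ∣ S ∣ ≡ n) (unicyclic : ∀ b → Unicyclic (component (spanning S) b)) where

    X-inadmissible : ∀ {b} → b ∈ leastVertices S → ∀ γ → IsCycle (component (spanning S) b) γ → ¬ Admissible γ → X S ≈ 0#
    X-inadmissible {b} b∈ []       cyc ¬adm with () ← IsCycle.length≥3 cyc
    X-inadmissible {b} b∈ (r ∷ rs) cyc ¬adm = trans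
      (X-value S ∣S∣≡n (map anchor (leastVertices S)) (≡.trans (≡.sym (List.map-∘ (leastVertices S))) (List.map-id (leastVertices S)))
        (All.map⁺ (All.universal (λ c → proj₂ (choose c (c ≟ b))) (leastVertices S))))
      (fromℝ-cong (listProduct-0 (component-factor S) (∈-map⁺ anchor b∈) (factor-0 (b ≟ b))))
      where
      -- Keeps the inadmissible cycle at b and falls back on unicyclicity in the other components.
      -- The decision is an argument, so that `factor-0` can analyse it at b.
      choose : ∀ c → Dec (c ≡ b) → ∃ λ (r , rs) → Anchored S (c , r , rs)
      choose c (yes ≡.refl) = (r , rs) , cyc
      choose c (no _) with unicyclic c
      ... | record { cycle = [] ; isCycle = cyc } with () ← IsCycle.length≥3 cyc
      choose c (no _) | record { cycle = s ∷ ss ; isCycle = cyc } = (s , ss) , cyc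
      anchor : Fin n → Fin n × Fin n × List (Fin n)
      anchor c = c , proj₁ (choose c (c ≟ b))
      factor-0 : (d : Dec (b ≡ b)) → component-factor S (b , proj₁ (choose b d)) R.≈ R.0#
      factor-0 (no b≢b)     = contradiction ≡.refl b≢b
      factor-0 (yes ≡.refl) = R.trans (R.*-congˡ (inadmissible⇒α≈0 {r ∷ rs} ¬adm)) (R.zeroʳ _)

    X-outside-unicyclic : ¬ In𝒰 (spanning S) → X S ≈ 0#
    X-outside-unicyclic ¬p = decidable-stable (X S ≟ℂ 0#) λ X≉0 → ¬p (record
      { size       = ∣S∣≡n
      ; unicyclic  = All.map⁺ (All.universal unicyclic (leastVertices S))
      ; admissible = All.map⁺ (All.tabulate λ b∈ γ cyc → decidable-stable (admissible? γ) λ ¬adm →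
          X≉0 (X-inadmissible b∈ γ cyc ¬adm)) })

  -- The f supplied by `X-vanishes` is onto S by counting, which makes all components unicyclic.
  -- Membership in 𝒰(G) can then fail only through admissibility.
  X-outside : ∀ S → ∣ S ∣ ≡ n → ¬ In𝒰 (spanning S) → X S ≈ 0#
  X-outside S ∣S∣≡n ¬p = X-vanishes S λ f f-inj f∈S incident → X-outside-unicyclic S ∣S∣≡n
    (FunctionalGraph.component-unicyclic G S f (proj₁ ∘ incident) f∈S (proj₂ ∘ incident) f-inj (image-onto f f-inj ∣S∣≡n f∈S)) ¬p

  -- Names the summands of sumOver𝒰, which are local to its definition.
  summands : ∃ λ (s : Subset m → R.Carrier) → sumOver𝒰 term ≡ foldr R._+_ R.0# (map s (allSubsets m))
  summands = _ , ≡.refl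

  summand-value : ∀ S → ∑.[ ∣ S ∣ ℕ.≟ n ] X S ≈ fromℝ (proj₁ summands S)
  summand-value S with in𝒰? (spanning S)
  ... | yes p = trans (reflexive (∑.[]-yes (∣ S ∣ ℕ.≟ n) (In𝒰.size p) (X S))) (X-term S (In𝒰.size p) p)
  ... | no ¬p = vanish (∣ S ∣ ℕ.≟ n)
    where
    vanish : (d : Dec (∣ S ∣ ≡ n)) → ∑.[ d ] X S ≈ 0#
    vanish (yes ∣S∣≡n) = X-outside S ∣S∣≡n ¬p
    vanish (no _)      = refl

  fromℝ-listSum : ∀ {a} {T : Set a} {g : T → ℂ} {h : T → R.Carrier} → (∀ x → g x ≈ fromℝ (h x)) → ∀ xs →
                  ∑.listSum (map g xs) ≈ fromℝ (foldr R._+_ R.0# (map h xs))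
  fromℝ-listSum g≈h []       = refl
  fromℝ-listSum {g = g} {h} g≈h (x ∷ xs) = trans (+-cong (g≈h x) (fromℝ-listSum {g = g} {h} g≈h xs)) (sym (fromℝ-+ (h x) _))

  det-Q : det Q ≈ fromℝ (sumOver𝒰 term)
  det-Q = trans det-Q-expansion (trans (fromℝ-listSum summand-value (allSubsets m))
    (reflexive (≡.cong fromℝ (≡.sym (proj₂ summands)))))

theorem5p1 : ∀ {ℓ} (ℝ : Reals ℓ) →
    let open Complex ℝ
        open RawRing ℂ-rawRing
        open Determinant ℂ-rawRing
    in
    ∀ {n m : ℕ} (G : OrientedGraph n m) (w : Fin m → ℂ) →
    let open Graph G
        open Weighted ℝ G w
    in
    2 ≤ n → 1 ≤ m →
    WeaklyConnected →
    (∀ e → ¬ (w e ≈ 0#)) →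
    (∀ e → ¬ ℝ⁻ (w e)) →
    det Q ≈ fromℝ (sumOver𝒰 term)
theorem5p1 ℝ G w _ _ _ w≉0 _ = Assembly.det-Q ℝ G w w≉0
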